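{- Let $G$ be a finite abelian group of order $n \geq 2$. (1) If $n$ is even, then the maximum size of a $2$-incomplete subset of $G$ is $n/2$. Moreover, every element of $S(G,2)$ is of the form $n-n/d$ with $d$ an even divisor of $n$, and all such integers occur, with the only exception that $3n/4$ (the case $d=4$) occurs only when the exponent of $G$ is divisible by $4$. That is: if the exponent of $G$ is divisible by $4$, then $S(G,2)=\{n-n/d : d\mid n,\ 2\mid d\}$; if the exponent of $G$ is even but not divisible by $4$, then $S(G,2)=\{n-n/d : d\mid n,\ 2\mid d,\ d\neq 4\}$. (2) If $n$ is odd, then the maximum size of a $2$-incomplete subset of $G$ is $(n-1)/2$. Moreover, if $G$ is of order $3$, of order $5$, or is noncyclic of order $9$, then $S(G,2)=\{n-2\}$; for every other $G$ of odd order, $S(G,2)=\{n-2,n-1\}$.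
   Context: Let $G$ be a finite abelian group, written additively. For a positive integer $h$ and a nonempty subset $A\subseteq G$, $hA=\{a_1+\cdots+a_h : a_1,\dots,a_h\in A\}$ is the set of sums of $h$ not necessarily distinct elements of $A$. A nonempty subset $A$ is $h$-complete if $hA=G$ and $h$-incomplete if $hA\neq G$. The $h$-critical number is $\chi(G,h)=\min\{m\geq 1 : \text{every } A\subseteq G \text{ with } |A|\geq m \text{ satisfies } hA=G\}$; thus $\chi(G,h)-1$ is the maximum size of an $h$-incomplete subset. Define $S(G,h)=\{|hA| : A\subset G,\ |A|=\chi(G,h)-1,\ hA\neq G\}$, the set of sizes of $hA$ as $A$ ranges over the $h$-incomplete subsets of $G$ of maximum size. -}

module Defs where

open import Level using (Level; _⊔_; 0ℓ)
open import Algebra.Bundles using (AbelianGroup)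
import Algebra.Definitions.RawMonoid as RawMonoidDefs
import Algebra.Properties.Monoid.Mult as MonoidMult
import Algebra.Properties.Group as GroupProperties
open import Data.Bool.Base using (true)
open import Data.Empty using (⊥-elim)
open import Data.Fin.Base using (Fin; zero; suc; toℕ)
import Data.Fin.Properties as Fin
open import Data.Fin.Subset using (Subset; _∈_; ∣_∣; ⊤; Nonempty)
open import Data.Fin.Subset.Properties using (_∈?_; anySubset?; ∣p∣≤n)
open import Data.Integer.Base using (ℤ; +_; -[1+_])
open import Data.Nat.Base as ℕ using (ℕ; zero; suc; _≤_; _∸_; _!; s≤s; z≤n)
import Data.Nat.Properties as ℕ
open import Data.Nat.Divisibility using (_∣_; divides; ∣-trans; m∣m*n; m≤n⇒m!∣n!)
open import Data.Product.Base using (∃; ∃-syntax; _×_; _,_; proj₁; proj₂)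
import Data.Bool.Properties as Bool
open import Data.Vec.Base using (tabulate)
open import Data.Vec.Functional using (Vector; head; tail) renaming (_∷_ to _∷ᶠ_)
open import Data.Vec.Properties using (≡-dec; lookup∘tabulate; lookup⇒[]=; []=⇒lookup)
open import Function.Bundles using (Inverse; _⇔_; mk⇔)
open import Relation.Binary.PropositionalEquality as ≡ using (_≡_; _≢_)
open import Relation.Nullary using (Dec; yes; no; does; ¬?; _×-dec_; _→-dec_)
open import Relation.Nullary.Decidable using (map′; decidable-stable; dec-true)
open import Relation.Unary using (Pred; Decidable)

module _ {p : Level} where

  IsLeast : Pred ℕ p → Pred ℕ p
  IsLeast P m = P m × (∀ k → P k → m ≤ k)

  IsGreatest : Pred ℕ p → Pred ℕ p
  IsGreatest P m = P m × (∀ k → P k → k ≤ m)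

  least : {P : Pred ℕ p} → Decidable P → ∀ m → P m → ∃ (IsLeast P)
  least P? zero Pm = zero , Pm , λ _ _ → z≤n
  least {P} P? (suc m) Pm with P? zero
  ... | yes P0 = zero , P0 , λ _ _ → z≤n
  ... | no ¬P0 with least {P = λ k → P (suc k)} (λ k → P? (suc k)) m Pm
  ...   | l , Pl , min = suc l , Pl , min′
    where
    min′ : ∀ k → P k → suc l ≤ k
    min′ zero    P0 = ⊥-elim (¬P0 P0)
    min′ (suc k) Pk = s≤s (min k Pk)

infix 4 _HasOrder_

_HasOrder_ : ∀ {c ℓ} → AbelianGroup c ℓ → ℕ → Set (c ⊔ ℓ)
G HasOrder n = Inverse (AbelianGroup.setoid G) (≡.setoid (Fin n))

-- A subset of G is given by the set A : Subset n of the indices of its elements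
-- under the enumeration ι, so x belongs to it when to x ∈ A.
module FiniteAbelianGroup {c ℓ} (G : AbelianGroup c ℓ) {n : ℕ} (ι : G HasOrder n) where

  open AbelianGroup G
    renaming ( _∙_ to _+_ ; ε to 0# ; _⁻¹ to -_
             ; ∙-cong to +-cong ; ∙-congˡ to +-congˡ ; ∙-congʳ to +-congʳ
             ; assoc to +-assoc ; identityˡ to +-identityˡ ; identityʳ to +-identityʳ
             ; inverseˡ to -‿inverseˡ ; inverseʳ to -‿inverseʳ )
  open RawMonoidDefs rawMonoid using (sum) renaming (_×_ to _·_)
  open MonoidMult monoid using (×-congʳ; ×-homo-+; ×-assocˡ)
  open GroupProperties group using (∙-cancelˡ; \\-leftDividesˡ; \\-leftDividesʳ)
  open Inverse ι using (to; from; to-cong; from-cong; strictlyInverseˡ; strictlyInverseʳ)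

  infixr 8 _·ᶻ_

  _·ᶻ_ : ℤ → Carrier → Carrier
  (+ k)    ·ᶻ x = k · x
  -[1+ k ] ·ᶻ x = suc k · (- x)

  Cyclic : Set (c ⊔ ℓ)
  Cyclic = ∃[ g ] ∀ x → ∃[ k ] (k ·ᶻ g ≈ x)

  private
    infix 4 _≈?_
    _≈?_ : ∀ x y → Dec (x ≈ y)
    x ≈? y = map′ (λ eq → trans (sym (strictlyInverseʳ x))
                            (trans (from-cong eq) (strictlyInverseʳ y)))
                  to-cong (to x Fin.≟ to y)

  Annihilates : ℕ → Set (c ⊔ ℓ)
  Annihilates e = ∀ x → e · x ≈ 0#

  private
    annihilates? : Decidable Annihilates
    annihilates? e = map′
      (λ h x → trans (×-congʳ e (sym (strictlyInverseʳ x))) (h (to x)))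
      (λ h i → h (from i))
      (Fin.all? (λ i → e · from i ≈? 0#))

    ·-zero : ∀ q → q · 0# ≈ 0#
    ·-zero zero    = refl
    ·-zero (suc q) = trans (+-identityˡ _) (·-zero q)

    ∣-annihilates : ∀ {d e x} → d ∣ e → d · x ≈ 0# → e · x ≈ 0#
    ∣-annihilates {d} {x = x} (divides q ≡.refl) dx≈0 =
      trans (sym (×-assocˡ x q d)) (trans (×-congʳ q dx≈0) (·-zero q))

    ∣! : ∀ {k} → 1 ≤ k → k ≤ n → k ∣ n !
    ∣! {suc k} _ k≤n = ∣-trans (m∣m*n (k !)) (m≤n⇒m!∣n! k≤n)

    !-annihilates : Annihilates (n !)
    !-annihilates x
      with Fin.pigeonhole (ℕ.n<1+n n) (λ i → to (toℕ i · x))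
    ... | i , j , i<j , eq =
      ∣-annihilates (∣! (ℕ.m<n⇒0<n∸m i<j)
                        (ℕ.≤-trans (ℕ.m∸n≤m (toℕ j) (toℕ i)) (Fin.toℕ≤pred[n] j)))
        (∙-cancelˡ (toℕ i · x) _ _
          (trans (sym (×-homo-+ x (toℕ i) (toℕ j ∸ toℕ i)))
          (trans (reflexive (≡.cong (_· x) (ℕ.m+[n∸m]≡n (ℕ.<⇒≤ i<j))))
          (trans (sym ix≈jx) (sym (+-identityʳ _))))))
      where
      ix≈jx : toℕ i · x ≈ toℕ j · x
      ix≈jx = trans (sym (strictlyInverseʳ _)) (trans (from-cong eq) (strictlyInverseʳ _))

  exponent-exists : ∃ (IsLeast (λ e → 1 ≤ e × Annihilates e))
  exponent-exists =
    least (λ e → (1 ℕ.≤? e) ×-dec annihilates? e) (n !) (ℕ.1≤n! n , !-annihilates)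

  exponent : ℕ
  exponent = proj₁ exponent-exists

  IsSumOf : ℕ → Subset n → Carrier → Set (c ⊔ ℓ)
  IsSumOf h A g = ∃[ a ] (∀ (i : Fin h) → to (a i) ∈ A) × sum a ≈ g

  private
    isSumOf-cong : ∀ {h A x y} → x ≈ y → IsSumOf h A x → IsSumOf h A y
    isSumOf-cong x≈y (a , a∈A , eq) = a , a∈A , trans eq x≈y

  isSumOf? : ∀ h A → Decidable (IsSumOf h A)
  isSumOf? zero A g =
    map′ (λ eq → (λ ()) , (λ ()) , eq) (λ (_ , _ , eq) → eq) (0# ≈? g)
  isSumOf? (suc h) A g = map′ cons uncons
    (Fin.any? (λ i → (i ∈? A) ×-dec isSumOf? h A (- from i + g)))
    where
    cons : ∃[ i ] (i ∈ A × IsSumOf h A (- from i + g)) → IsSumOf (suc h) A g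
    cons (i , i∈A , a , a∈A , eq) =
      from i ∷ᶠ a ,
      (λ { zero    → ≡.subst (_∈ A) (≡.sym (strictlyInverseˡ i)) i∈A
         ; (suc j) → a∈A j }) ,
      trans (+-congˡ eq) (\\-leftDividesˡ (from i) g)

    uncons : IsSumOf (suc h) A g → ∃[ i ] (i ∈ A × IsSumOf h A (- from i + g))
    uncons (a , a∈A , eq) =
      to (head a) , a∈A zero , tail a , (λ j → a∈A (suc j)) ,
      trans (sym (\\-leftDividesʳ (head a) (sum (tail a))))
            (+-cong (⁻¹-cong (sym (strictlyInverseʳ (head a)))) eq)

  -- h ⋆ A is the sumset hA.
  infixr 8 _⋆_

  _⋆_ : ℕ → Subset n → Subset n
  h ⋆ A = tabulate (λ i → does (isSumOf? h A (from i)))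

  ∈-⋆ : ∀ {h A g} → to g ∈ h ⋆ A ⇔ IsSumOf h A g
  ∈-⋆ {h} {A} {g} = mk⇔ sound complete
    where
    at : Dec (IsSumOf h A (from (to g)))
    at = isSumOf? h A (from (to g))

    witness : ∀ {P : Set (c ⊔ ℓ)} (P? : Dec P) → does P? ≡ true → P
    witness (yes p) _ = p

    sound : to g ∈ h ⋆ A → IsSumOf h A g
    sound g∈ = isSumOf-cong (strictlyInverseʳ g)
      (witness at (≡.trans (≡.sym (lookup∘tabulate _ (to g))) ([]=⇒lookup g∈)))

    complete : IsSumOf h A g → to g ∈ h ⋆ A
    complete s = lookup⇒[]= (to g) _
      (≡.trans (lookup∘tabulate _ (to g))
               (dec-true at (isSumOf-cong (sym (strictlyInverseʳ g)) s)))

  Incomplete : ℕ → Pred (Subset n) 0ℓ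
  Incomplete h A = Nonempty A × h ⋆ A ≢ ⊤

  IncompleteSize : ℕ → Pred ℕ 0ℓ
  IncompleteSize h m = ∃[ A ] Incomplete h A × ∣ A ∣ ≡ m

  ForcesComplete : ℕ → Pred ℕ 0ℓ
  ForcesComplete h m = 1 ≤ m × (∀ A → m ≤ ∣ A ∣ → h ⋆ A ≡ ⊤)

  private
    infix 4 _≟ˢ_
    _≟ˢ_ : (A B : Subset n) → Dec (A ≡ B)
    _≟ˢ_ = ≡-dec Bool._≟_

    forcesComplete? : ∀ h → Decidable (ForcesComplete h)
    forcesComplete? h m = (1 ℕ.≤? m) ×-dec map′
      (λ ¬∃ A m≤A → decidable-stable (h ⋆ A ≟ˢ ⊤) (λ A≢⊤ → ¬∃ (A , m≤A , A≢⊤)))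
      (λ all (A , m≤A , A≢⊤) → A≢⊤ (all A m≤A))
      (¬? (anySubset? (λ A → (m ℕ.≤? ∣ A ∣) ×-dec ¬? (h ⋆ A ≟ˢ ⊤))))

  χ-exists : ∀ h → ∃ (IsLeast (ForcesComplete h))
  χ-exists h = least (forcesComplete? h) (suc n)
    (s≤s z≤n , λ A n<A → ⊥-elim (ℕ.<⇒≱ n<A (∣p∣≤n A)))

  χ : ℕ → ℕ
  χ h = proj₁ (χ-exists h)

  S : ℕ → Pred ℕ 0ℓ
  S h k = ∃[ A ] Incomplete h A × ∣ A ∣ ≡ χ h ∸ 1 × ∣ h ⋆ A ∣ ≡ k

-- An element g is missing from 2A exactly when A is disjoint from g − A, hence 2|A| ≤ n.
--
-- Let n be even and |A| = n/2. Then g is missing iff g − A is the complement of A, so the missing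
-- elements form a coset of the stabilizer H of A, and |2A| = n − |H|. As A is a union of H-cosets,
-- n/|H| is even. If n/|H| = 4, then A = (a + H) ∪ (b + H), where b − a has order 4 modulo H: otherwise
-- it would stabilize A. Conversely, choose subgroups H ≤ G₀ with |G₀| = n/2 and g ∉ G₀; then
-- (G₀ ∖ H) ∪ (g + H) misses exactly g + H, provided |G₀| ≠ 2|H| or 2g ∉ H. When 4 divides the exponent,
-- a maximal subgroup among those containing 4G but not a suitable element 2y has cyclic quotient of order 4.
--
-- Let n be odd and |A| = (n − 1)/2. If 2c is missing, then x ↦ 2c − x maps the complement of A
-- without c onto A. For three missing elements 2c, 2d, 2e, composing these reflections in two ways
-- starting from e puts e − 2c + 2d both inside and outside A; so |2A| ≥ n − 2.
-- For the attained sizes, take t of order 2k + 1, H = ⟨t⟩, and a union P of cosets of H containing one of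
-- ±C for each coset C ≠ H. Then {t, …, kt} ∪ P misses just 0 and t. To lose only 0, replace kt by (k + 1)t
-- if k ≥ 3, and otherwise replace some x ∈ P by −x. In the noncyclic group of order 9 the set A contains
-- a line, so that |2A| ≤ 7.

module Submission where

open import Defs
open import Algebra.Bundles using (AbelianGroup)
import Algebra.Definitions.RawMonoid as RawMonoidDefs
import Algebra.Properties.AbelianGroup as AbelianGroupProperties
import Algebra.Properties.CommutativeMonoid.Mult as CommutativeMonoidMult
import Data.Bool.Properties as Bool
open import Data.Bool.Base using (true)
open import Data.Fin.Base using (Fin; zero; suc; toℕ; fromℕ<; inject₁)
import Data.Fin.Properties as Fin
open import Data.Fin.Subset using (Subset; _∈_; _∉_; _⊆_; ∣_∣; ∁; _∪_; _─_; ⊤; inside; outside; ⁅_⁆; Nonempty) renaming (⊥ to ∅; _-_ to _∖_)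
open import Data.Fin.Subset.Properties
open import Data.Integer.Base as ℤ using (-[1+_])
open import Data.List.Base using (List; []; _∷_; length)
open import Data.List.Relation.Unary.All using (All; []; _∷_)
open import Data.List.Relation.Unary.Any using (Any; here; there)
open import Data.Nat.Base as ℕ using (ℕ; zero; suc; _≤_; _<_; _∸_; _/_; _%_; z≤n; s≤s)
open import Data.Nat.Divisibility
open import Data.Nat.DivMod using (m≡m%n+[m/n]*n; m%n<n; m*n/n≡m)
open import Data.Nat.ListAction using (product)
open import Data.Nat.Primality using (Prime; euclidsLemma; prime⇒nonZero; prime⇒nonTrivial; prime⇒irreducible; prime[2]; irreducible[2])
open import Data.Nat.Primality.Factorisation using (PrimeFactorisation; factorise)
import Data.Nat.Properties as ℕ
open import Data.Product.Base using (∃; ∃-syntax; Σ-syntax; _×_; _,_; proj₁; proj₂)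
open import Data.Sum.Base using (_⊎_; inj₁; inj₂; [_,_]′)
open import Data.Vec.Base using (Vec; []; _∷_; here; there; lookup; zipWith; replicate; allFin; map; tabulate)
open import Data.Vec.N-ary using (N-ary; _$ⁿ_)
open import Data.Vec.Properties using (≡-dec; lookup∘tabulate; lookup⇒[]=; []=⇒lookup)
open import Function.Base using (_∘_; _|>_)
open import Function.Bundles using (Inverse; Equivalence; _⇔_; mk⇔)
open import Level using (_⊔_)
open import Relation.Binary.Definitions using (_Respects_; tri<; tri≈; tri>)
open import Relation.Binary.PropositionalEquality as ≡ using (_≡_; _≢_)
open import Relation.Nullary using (¬_; Dec; yes; no; does; contradiction; ¬?; _×-dec_; _⊎-dec_)
open import Relation.Nullary.Decidable using (map′; dec-true; decidable-stable; from-no)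
open import Relation.Unary using (Decidable)

-- No quotient group is ever formed: orders, Lagrange and Cauchy are all stated relative to a
-- subgroup `H`, as differences or multiples lying in `H`. The relative form of Cauchy's theorem is
-- what yields H ≤ G₀ with both orders prescribed.
--
-- The exception d = 4 is the case |G₀| = 2|H|. Then only one coset of H is left in G₀ after the
-- swap, and if 2g ∈ H the doubles of both remaining cosets equal H, so that a further coset is
-- missing.
--
-- In odd order the exceptions come from k = 1 and k = 2, where {1, ..., k} is kept and an x outside
-- H is flipped. Such an x needs H ≠ G, which fails in orders 3 and 5. The flip also endangers the
-- sum x + t. For k = 2 it is 2t + (x - t); for k = 1 it has to come from y and x - y in P, and a
-- suitable y is found when H has more than four cosets. Odd multiples of 3 beyond 9 are large
-- enough. In order 9 there are only three cosets of a subgroup of order 3; the cyclic group escapes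
-- through an element of order 9, that is k = 4.

-- Cardinalities of subsets of `Fin n`.

module Counting where

  private
    variable
      m n : ℕ
      p q : Subset n

  ∣p∣≡1+∣p∖x∣ : ∀ {x} → x ∈ p → ∣ p ∣ ≡ suc ∣ p ∖ x ∣
  ∣p∣≡1+∣p∖x∣ {p = inside ∷ p} here = ≡.cong (suc ∘ ∣_∣) (≡.sym (p─⊥≡p p))
  ∣p∣≡1+∣p∖x∣ {p = outside ∷ p} (there x∈p) = ∣p∣≡1+∣p∖x∣ x∈p
  ∣p∣≡1+∣p∖x∣ {p = inside ∷ p} (there x∈p) = ≡.cong suc (∣p∣≡1+∣p∖x∣ x∈p)

  ∣p∪q∣≤∣p∣+∣q∣ : ∀ (p q : Subset n) → ∣ p ∪ q ∣ ≤ ∣ p ∣ ℕ.+ ∣ q ∣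
  ∣p∪q∣≤∣p∣+∣q∣ [] [] = z≤n
  ∣p∪q∣≤∣p∣+∣q∣ (outside ∷ p) (outside ∷ q) = ∣p∪q∣≤∣p∣+∣q∣ p q
  ∣p∪q∣≤∣p∣+∣q∣ (outside ∷ p) (inside ∷ q) =
    ≡.subst (suc ∣ p ∪ q ∣ ≤_) (≡.sym (ℕ.+-suc ∣ p ∣ ∣ q ∣)) (s≤s (∣p∪q∣≤∣p∣+∣q∣ p q))
  ∣p∪q∣≤∣p∣+∣q∣ (inside ∷ p) (outside ∷ q) = s≤s (∣p∪q∣≤∣p∣+∣q∣ p q)
  ∣p∪q∣≤∣p∣+∣q∣ (inside ∷ p) (inside ∷ q) =
    s≤s (ℕ.≤-trans (∣p∪q∣≤∣p∣+∣q∣ p q) (ℕ.+-monoʳ-≤ ∣ p ∣ (ℕ.n≤1+n _)))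

  disjoint⇒∣p∪q∣ : (p q : Subset n) → (∀ {x} → x ∈ p → x ∉ q) → ∣ p ∪ q ∣ ≡ ∣ p ∣ ℕ.+ ∣ q ∣
  disjoint⇒∣p∪q∣ [] [] _ = ≡.refl
  disjoint⇒∣p∪q∣ (outside ∷ p) (outside ∷ q) p#q =
    disjoint⇒∣p∪q∣ p q (λ x∈p → p#q (there x∈p) ∘ there)
  disjoint⇒∣p∪q∣ (outside ∷ p) (inside ∷ q) p#q =
    ≡.trans (≡.cong suc (disjoint⇒∣p∪q∣ p q (λ x∈p → p#q (there x∈p) ∘ there)))
          (≡.sym (ℕ.+-suc ∣ p ∣ ∣ q ∣))
  disjoint⇒∣p∪q∣ (inside ∷ p) (outside ∷ q) p#q =
    ≡.cong suc (disjoint⇒∣p∪q∣ p q (λ x∈p → p#q (there x∈p) ∘ there))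
  disjoint⇒∣p∪q∣ (inside ∷ p) (inside ∷ q) p#q = contradiction here (p#q here)

  x∈p∖y⁻ : ∀ {x y} (p : Subset n) → x ∈ p ∖ y → x ∈ p × x ≢ y
  x∈p∖y⁻ {y = y} p x∈ = p─q⊆p p ⁅ y ⁆ x∈ , λ { ≡.refl → x∉p∖x p x∈ }
    where
    x∉p∖x : ∀ {n} (p : Subset n) {x} → x ∉ p ∖ x
    x∉p∖x (inside ∷ p) {suc x} (there x∈) = x∉p∖x p x∈
    x∉p∖x (outside ∷ p) {suc x} (there x∈) = x∉p∖x p x∈
    x∉p∖x (inside ∷ p) {zero} ()
    x∉p∖x (outside ∷ p) {zero} ()

  injection⇒∣∣≤ : (f : Fin m → Fin n) {p : Subset m} {q : Subset n} →
    (∀ {i} → i ∈ p → f i ∈ q) →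
    (∀ {i j} → i ∈ p → j ∈ p → f i ≡ f j → i ≡ j) → ∣ p ∣ ≤ ∣ q ∣
  injection⇒∣∣≤ f {[]} _ _ = z≤n
  injection⇒∣∣≤ f {outside ∷ p} f∈ f-inj = injection⇒∣∣≤ (f ∘ suc) (f∈ ∘ there)
    (λ i∈ j∈ eq → Fin.suc-injective (f-inj (there i∈) (there j∈) eq))
  injection⇒∣∣≤ f {inside ∷ p} {q} f∈ f-inj = ≡.subst (suc ∣ p ∣ ≤_) (≡.sym (∣p∣≡1+∣p∖x∣ (f∈ here)))
    (s≤s (injection⇒∣∣≤ (f ∘ suc) {p} {q ∖ f zero}
      (λ i∈ → x∈p∧x≢y⇒x∈p-y (f∈ (there i∈)) (λ eq → contradiction (f-inj (there i∈) here eq) λ ()))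
      (λ i∈ j∈ eq → Fin.suc-injective (f-inj (there i∈) (there j∈) eq))))

  ⊆∧∣∣≥⇒⊇ : p ⊆ q → ∣ q ∣ ≤ ∣ p ∣ → q ⊆ p
  ⊆∧∣∣≥⇒⊇ {p = p} {q} p⊆q q≤p {x} x∈q = decidable-stable (x ∈? p) λ x∉p →
    ℕ.≤⇒≯ q≤p (p⊂q⇒∣p∣<∣q∣ (p⊆q , x , x∈q , x∉p))

  ∣∣<⇒∃∉ : ∀ (p q : Subset n) → ∣ p ∣ < ∣ q ∣ → ∃[ x ] (x ∈ q × x ∉ p)
  ∣∣<⇒∃∉ p q p<q with nonempty? (q ─ p)
  ... | yes (x , x∈) = x , p─q⊆p q p x∈ , x∉ q p x∈
    where
    x∉ : ∀ {n x} (q p : Subset n) → x ∈ q ─ p → x ∉ p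
    x∉ (s ∷ q) (inside ∷ p) () here
    x∉ (s ∷ q) (t ∷ p) (there a) (there b) = x∉ q p a b
  ... | no empty = contradiction (p⊆q⇒∣p∣≤∣q∣ q⊆p) (ℕ.<⇒≱ p<q)
    where
    q⊆p : q ⊆ p
    q⊆p {x} x∈q = decidable-stable (x ∈? p) λ x∉p → empty (x , x∈p∧x∉q⇒x∈p─q x∈q x∉p)

  1≤∣p∣⇒Nonempty : 1 ≤ ∣ p ∣ → Nonempty p
  1≤∣p∣⇒Nonempty {n} {p} 1≤∣p∣ =
    let (x , x∈p , _) = ∣∣<⇒∃∉ ∅ p (≡.subst (_< ∣ p ∣) (≡.sym (∣⊥∣≡0 n)) 1≤∣p∣) in x , x∈p

  ∣∁p∣+∣p∣≡n : (p : Subset n) → ∣ ∁ p ∣ ℕ.+ ∣ p ∣ ≡ n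
  ∣∁p∣+∣p∣≡n p = ≡.trans (≡.cong (ℕ._+ ∣ p ∣) (∣∁p∣≡n∸∣p∣ p)) (ℕ.m∸n+n≡m (∣p∣≤n p))

  -- Sizes are bounded by `n`, so enlarging must stop. This replaces every choice of a maximal
  -- subset below: cosets inside a stable set, Cauchy's theorem, cyclic quotients of order 4, and
  -- the completion of half-systems.
  exhaust : ∀ {a b} {Q : Subset n → Set a} {R : Set b} →
    (∀ p → Q p → R ⊎ ∃[ q ] (Q q × ∣ p ∣ < ∣ q ∣)) → ∀ p → Q p → R
  exhaust {n = n} {Q = Q} {R} step p Qp = go (suc n) p Qp (ℕ.m≤n+m (suc n) ∣ p ∣)
    where
    go : ∀ k p → Q p → n < ∣ p ∣ ℕ.+ k → R
    go zero p _ n< = contradiction (∣p∣≤n p) (ℕ.<⇒≱ (≡.subst (n <_) (ℕ.+-identityʳ _) n<))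
    go (suc k) p Qp n< with step p Qp
    ... | inj₁ r = r
    ... | inj₂ (q , Qq , p<q) = go k q Qq
      (ℕ.<-≤-trans n< (≡.subst (_≤ ∣ q ∣ ℕ.+ k) (≡.sym (ℕ.+-suc ∣ p ∣ k)) (ℕ.+-monoˡ-≤ k p<q)))

open Counting

-- Divisors of small numbers, parity and halving.

∣4⁻ : ∀ {r} → r ∣ 4 → r ≡ 1 ⊎ r ≡ 2 ⊎ r ≡ 4
∣4⁻ {0} 0∣4 = contradiction 0∣4 (from-no (0 ∣? 4))
∣4⁻ {1} _ = inj₁ ≡.refl
∣4⁻ {2} _ = inj₂ (inj₁ ≡.refl)
∣4⁻ {3} 3∣4 = contradiction 3∣4 (from-no (3 ∣? 4))
∣4⁻ {4} _ = inj₂ (inj₂ ≡.refl)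
∣4⁻ {suc (suc (suc (suc (suc _))))} r∣4 with s≤s (s≤s (s≤s (s≤s ()))) ← ∣⇒≤ r∣4

∣9⁻ : ∀ {r} → r ∣ 9 → r ≡ 1 ⊎ r ≡ 3 ⊎ r ≡ 9
∣9⁻ {r} r∣9 = by r (∣⇒≤ r∣9) r∣9
  where
  by : ∀ r → r ≤ 9 → r ∣ 9 → r ≡ 1 ⊎ r ≡ 3 ⊎ r ≡ 9
  by 0 _ r∣9 = contradiction r∣9 (from-no (0 ∣? 9))
  by 1 _ _ = inj₁ ≡.refl
  by 2 _ r∣9 = contradiction r∣9 (from-no (2 ∣? 9))
  by 3 _ _ = inj₂ (inj₁ ≡.refl)
  by 4 _ r∣9 = contradiction r∣9 (from-no (4 ∣? 9))
  by 5 _ r∣9 = contradiction r∣9 (from-no (5 ∣? 9))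
  by 6 _ r∣9 = contradiction r∣9 (from-no (6 ∣? 9))
  by 7 _ r∣9 = contradiction r∣9 (from-no (7 ∣? 9))
  by 8 _ r∣9 = contradiction r∣9 (from-no (8 ∣? 9))
  by 9 _ _ = inj₂ (inj₂ ≡.refl)
  by (suc (suc (suc (suc (suc (suc (suc (suc (suc (suc _)))))))))) r≤9 _ = contradiction r≤9 (ℕ.m+n≮m 9 _)

odd-form : ∀ m → ¬ 2 ∣ m → ∃[ k ] m ≡ suc (k ℕ.+ k)
odd-form zero          ¬2∣m = contradiction (2 ∣0) ¬2∣m
odd-form (suc zero)    _    = 0 , ≡.refl
odd-form (suc (suc m)) ¬2∣m = let (k , eq) = odd-form m (λ 2∣m → ¬2∣m (∣m∣n⇒∣m+n ∣-refl 2∣m)) in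
  suc k , ≡.cong (λ i → suc (suc i)) (≡.trans eq (≡.sym (ℕ.+-suc k k)))

∣∧<⇒≡ : ∀ {r m} → 1 ≤ m → m < r ℕ.+ r → r ∣ m → m ≡ r
∣∧<⇒≡ 1≤m m<2r (divides zero ≡.refl) = contradiction 1≤m λ ()
∣∧<⇒≡ {r} 1≤m m<2r (divides 1 eq) = ≡.trans eq (ℕ.+-identityʳ r)
∣∧<⇒≡ {r} 1≤m m<2r (divides (suc (suc c)) ≡.refl) = contradiction m<2r
  (ℕ.≤⇒≯ (ℕ.+-monoʳ-≤ r (ℕ.m≤m+n r (c ℕ.* r))))

2∣⇒≡q+q : ∀ {n} (2∣n : 2 ∣ n) → n ≡ quotient 2∣n ℕ.+ quotient 2∣n
2∣⇒≡q+q (divides q n≡q*2) = ≡.trans n≡q*2 (≡.trans (ℕ.*-comm q 2) (≡.cong (q ℕ.+_) (ℕ.+-identityʳ q)))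

1<1+q+q⇒1≤q : ∀ {q} → 1 < suc (q ℕ.+ q) → 1 ≤ q
1<1+q+q⇒1≤q {zero}  (s≤s ())
1<1+q+q⇒1≤q {suc q} _ = s≤s z≤n

q+q/2≡q : ∀ q → (q ℕ.+ q) / 2 ≡ q
q+q/2≡q q = ≡.trans (≡.cong (_/ 2) (≡.trans (≡.cong (q ℕ.+_) (≡.sym (ℕ.+-identityʳ q))) (ℕ.*-comm 2 q))) (m*n/n≡m q 2)

-- A solver for linear identities in an abelian group.

module AbelianGroupSolver {c ℓ} (G : AbelianGroup c ℓ) where
  open AbelianGroup G
    renaming ( _∙_ to _+_; ε to 0#; _⁻¹ to -_; _-_ to _∸_; ∙-cong to +-cong; ∙-congˡ to +-congˡ; ∙-congʳ to +-congʳ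
             ; assoc to +-assoc; identityˡ to +-identityˡ; identityʳ to +-identityʳ; comm to +-comm
             ; inverseˡ to -‿inverseˡ; inverseʳ to -‿inverseʳ; ⁻¹-cong to -‿cong )
  open RawMonoidDefs rawMonoid using () renaming (_×_ to _·_)
  open AbelianGroupProperties G using (⁻¹-∙-comm; ⁻¹-involutive; ε⁻¹≈ε; ∙-cancelʳ)
  open CommutativeMonoidMult commutativeMonoid using (×-homo-+)
  open import Relation.Binary.Reasoning.Setoid setoid
  open import Algebra.Properties.CommutativeSemigroup commutativeSemigroup using (interchange)

  infixl 6 _⊕_ _⊖_
  infix  8 ⊝_
  infixr 7 _⊛_
  infix  4 _⊜_

  data Expr (k : ℕ) : Set where
    var     : Fin k → Expr k
    𝟘       : Expr k
    _⊕_ _⊖_ : Expr k → Expr k → Expr k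
    ⊝_      : Expr k → Expr k
    _⊛_     : ℕ → Expr k → Expr k

  ⟦_⟧ : ∀ {k} → Expr k → Vec Carrier k → Carrier
  ⟦ var i ⟧ ρ = lookup ρ i
  ⟦ 𝟘 ⟧ ρ     = 0#
  ⟦ a ⊕ b ⟧ ρ = ⟦ a ⟧ ρ + ⟦ b ⟧ ρ
  ⟦ a ⊖ b ⟧ ρ = ⟦ a ⟧ ρ + - ⟦ b ⟧ ρ
  ⟦ ⊝ a ⟧ ρ   = - ⟦ a ⟧ ρ
  ⟦ m ⊛ a ⟧ ρ = m · ⟦ a ⟧ ρ

  -- An expression denotes pos − neg with coefficient vectors in ℕ, so that two
  -- expressions agree once pos₁ + neg₂ and pos₂ + neg₁ have the same coefficients.
  private
    Coeffs : ℕ → Set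
    Coeffs = Vec ℕ

    _⊞_ : ∀ {k} → Coeffs k → Coeffs k → Coeffs k
    _⊞_ = zipWith ℕ._+_

    unit : ∀ {k} → Fin k → Coeffs k
    unit zero    = 1 ∷ replicate _ 0
    unit (suc i) = 0 ∷ unit i

    _⊠_ : ∀ {k} → ℕ → Coeffs k → Coeffs k
    zero  ⊠ v = replicate _ 0
    suc m ⊠ v = v ⊞ (m ⊠ v)

    pos neg : ∀ {k} → Expr k → Coeffs k
    pos (var i) = unit i
    pos 𝟘       = replicate _ 0
    pos (a ⊕ b) = pos a ⊞ pos b
    pos (a ⊖ b) = pos a ⊞ neg b
    pos (⊝ a)   = neg a
    pos (m ⊛ a) = m ⊠ pos a
    neg (var i) = replicate _ 0
    neg 𝟘       = replicate _ 0
    neg (a ⊕ b) = neg a ⊞ neg b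
    neg (a ⊖ b) = neg a ⊞ pos b
    neg (⊝ a)   = pos a
    neg (m ⊛ a) = m ⊠ neg a

    eval : ∀ {k} → Coeffs k → Vec Carrier k → Carrier
    eval []      []      = 0#
    eval (m ∷ v) (x ∷ ρ) = m · x + eval v ρ

    eval-0 : ∀ {k} (ρ : Vec Carrier k) → eval (replicate k 0) ρ ≈ 0#
    eval-0 []      = refl
    eval-0 (x ∷ ρ) = trans (+-identityˡ _) (eval-0 ρ)

    eval-⊞ : ∀ {k} (v w : Coeffs k) (ρ : Vec Carrier k) → eval (v ⊞ w) ρ ≈ eval v ρ + eval w ρ
    eval-⊞ []      []      []      = sym (+-identityˡ 0#)
    eval-⊞ (m ∷ v) (l ∷ w) (x ∷ ρ) =
      trans (+-cong (×-homo-+ x m l) (eval-⊞ v w ρ)) (interchange _ _ _ _)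

    eval-unit : ∀ {k} (i : Fin k) (ρ : Vec Carrier k) → eval (unit i) ρ ≈ lookup ρ i
    eval-unit zero    (x ∷ ρ) = trans (+-cong (+-identityʳ x) (eval-0 ρ)) (+-identityʳ x)
    eval-unit (suc i) (x ∷ ρ) = trans (+-identityˡ _) (eval-unit i ρ)

    difference-+ : ∀ a b a′ b′ → (a + a′) + - (b + b′) ≈ (a + - b) + (a′ + - b′)
    difference-+ a b a′ b′ = trans (+-congˡ (sym (⁻¹-∙-comm b b′))) (interchange a a′ (- b) (- b′))

    difference-neg : ∀ a b → - (a + - b) ≈ b + - a
    difference-neg a b = trans (sym (⁻¹-∙-comm a (- b)))
      (trans (+-congˡ (⁻¹-involutive b)) (+-comm (- a) b))

    correct : ∀ {k} (e : Expr k) (ρ : Vec Carrier k) → ⟦ e ⟧ ρ ≈ eval (pos e) ρ + - eval (neg e) ρ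
    correct-+ : ∀ {k} (p q p′ q′ : Coeffs k) (ρ : Vec Carrier k) →
      eval (p ⊞ p′) ρ + - eval (q ⊞ q′) ρ ≈ (eval p ρ + - eval q ρ) + (eval p′ ρ + - eval q′ ρ)
    correct-+ p q p′ q′ ρ = trans (+-cong (eval-⊞ p p′ ρ) (-‿cong (eval-⊞ q q′ ρ))) (difference-+ _ _ _ _)

    correct-0 : ∀ {k} (ρ : Vec Carrier k) → 0# ≈ eval (replicate k 0) ρ + - eval (replicate k 0) ρ
    correct-0 ρ = sym (-‿inverseʳ _)

    correct-⊛ : ∀ {k} m (e : Expr k) (ρ : Vec Carrier k) →
      m · ⟦ e ⟧ ρ ≈ eval (m ⊠ pos e) ρ + - eval (m ⊠ neg e) ρ
    correct-⊛ zero    e ρ = correct-0 ρ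
    correct-⊛ (suc m) e ρ = trans (+-cong (correct e ρ) (correct-⊛ m e ρ))
      (sym (correct-+ (pos e) (neg e) (m ⊠ pos e) (m ⊠ neg e) ρ))

    correct (var i) ρ = sym (trans (+-cong (eval-unit i ρ) (trans (-‿cong (eval-0 ρ)) ε⁻¹≈ε)) (+-identityʳ _))
    correct 𝟘       ρ = correct-0 ρ
    correct (a ⊕ b) ρ = trans (+-cong (correct a ρ) (correct b ρ))
      (sym (correct-+ (pos a) (neg a) (pos b) (neg b) ρ))
    correct (a ⊖ b) ρ = trans (+-cong (correct a ρ) (trans (-‿cong (correct b ρ)) (difference-neg _ _)))
      (sym (correct-+ (pos a) (neg a) (neg b) (pos b) ρ))
    correct (⊝ a)   ρ = trans (-‿cong (correct a ρ)) (difference-neg _ _)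
    correct (m ⊛ a) ρ = correct-⊛ m a ρ

    shift-sides : ∀ {a b a′ b′} → a + b′ ≈ a′ + b → a + - b ≈ a′ + - b′
    shift-sides {a} {b} {a′} {b′} eq = ∙-cancelʳ (b + b′) _ _ (begin
      (a + - b) + (b + b′)   ≈⟨ interchange a (- b) b b′ ⟩
      (a + b) + (- b + b′)   ≈⟨ interchange a b (- b) b′ ⟩
      (a + - b) + (b + b′)   ≈⟨ sym (+-assoc _ b b′) ⟩
      ((a + - b) + b) + b′   ≈⟨ +-congʳ (cancel a b) ⟩
      a + b′                 ≈⟨ eq ⟩
      a′ + b                 ≈⟨ +-congʳ (sym (cancel a′ b′)) ⟩
      ((a′ + - b′) + b′) + b ≈⟨ +-assoc _ b′ b ⟩
      (a′ + - b′) + (b′ + b) ≈⟨ +-congˡ (+-comm b′ b) ⟩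
      (a′ + - b′) + (b + b′) ∎)
      where
      cancel : ∀ x y → (x + - y) + y ≈ x
      cancel x y = trans (+-assoc x (- y) y) (trans (+-congˡ (-‿inverseˡ y)) (+-identityʳ x))

  data Equation (k : ℕ) : Set where
    _⊜_ : Expr k → Expr k → Equation k

  Holds : ∀ {k} → Equation k → Vec Carrier k → Set ℓ
  Holds (a ⊜ b) ρ = ⟦ a ⟧ ρ ≈ ⟦ b ⟧ ρ

  Balanced : ∀ {k} → Equation k → Set
  Balanced (a ⊜ b) = pos a ⊞ neg b ≡ pos b ⊞ neg a

  private
    balanced⇒holds : ∀ {k} (e : Equation k) (ρ : Vec Carrier k) → Balanced e → Holds e ρ
    balanced⇒holds (a ⊜ b) ρ eq = trans (correct a ρ) (trans (shift-sides (begin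
      eval (pos a) ρ + eval (neg b) ρ ≈⟨ sym (eval-⊞ (pos a) (neg b) ρ) ⟩
      eval (pos a ⊞ neg b) ρ          ≡⟨ ≡.cong (λ v → eval v ρ) eq ⟩
      eval (pos b ⊞ neg a) ρ          ≈⟨ eval-⊞ (pos b) (neg a) ρ ⟩
      eval (pos b) ρ + eval (neg a) ρ ∎)) (sym (correct b ρ)))

  -- `Balanced` compares vectors of numerals that compute, so each use closes it by `≡.refl`.
  solve : ∀ {k} (ρ : Vec Carrier k) (f : N-ary k (Expr k) (Equation k)) →
    Balanced (f $ⁿ map var (allFin k)) → Holds (f $ⁿ map var (allFin k)) ρ
  solve ρ f = balanced⇒holds (f $ⁿ map var (allFin _)) ρ

  infix 1 _⇒_

  -- Lets the solver use a hypothesis: adding `a ≈ b` crosswise turns the goal into an unconditional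
  -- identity.
  _⇒_ : ∀ {a b x y} → a ≈ b → x + b ≈ y + a → x ≈ y
  _⇒_ {a} {b} {x} {y} a≈b eq = ∙-cancelʳ b x y (trans eq (+-congˡ a≈b))

-- Membership, comprehension and counting in a finite abelian group.

module Sumsets {c ℓ} (G : AbelianGroup c ℓ) {n : ℕ} (ι : G HasOrder n) where

  open AbelianGroup G public
    renaming ( _∙_ to _+_; ε to 0#; _⁻¹ to infix 8 -_; ∙-cong to +-cong; ∙-congˡ to +-congˡ; ∙-congʳ to +-congʳ
             ; assoc to +-assoc; identityˡ to +-identityˡ; identityʳ to +-identityʳ; comm to +-comm
             ; inverseˡ to -‿inverseˡ; inverseʳ to -‿inverseʳ; ⁻¹-cong to -‿cong )
    hiding (_-_)
  open RawMonoidDefs rawMonoid public using () renaming (_×_ to infixr 8 _·_)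
  open AbelianGroupProperties G public using (⁻¹-∙-comm; ⁻¹-involutive; ε⁻¹≈ε; ∙-cancelʳ; ∙-cancelˡ; ⁻¹-injective)
  open CommutativeMonoidMult commutativeMonoid public using (×-homo-+; ×-assocˡ; ×-distrib-+; ×-congʳ; ×-congˡ)
  open AbelianGroupSolver G public
  open FiniteAbelianGroup G ι public
  open Inverse ι public using (to; from; to-cong; from-cong; strictlyInverseˡ; strictlyInverseʳ)

  infix 4 _∊_ _∊?_ _≈?_

  _∊_ : Carrier → Subset n → Set
  x ∊ A = to x ∈ A

  _∊?_ : ∀ x A → Dec (x ∊ A)
  x ∊? A = to x ∈? A

  to-injective : ∀ {x y} → to x ≡ to y → x ≈ y
  to-injective {x} {y} eq = trans (sym (strictlyInverseʳ x)) (trans (from-cong eq) (strictlyInverseʳ y))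

  _≈?_ : ∀ x y → Dec (x ≈ y)
  x ≈? y = map′ to-injective to-cong (to x Fin.≟ to y)

  ∊-resp : ∀ {A} → (_∊ A) Respects _≈_
  ∊-resp {A} x≈y = ≡.subst (_∈ A) (to-cong x≈y)

  ∈⇒∊ : ∀ {A i} → i ∈ A → from i ∊ A
  ∈⇒∊ {A} {i} = ≡.subst (_∈ A) (≡.sym (strictlyInverseˡ i))

  ⊆⁺ : ∀ {A B} → (∀ {x} → x ∊ A → x ∊ B) → A ⊆ B
  ⊆⁺ {A} {B} A⊆B {i} i∈A = ≡.subst (_∈ B) (strictlyInverseˡ i) (A⊆B (∈⇒∊ i∈A))

  module _ {p} {P : Carrier → Set p} (P? : Decidable P) where

    any-element? : P Respects _≈_ → Dec (∃ P)
    any-element? resp = map′ (λ (i , Pi) → from i , Pi)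
      (λ (x , Px) → to x , resp (sym (strictlyInverseʳ x)) Px) (Fin.any? (P? ∘ from))

    abstract
      -- Comprehension for a decidable predicate. It is abstract so that the table of decisions
      -- never unfolds; the two membership rules are all that is used.
      ⟪_⟫ : Subset n
      ⟪_⟫ = tabulate (does ∘ P? ∘ from)

      ∊⟪⟫⁺ : P Respects _≈_ → ∀ {x} → P x → x ∊ ⟪_⟫
      ∊⟪⟫⁺ resp {x} Px = lookup⇒[]= (to x) _ (≡.trans (lookup∘tabulate _ (to x))
        (dec-true (P? (from (to x))) (resp (sym (strictlyInverseʳ x)) Px)))

      ∊⟪⟫⁻ : P Respects _≈_ → ∀ {x} → x ∊ ⟪_⟫ → P x
      ∊⟪⟫⁻ resp {x} x∊ = resp (strictlyInverseʳ x) (witness (P? _)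
        (≡.trans (≡.sym (lookup∘tabulate _ (to x))) ([]=⇒lookup x∊)))
        where
        witness : ∀ {Q : Set p} (Q? : Dec Q) → does Q? ≡ true → Q
        witness (yes q) _ = q

  module _ {A B : Subset n} where

    injection⇒∣A∣≤∣B∣ : (φ : Carrier → Carrier) → (∀ {x} → x ∊ A → φ x ∊ B) →
      (∀ {x y} → φ x ≈ φ y → x ≈ y) → ∣ A ∣ ≤ ∣ B ∣
    injection⇒∣A∣≤∣B∣ φ φ∊ φ-inj = injection⇒∣∣≤ (to ∘ φ ∘ from) (φ∊ ∘ ∈⇒∊) λ {i} {j} _ _ eq →
      ≡.trans (≡.sym (strictlyInverseˡ i))
        (≡.trans (to-cong (φ-inj (to-injective eq))) (strictlyInverseˡ j))

    abstract
      ∣A∣<∣B∣⇒∃ : ∣ A ∣ < ∣ B ∣ → ∃[ x ] (x ∊ B × ¬ x ∊ A)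
      ∣A∣<∣B∣⇒∃ A<B with ∣∣<⇒∃∉ A B A<B
      ... | i , i∈B , i∉A = from i , ∈⇒∊ i∈B , i∉A ∘ ≡.subst (_∈ A) (strictlyInverseˡ i)

    ⊆∧∣∣≥⇒∊ : (∀ {x} → x ∊ A → x ∊ B) → ∣ B ∣ ≤ ∣ A ∣ → ∀ {x} → x ∊ B → x ∊ A
    ⊆∧∣∣≥⇒∊ A⊆B B≤A = ⊆∧∣∣≥⇒⊇ {p = A} {q = B} (⊆⁺ A⊆B) B≤A

    ∣∣-mono : (∀ {x} → x ∊ A → x ∊ B) → ∣ A ∣ ≤ ∣ B ∣
    ∣∣-mono A⊆B = p⊆q⇒∣p∣≤∣q∣ (⊆⁺ A⊆B)

    ∪⁻ : ∀ {x} → x ∊ A ∪ B → x ∊ A ⊎ x ∊ B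
    ∪⁻ = x∈p∪q⁻ A B

    ∪⁺ˡ : ∀ {x} → x ∊ A → x ∊ A ∪ B
    ∪⁺ˡ = x∈p∪q⁺ ∘ inj₁

    ∪⁺ʳ : ∀ {x} → x ∊ B → x ∊ A ∪ B
    ∪⁺ʳ = x∈p∪q⁺ ∘ inj₂

  1≤n : 1 ≤ n
  1≤n = nonzero (to 0#)
    where
    nonzero : ∀ {m} → Fin m → 1 ≤ m
    nonzero zero    = s≤s z≤n
    nonzero (suc _) = s≤s z≤n

  ∊-2⋆⁺ : ∀ {A x y z} → x ∊ A → y ∊ A → x + y ≈ z → z ∊ 2 ⋆ A
  ∊-2⋆⁺ {A} {x} {y} x∊A y∊A eq = Equivalence.from (∈-⋆ {2} {A})
    ( (λ { zero → x ; (suc zero) → y })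
    , (λ { zero → x∊A ; (suc zero) → y∊A })
    , trans (+-congˡ (+-identityʳ y)) eq )

  ∊-2⋆⁻ : ∀ {A z} → z ∊ 2 ⋆ A → ∃[ x ] ∃[ y ] (x ∊ A × y ∊ A × x + y ≈ z)
  ∊-2⋆⁻ {A} z∊ with Equivalence.to (∈-⋆ {2} {A}) z∊
  ... | a , a∊A , eq =
    a zero , a (suc zero) , a∊A zero , a∊A (suc zero) , trans (+-congˡ (sym (+-identityʳ _))) eq

  2·x≈x+x : ∀ x → 2 · x ≈ x + x
  2·x≈x+x x = +-congˡ (+-identityʳ x)

  m*n·x : ∀ m k x → (m ℕ.* k) · x ≈ m · (k · x)
  m*n·x m k x = sym (×-assocˡ x m k)

  -- Subgroups

  record IsSubgroup (H : Subset n) : Set c where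
    field
      0∊ : 0# ∊ H
      +∊ : ∀ {x y} → x ∊ H → y ∊ H → x + y ∊ H
      -∊ : ∀ {x} → x ∊ H → - x ∊ H

    -∊⁻ : ∀ {x} → - x ∊ H → x ∊ H
    -∊⁻ {x} = ∊-resp (⁻¹-involutive x) ∘ -∊

    ∸∊ : ∀ {x y} → x ∊ H → y ∊ H → x + - y ∊ H
    ∸∊ x∊ y∊ = +∊ x∊ (-∊ y∊)

    ·∊ : ∀ k {x} → x ∊ H → k · x ∊ H
    ·∊ zero    x∊ = 0∊
    ·∊ (suc k) x∊ = +∊ x∊ (·∊ k x∊)

  abstract
    coset : Carrier → Subset n → Subset n
    coset x H = ⟪ (λ z → z + - x ∊? H) ⟫

    coset⁺ : ∀ {x H z} → z + - x ∊ H → z ∊ coset x H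
    coset⁺ {x} {H} = ∊⟪⟫⁺ (λ z → z + - x ∊? H) (∊-resp ∘ +-congʳ)

    coset⁻ : ∀ {x H z} → z ∊ coset x H → z + - x ∊ H
    coset⁻ {x} {H} = ∊⟪⟫⁻ (λ z → z + - x ∊? H) (∊-resp ∘ +-congʳ)

  ∣coset∣ : ∀ {x H} → ∣ coset x H ∣ ≡ ∣ H ∣
  ∣coset∣ {x} {H} = ℕ.≤-antisym
    (injection⇒∣A∣≤∣B∣ (_+ - x) coset⁻ (∙-cancelʳ _ _ _))
    (injection⇒∣A∣≤∣B∣ (_+ x)
      (coset⁺ ∘ ∊-resp (solve (x ∷ _ ∷ []) (λ x h → h ⊜ h ⊕ x ⊖ x) ≡.refl)) (∙-cancelʳ _ _ _))

  -- For a subgroup `H` this says that `A` is a union of cosets of `H`.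
  Stable : Subset n → Subset n → Set c
  Stable H A = ∀ {x h} → x ∊ A → h ∊ H → x + h ∊ A

  stable∸ : ∀ {H A x y} → Stable H A → x ∊ A → y + - x ∊ H → y ∊ A
  stable∸ {x = x} {y} stable x∊A y-x∊H =
    ∊-resp (solve (x ∷ y ∷ []) (λ x y → x ⊕ (y ⊖ x) ⊜ y) ≡.refl) (stable x∊A y-x∊H)

  ⊤-stable : ∀ {H} → Stable H ⊤
  ⊤-stable _ _ = ∈⊤

  module Subgroup {H : Subset n} (H≤G : IsSubgroup H) where
    open IsSubgroup H≤G public

    symʰ : ∀ {x y} → x + - y ∊ H → y + - x ∊ H
    symʰ {x} {y} p = ∊-resp (solve (x ∷ y ∷ []) (λ x y → ⊝ (x ⊖ y) ⊜ y ⊖ x) ≡.refl) (-∊ p)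

    transʰ : ∀ {x y z} → x + - y ∊ H → y + - z ∊ H → x + - z ∊ H
    transʰ {x} {y} {z} p q =
      ∊-resp (solve (x ∷ y ∷ z ∷ []) (λ x y z → (x ⊖ y) ⊕ (y ⊖ z) ⊜ x ⊖ z) ≡.refl) (+∊ p q)

    coset-stable : ∀ {x} → Stable H (coset x H)
    coset-stable {x} {y} {h} y∊ h∊ = coset⁺
      (∊-resp (solve (x ∷ y ∷ h ∷ []) (λ x y h → (y ⊖ x) ⊕ h ⊜ (y ⊕ h) ⊖ x) ≡.refl) (+∊ (coset⁻ y∊) h∊))

    ∪coset-stable : ∀ {A x} → Stable H A → Stable H (A ∪ coset x H)
    ∪coset-stable {A} {x} stable y∊ h∊ with ∪⁻ {A} {coset x H} y∊
    ... | inj₁ y∊A = ∪⁺ˡ (stable y∊A h∊)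
    ... | inj₂ y∊  = ∪⁺ʳ {A} (coset-stable y∊ h∊)

    x∊coset : ∀ {x} → x ∊ coset x H
    x∊coset {x} = coset⁺ (∊-resp (sym (-‿inverseʳ x)) 0∊)

    ∣∪coset∣ : ∀ {A x} → Stable H A → ¬ x ∊ A → ∣ A ∪ coset x H ∣ ≡ ∣ A ∣ ℕ.+ ∣ H ∣
    ∣∪coset∣ {A} {x} stable x∉A = ≡.trans (disjoint⇒∣p∪q∣ A (coset x H) disj) (≡.cong (∣ A ∣ ℕ.+_) ∣coset∣)
      where
      disj : ∀ {i} → i ∈ A → ¬ i ∈ coset x H
      disj {i} i∈A i∈x+H = x∉A (stable∸ {H} stable (∈⇒∊ i∈A) (symʰ (coset⁻ (∈⇒∊ i∈x+H))))

    1≤∣H∣ : 1 ≤ ∣ H ∣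
    1≤∣H∣ = ≡.subst (1 ≤_) (≡.sym (∣p∣≡1+∣p∖x∣ 0∊)) (s≤s z≤n)

    instance
      ∣H∣-nonZero : ℕ.NonZero ∣ H ∣
      ∣H∣-nonZero = ℕ.>-nonZero 1≤∣H∣

    -- `A` is filled up coset by coset, each new coset being disjoint from the earlier ones and of
    -- size `∣ H ∣`. For `A = ⊤` this is Lagrange's theorem.
    stable⇒∣H∣∣∣A∣ : ∀ {A} → Stable H A → ∣ H ∣ ∣ ∣ A ∣
    stable⇒∣H∣∣∣A∣ {A} stable =
      exhaust {Q = λ B → B ⊆ A × Stable H B × ∣ H ∣ ∣ ∣ B ∣} step ∅
        ( (λ x∈ → contradiction x∈ ∉⊥) , (λ x∈ → contradiction x∈ ∉⊥)
        , ≡.subst (∣ H ∣ ∣_) (≡.sym (∣⊥∣≡0 n)) (∣ H ∣ ∣0))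
      where
      step : ∀ B → B ⊆ A × Stable H B × ∣ H ∣ ∣ ∣ B ∣ →
        ∣ H ∣ ∣ ∣ A ∣ ⊎ ∃[ C ] ((C ⊆ A × Stable H C × ∣ H ∣ ∣ ∣ C ∣) × ∣ B ∣ < ∣ C ∣)
      step B (B⊆A , B-stable , H∣B) with ∣ B ∣ ℕ.<? ∣ A ∣
      ... | no B≮A = inj₁ (≡.subst (∣ H ∣ ∣_) (ℕ.≤-antisym (p⊆q⇒∣p∣≤∣q∣ B⊆A) (ℕ.≮⇒≥ B≮A)) H∣B)
      ... | yes B<A with ∣A∣<∣B∣⇒∃ {B} {A} B<A
      ...   | x , x∊A , x∉B = inj₂
        ( B ∪ coset x H
        , ( ⊆⁺ (λ y∊ → ∪⊆ (∪⁻ {B} {coset x H} y∊)) , ∪coset-stable {B} B-stable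
          , ≡.subst (∣ H ∣ ∣_) (≡.sym size) (∣m∣n⇒∣m+n H∣B ∣-refl) )
        , ≡.subst (∣ B ∣ <_) (≡.sym size) (ℕ.m<m+n ∣ B ∣ 1≤∣H∣)
        ) where
        ∪⊆ : ∀ {y} → y ∊ B ⊎ y ∊ coset x H → y ∊ A
        ∪⊆ (inj₁ y∊B) = B⊆A y∊B
        ∪⊆ (inj₂ y∊)  = stable∸ {H} stable x∊A (coset⁻ y∊)
        size = ∣∪coset∣ {B} B-stable x∉B

  -- Orders modulo a subgroup, and adjoining an element.

  exponent-least : IsLeast (λ k → 1 ≤ k × Annihilates k) exponent
  exponent-least = proj₂ exponent-exists

  -- The order of the class of `x` in the quotient by `H`.
  Order : Subset n → Carrier → ℕ → Set
  Order H x = IsLeast (λ k → 1 ≤ k × k · x ∊ H)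

  ·-0 : ∀ k → k · 0# ≈ 0#
  ·-0 zero    = refl
  ·-0 (suc k) = trans (+-identityˡ _) (·-0 k)

  -‿· : ∀ k x → k · (- x) ≈ - (k · x)
  -‿· zero    x = sym ε⁻¹≈ε
  -‿· (suc k) x = trans (+-congˡ (-‿· k x)) (⁻¹-∙-comm x (k · x))

  ∸-· : ∀ {j k} x → j ≤ k → (k ℕ.∸ j) · x ≈ k · x + - (j · x)
  ∸-· {j} {k} x j≤k = trans (sym (×-homo-+ x (k ℕ.∸ j) j)) (×-congˡ (ℕ.m∸n+n≡m j≤k))
    ⇒ solve ((k ℕ.∸ j) · x ∷ j · x ∷ k · x ∷ []) (λ d j k → d ⊕ k ⊜ (k ⊖ j) ⊕ (d ⊕ j)) ≡.refl

  module Orders {H : Subset n} (H≤G : IsSubgroup H) where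
    open Subgroup H≤G public

    abstract
      order : ∀ x → ∃ (Order H x)
      order x = least (λ k → (1 ℕ.≤? k) ×-dec (k · x ∊? H)) exponent
        (proj₁ (proj₁ exponent-least) , ∊-resp (sym (proj₂ (proj₁ exponent-least) x)) 0∊)

    module _ {x r} (o : Order H x r) where

      order≥1 : 1 ≤ r
      order≥1 = proj₁ (proj₁ o)

      r·x∊ : r · x ∊ H
      r·x∊ = proj₂ (proj₁ o)

      instance
        order-nonZero : ℕ.NonZero r
        order-nonZero = ℕ.>-nonZero order≥1

      k·x∉ : ∀ {k} → 1 ≤ k → k < r → ¬ k · x ∊ H
      k·x∉ 1≤k k<r k·x∊ = ℕ.<⇒≱ k<r (proj₂ o _ (1≤k , k·x∊))

      reduce : ∀ m → m · x + - ((m % r) · x) ∊ H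
      reduce m = ∊-resp eq (·∊ (m / r) r·x∊)
        where
        eq : (m / r) · (r · x) ≈ m · x + - ((m % r) · x)
        eq = sym (trans (×-congˡ (m≡m%n+[m/n]*n m r)) (trans (×-homo-+ x (m % r) _) (+-congˡ (m*n·x (m / r) r x))))
          ⇒ solve (m · x ∷ (m % r) · x ∷ (m / r) · (r · x) ∷ []) (λ m a b → b ⊕ m ⊜ (m ⊖ a) ⊕ (a ⊕ b)) ≡.refl

      order-∣ : ∀ {m} → m · x ∊ H → r ∣ m
      order-∣ {m} m·x∊ = m%n≡0⇒n∣m m r (zero-or (m % r) (m%n<n m r) (reduce m))
        where
        zero-or : ∀ k → k < r → m · x + - (k · x) ∊ H → k ≡ 0
        zero-or zero    _   _ = ≡.refl
        zero-or (suc k) k<r p = contradiction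
          (∊-resp (solve (m · x ∷ suc k · x ∷ []) (λ m k → m ⊖ (m ⊖ k) ⊜ k) ≡.refl) (∸∊ m·x∊ p))
          (k·x∉ (s≤s z≤n) k<r)

    InAdjoin : Carrier → ℕ → Carrier → Set
    InAdjoin x r y = ∃[ j ] y + - (toℕ {r} j · x) ∊ H

    in-adjoin? : ∀ x r → Decidable (InAdjoin x r)
    in-adjoin? x r y = Fin.any? (λ j → y + - (toℕ j · x) ∊? H)

    in-adjoin-resp : ∀ {x r} → InAdjoin x r Respects _≈_
    in-adjoin-resp y≈z (j , p) = j , ∊-resp (+-congʳ y≈z) p

    -- The subgroup generated by H and x, when r is the order of x modulo H.
    abstract
      adjoin : Carrier → ℕ → Subset n
      adjoin x r = ⟪ in-adjoin? x r ⟫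

      in-adjoin⁺ : ∀ {x r y} → InAdjoin x r y → y ∊ adjoin x r
      in-adjoin⁺ {x} {r} = ∊⟪⟫⁺ (in-adjoin? x r) in-adjoin-resp

      in-adjoin⁻ : ∀ {x r y} → y ∊ adjoin x r → InAdjoin x r y
      in-adjoin⁻ {x} {r} = ∊⟪⟫⁻ (in-adjoin? x r) in-adjoin-resp

    -- Induction through the unions of the cosets of 0, x, ..., (k - 1)x, which need not be
    -- subgroups before `k = r`. The coset of kx is new: if it met that of jx with j < k, then (k -
    -- j)x would lie in `H` although 0 < k - j < r.
    ∣adjoin∣≤ : ∀ {x r} → Order H x r → ∀ k → k ≤ r → ∣ adjoin x k ∣ ≡ k ℕ.* ∣ H ∣
    ∣adjoin∣≤ {x} {r} o zero _ = ≡.trans (≡.cong ∣_∣ (⊆-antisym {i = adjoin x 0} (⊆⁺ none) ⊥⊆)) (∣⊥∣≡0 n)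
      where
      none : ∀ {y} → y ∊ adjoin x 0 → y ∊ ∅
      none y∊ with () , _ ← in-adjoin⁻ y∊
    ∣adjoin∣≤ {x} {r} o (suc k) k<r =
      ≡.trans (≡.cong ∣_∣ (⊆-antisym (⊆⁺ ⊆∪) (⊆⁺ ∪⊆)))
      (≡.trans (∣∪coset∣ {adjoin x k} stable k·x∉adj)
      (≡.trans (≡.cong (ℕ._+ ∣ H ∣) (∣adjoin∣≤ o k (ℕ.<⇒≤ k<r))) (ℕ.+-comm _ ∣ H ∣)))
      where
      stable : Stable H (adjoin x k)
      stable {y} {h} y∊ h∊ with in-adjoin⁻ y∊
      ... | j , p = in-adjoin⁺ (j , ∊-resp
        (solve (y ∷ h ∷ toℕ j · x ∷ []) (λ y h j → (y ⊖ j) ⊕ h ⊜ (y ⊕ h) ⊖ j) ≡.refl) (+∊ p h∊))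

      k·x∉adj : ¬ k · x ∊ adjoin x k
      k·x∉adj p with in-adjoin⁻ p
      ... | j , q = k·x∉ o (ℕ.m<n⇒0<n∸m (Fin.toℕ<n j)) (ℕ.≤-<-trans (ℕ.m∸n≤m k (toℕ j)) k<r)
        (∊-resp (sym (∸-· x (ℕ.<⇒≤ (Fin.toℕ<n j)))) q)

      ⊆∪ : ∀ {y} → y ∊ adjoin x (suc k) → y ∊ adjoin x k ∪ coset (k · x) H
      ⊆∪ {y} y∊ with in-adjoin⁻ y∊
      ... | j , p with toℕ j ℕ.<? k
      ...   | yes j<k = ∪⁺ˡ (in-adjoin⁺ (fromℕ< j<k , ≡.subst (λ i → y + - (i · x) ∊ H) (≡.sym (Fin.toℕ-fromℕ< j<k)) p))
      ...   | no  j≮k = ∪⁺ʳ {adjoin x k} (coset⁺ (≡.subst (λ i → y + - (i · x) ∊ H)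
              (ℕ.≤-antisym (ℕ.s≤s⁻¹ (Fin.toℕ<n j)) (ℕ.≮⇒≥ j≮k)) p))

      ∪⊆ : ∀ {y} → y ∊ adjoin x k ∪ coset (k · x) H → y ∊ adjoin x (suc k)
      ∪⊆ {y} y∊ with ∪⁻ {adjoin x k} y∊
      ... | inj₁ p with in-adjoin⁻ p
      ...   | j , q = in-adjoin⁺ (inject₁ j , ≡.subst (λ i → y + - (i · x) ∊ H) (≡.sym (Fin.toℕ-inject₁ j)) q)
      ∪⊆ {y} y∊ | inj₂ p = in-adjoin⁺ (fromℕ< (ℕ.n<1+n k) ,
        ≡.subst (λ i → y + - (i · x) ∊ H) (≡.sym (Fin.toℕ-fromℕ< (ℕ.n<1+n k))) (coset⁻ p))

    module Adjoin {x r} (o : Order H x r) where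

      ∣adjoin∣ : ∣ adjoin x r ∣ ≡ r ℕ.* ∣ H ∣
      ∣adjoin∣ = ∣adjoin∣≤ o r ℕ.≤-refl

      adjoin⁺ : ∀ m {y} → y + - (m · x) ∊ H → y ∊ adjoin x r
      adjoin⁺ m {y} p = in-adjoin⁺
        (fromℕ< m%r<r , ≡.subst (λ i → y + - (i · x) ∊ H) (≡.sym (Fin.toℕ-fromℕ< m%r<r)) (transʰ p (reduce o m)))
        where
        instance _ = order-nonZero o
        m%r<r = m%n<n m r

      adjoin⁻ : ∀ {y} → y ∊ adjoin x r → ∃[ m ] (m < r × y + - (m · x) ∊ H)
      adjoin⁻ y∊ with in-adjoin⁻ y∊
      ... | j , p = toℕ j , Fin.toℕ<n j , p

      H⊆adjoin : ∀ {y} → y ∊ H → y ∊ adjoin x r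
      H⊆adjoin {y} y∊ = adjoin⁺ 0 (∊-resp (solve (y ∷ []) (λ y → y ⊜ y ⊖ 𝟘) ≡.refl) y∊)

      x∊adjoin : x ∊ adjoin x r
      x∊adjoin = adjoin⁺ 1 (∊-resp (solve (x ∷ []) (λ x → 𝟘 ⊜ x ⊖ (x ⊕ 𝟘)) ≡.refl) 0∊)

      adjoin≤G : IsSubgroup (adjoin x r)
      adjoin≤G = record { 0∊ = H⊆adjoin 0∊ ; +∊ = plus ; -∊ = neg }
        where
        plus : ∀ {y z} → y ∊ adjoin x r → z ∊ adjoin x r → y + z ∊ adjoin x r
        plus {y} {z} y∊ z∊ with adjoin⁻ y∊ | adjoin⁻ z∊
        ... | i , _ , p | j , _ , q = adjoin⁺ (i ℕ.+ j) (∊-resp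
          (trans (solve (y ∷ z ∷ i · x ∷ j · x ∷ []) (λ y z i j → (y ⊖ i) ⊕ (z ⊖ j) ⊜ (y ⊕ z) ⊖ (i ⊕ j)) ≡.refl)
                 (+-congˡ (-‿cong (sym (×-homo-+ x i j))))) (+∊ p q))

        neg : ∀ {y} → y ∊ adjoin x r → - y ∊ adjoin x r
        neg {y} y∊ with adjoin⁻ y∊
        ... | i , i<r , p = adjoin⁺ (r ℕ.∸ i) (∊-resp
          (trans (solve (y ∷ i · x ∷ r · x ∷ []) (λ y i r → ⊝ (y ⊖ i) ⊖ r ⊜ ⊝ y ⊖ (r ⊖ i)) ≡.refl)
                 (+-congˡ (-‿cong (sym (∸-· x (ℕ.<⇒≤ i<r)))))) (∸∊ (-∊ p) (r·x∊ o)))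

    order*∣H∣∣n : ∀ {x r} → Order H x r → r ℕ.* ∣ H ∣ ∣ n
    order*∣H∣∣n o = ≡.subst (_∣ n) (Adjoin.∣adjoin∣ o)
      (≡.subst (∣ adjoin _ _ ∣ ∣_) (∣⊤∣≡n n) (Subgroup.stable⇒∣H∣∣∣A∣ (Adjoin.adjoin≤G o) {⊤} (⊤-stable {adjoin _ _})))

    abstract
      proper⇒∃∉ : ∣ H ∣ < n → ∃[ x ] ¬ x ∊ H
      proper⇒∃∉ H<n with ∣A∣<∣B∣⇒∃ {H} {⊤} (≡.subst (∣ H ∣ <_) (≡.sym (∣⊤∣≡n n)) H<n)
      ... | x , _ , x∉ = x , x∉

  instance
    n-nonZero : ℕ.NonZero n
    n-nonZero = ℕ.>-nonZero 1≤n

  -- Cauchy's theorem modulo a subgroup, and subgroups of prescribed order.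

  module _ {p} (p-prime : Prime p) {H₀} (H₀≤G : IsSubgroup H₀) where

    private
      instance
        p-nonZero : ℕ.NonZero p
        p-nonZero = prime⇒nonZero p-prime

      2≤p : 2 ≤ p
      2≤p = ℕ.nonTrivial⇒n>1 p {{prime⇒nonTrivial p-prime}}

      Killed : Subset n → Set c
      Killed H = ∃[ x ] (¬ x ∊ H × p · x ∊ H)

      -- If the order r of y modulo H is prime to p, then an element x killed by p modulo
      -- H + ⟨y⟩ gives the element r · x killed by p modulo H.
      Reduced : Subset n → Set c
      Reduced H = IsSubgroup H × p ℕ.* ∣ H ∣ ∣ n × (Killed H → Killed H₀)

      -- Take `y` outside `H`, of order `r` modulo `H`. If `p` divides `r`, then (r/p)y is killed by
      -- `p` modulo `H`. Otherwise `H` is replaced by H + ⟨y⟩, which is larger and still leaves a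
      -- factor `p` in its index.
      step : ∀ H → Reduced H → Killed H₀ ⊎ ∃[ K ] (Reduced K × ∣ H ∣ < ∣ K ∣)
      step H (H≤G , pH∣n , lift) with proper⇒∃∉ H<n
        where
        open Orders H≤G
        H<n : ∣ H ∣ < n
        H<n = ℕ.<-≤-trans (ℕ.m<m*n ∣ H ∣ p 2≤p) (ℕ.≤-trans (ℕ.≤-reflexive (ℕ.*-comm ∣ H ∣ p)) (∣⇒≤ pH∣n))
      ... | y , y∉H with order y
        where open Orders H≤G
      ... | r , o with p ∣? r
      ...   | yes (divides q ≡.refl) = inj₁ (lift (q · y , k·x∉ o 1≤q q<r , p·qy∊))
        where
        open Orders H≤G
        instance _ = order-nonZero o
        1≤q : 1 ≤ q
        1≤q = ℕ.>-nonZero⁻¹ q {{ℕ.m*n≢0⇒m≢0 q}}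
        q<r : q < q ℕ.* p
        q<r = ℕ.m<m*n q p {{ℕ.>-nonZero 1≤q}} 2≤p
        p·qy∊ : p · q · y ∊ H
        p·qy∊ = ∊-resp (trans (×-congˡ (ℕ.*-comm q p)) (m*n·x p q y)) (r·x∊ o)
      ...   | no p∤r = inj₂ (adjoin y r , (adjoin≤G , pK∣n , lift ∘ descend) , H<K)
        where
        open Orders H≤G
        open Adjoin o
        instance _ = order-nonZero o

        2≤r : 2 ≤ r
        2≤r = ℕ.≤∧≢⇒< (order≥1 o) λ { ≡.refl → y∉H (∊-resp (+-identityʳ y) (r·x∊ o)) }

        H<K : ∣ H ∣ < ∣ adjoin y r ∣
        H<K = ≡.subst (∣ H ∣ <_) (≡.trans (ℕ.*-comm ∣ H ∣ r) (≡.sym ∣adjoin∣)) (ℕ.m<m*n ∣ H ∣ r 2≤r)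

        pr∣sp : ∀ s → r ∣ s ℕ.* p → p ℕ.* r ∣ s ℕ.* p
        pr∣sp s (divides t sp≡tr) with euclidsLemma t r p-prime (≡.subst (p ∣_) sp≡tr (n∣m*n s))
        ... | inj₁ p∣t = ≡.subst (p ℕ.* r ∣_) (≡.sym sp≡tr) (*-monoˡ-∣ r p∣t)
        ... | inj₂ p∣r = contradiction p∣r p∤r

        pK∣n : p ℕ.* ∣ adjoin y r ∣ ∣ n
        pK∣n = ≡.subst₂ _∣_
          (≡.trans (ℕ.*-assoc p r ∣ H ∣) (≡.cong (p ℕ.*_) (≡.sym ∣adjoin∣))) (≡.sym n≡spH)
          (*-monoˡ-∣ ∣ H ∣ (pr∣sp s (*-cancelʳ-∣ ∣ H ∣ (≡.subst (r ℕ.* ∣ H ∣ ∣_) n≡spH (order*∣H∣∣n o)))))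
          where
          s = quotient pH∣n
          n≡spH : n ≡ s ℕ.* p ℕ.* ∣ H ∣
          n≡spH = ≡.trans (_∣_.equality pH∣n) (≡.sym (ℕ.*-assoc s p ∣ H ∣))

        descend : Killed (adjoin y r) → Killed H
        descend (x , x∉K , px∊K) = r · x , rx∉H , prx∊H
          where
          -- Modulo K = H + ⟨y⟩ the order of `x` is 1 or `p`. It is not 1, and if it is `p`, then rx
          -- ∈ H ⊆ K would give p ∣ r.
          rx∉H : ¬ r · x ∊ H
          rx∉H rx∊H with Orders.order adjoin≤G x
          ... | k , o′ with prime⇒irreducible p-prime (Orders.order-∣ adjoin≤G o′ px∊K)
          ...   | inj₁ ≡.refl = x∉K (∊-resp (+-identityʳ x) (Orders.r·x∊ adjoin≤G o′))
          ...   | inj₂ ≡.refl = p∤r (Orders.order-∣ adjoin≤G o′ (H⊆adjoin rx∊H))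

          prx∊H : p · r · x ∊ H
          prx∊H with adjoin⁻ px∊K
          ... | j , _ , q = ∊-resp eq (+∊ (·∊ r q) (·∊ j (r·x∊ o)))
            where
            swap : ∀ a b z → a · b · z ≈ b · a · z
            swap a b z = trans (sym (m*n·x a b z)) (trans (×-congˡ (ℕ.*-comm a b)) (m*n·x b a z))
            eq : r · (p · x + - (j · y)) + j · r · y ≈ p · r · x
            eq = trans (+-cong (trans (×-distrib-+ (p · x) _ r) (+-cong (swap r p x) (-‿· r _))) (swap j r y))
              (solve (p · r · x ∷ r · j · y ∷ []) (λ a b → a ⊖ b ⊕ b ⊜ a) ≡.refl)

    -- Cauchy's theorem for the quotient by `H₀`. Divisibility of n by p|H| keeps `H` proper
    -- throughout, so the growth can only end by producing the element.
    cauchy : p ℕ.* ∣ H₀ ∣ ∣ n → ∃[ x ] (¬ x ∊ H₀ × p · x ∊ H₀)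
    cauchy pH₀∣n = exhaust {Q = Reduced} step H₀ (H₀≤G , pH₀∣n , λ k → k)

  prime-order : ∀ {p H x} → Prime p → IsSubgroup H → ¬ x ∊ H → p · x ∊ H → Order H x p
  prime-order {x = x} p-prime H≤G x∉H px∊H with Orders.order H≤G x
  ... | r , o with prime⇒irreducible p-prime (Orders.order-∣ H≤G o px∊H)
  ...   | inj₁ ≡.refl = contradiction (∊-resp (+-identityʳ x) (Orders.r·x∊ H≤G o)) x∉H
  ...   | inj₂ ≡.refl = o

  order∣4⇒≡4 : ∀ {H x r} → IsSubgroup H → Order H x r → r ∣ 4 → ¬ 2 · x ∊ H → r ≡ 4
  order∣4⇒≡4 {x = x} H≤G o r∣4 2x∉ with ∣4⁻ r∣4
  ... | inj₁ ≡.refl = contradiction (·∊ 2 (∊-resp (+-identityʳ x) (r·x∊ o))) 2x∉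
    where open Orders H≤G
  ... | inj₂ (inj₁ ≡.refl) = contradiction (Orders.r·x∊ H≤G o) 2x∉
  ... | inj₂ (inj₂ r≡4) = r≡4

  extend-product : ∀ {ps H} → All Prime ps → IsSubgroup H → product ps ℕ.* ∣ H ∣ ∣ n →
    ∃[ K ] (IsSubgroup K × (∀ {x} → x ∊ H → x ∊ K) × ∣ K ∣ ≡ product ps ℕ.* ∣ H ∣)
  extend-product {H = H} [] H≤G _ = H , H≤G , (λ x∊ → x∊) , ≡.sym (ℕ.+-identityʳ ∣ H ∣)
  extend-product {p ∷ ps} {H} (p-prime ∷ ps-prime) H≤G d∣n
    with cauchy p-prime H≤G (m*n∣⇒n∣ (product ps) (p ℕ.* ∣ H ∣) (≡.subst (_∣ n) regroup d∣n))
    where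
    regroup : p ℕ.* product ps ℕ.* ∣ H ∣ ≡ product ps ℕ.* (p ℕ.* ∣ H ∣)
    regroup = ≡.trans (≡.cong (ℕ._* ∣ H ∣) (ℕ.*-comm p (product ps))) (ℕ.*-assoc (product ps) p ∣ H ∣)
  ... | x , x∉H , px∊H = K , K≤G , K⊇ ∘ H⊆adjoin , ≡.trans ∣K∣ size
    where
    o = prime-order p-prime H≤G x∉H px∊H
    open Orders H≤G using (module Adjoin)
    open Adjoin o
    size : product ps ℕ.* ∣ Orders.adjoin H≤G x p ∣ ≡ p ℕ.* product ps ℕ.* ∣ H ∣
    size = ≡.trans (≡.cong (product ps ℕ.*_) ∣adjoin∣)
      (≡.trans (≡.sym (ℕ.*-assoc (product ps) p ∣ H ∣)) (≡.cong (ℕ._* ∣ H ∣) (ℕ.*-comm (product ps) p)))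
    rec = extend-product ps-prime adjoin≤G (≡.subst (_∣ n) (≡.sym size) d∣n)
    K = proj₁ rec
    K≤G = proj₁ (proj₂ rec)
    K⊇ = λ {x} → proj₁ (proj₂ (proj₂ rec)) {x}
    ∣K∣ = proj₂ (proj₂ (proj₂ rec))

  -- The index `k` is built up one prime factor at a time by relative Cauchy. Applied over the
  -- trivial subgroup it gives H, and over H it gives G₀.
  extend-by : ∀ {H} k → IsSubgroup H → k ℕ.* ∣ H ∣ ∣ n →
    ∃[ K ] (IsSubgroup K × (∀ {x} → x ∊ H → x ∊ K) × ∣ K ∣ ≡ k ℕ.* ∣ H ∣)
  extend-by {H} zero H≤G 0∣n = contradiction (0∣⇒≡0 0∣n) (ℕ.≢-nonZero⁻¹ n)
  extend-by {H} k@(suc _) H≤G k*H∣n = ≡.subst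
    (λ m → ∃[ K ] (IsSubgroup K × (∀ {x} → x ∊ H → x ∊ K) × ∣ K ∣ ≡ m ℕ.* ∣ H ∣)) (≡.sym isFactorisation)
    (extend-product factorsPrime H≤G (≡.subst (λ m → m ℕ.* ∣ H ∣ ∣ n) isFactorisation k*H∣n))
    where open PrimeFactorisation (factorise k)

  trivial : Subset n
  trivial = ⁅ to 0# ⁆

  trivial⁻ : ∀ {x} → x ∊ trivial → x ≈ 0#
  trivial⁻ = to-injective ∘ x∈⁅y⁆⇒x≡y _

  trivial⁺ : ∀ {x} → x ≈ 0# → x ∊ trivial
  trivial⁺ x≈0 = ∊-resp (sym x≈0) (x∈⁅x⁆ (to 0#))

  trivial≤G : IsSubgroup trivial
  trivial≤G = record
    { 0∊ = trivial⁺ refl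
    ; +∊ = λ x∊ y∊ → trivial⁺ (trans (+-cong (trivial⁻ x∊) (trivial⁻ y∊)) (+-identityˡ 0#))
    ; -∊ = λ x∊ → trivial⁺ (trans (-‿cong (trivial⁻ x∊)) ε⁻¹≈ε)
    }

  ∣trivial∣ : ∣ trivial ∣ ≡ 1
  ∣trivial∣ = ∣⁅x⁆∣≡1 (to 0#)

  -- Cyclic quotients of order 4.

  CyclicQuotient4 : Set c
  CyclicQuotient4 = ∃[ H ] ∃[ y ] (IsSubgroup H × 4 ℕ.* ∣ H ∣ ≡ n × Order H y 4)

  -- The family in which a maximal member is sought: `y` has order exactly 4 modulo `K`.
  KilledBy4 : Carrier → Subset n → Set c
  KilledBy4 y K = IsSubgroup K × (∀ x → 4 · x ∊ K) × ¬ 2 · y ∊ K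

  module _ {y K} (K≤G : IsSubgroup K) (4·∊ : ∀ x → 4 · x ∊ K) (2y∉ : ¬ 2 · y ∊ K) where
    open Orders K≤G

    order≡4 : Order K y 4
    order≡4 = let (r , o) = order y in
      ≡.subst (Order K y) (order∣4⇒≡4 K≤G o (order-∣ o (4·∊ y)) 2y∉) o

    open Adjoin order≡4

    -- Doubling the hypothesis and using 4x ∈ K gives 2m · y ∈ K, so 4 divides 2m.
    even-correction : ∀ {x m} → 2 · x + - (m · y) ∊ K → 2 ∣ m
    even-correction {x} {m} p = *-cancelˡ-∣ 2 (order-∣ order≡4 {2 ℕ.* m} (∊-resp
      (trans (solve (x ∷ m · y ∷ []) (λ x m → 4 ⊛ x ⊖ 2 ⊛ (2 ⊛ x ⊖ m) ⊜ 2 ⊛ m) ≡.refl) (sym (m*n·x 2 m y)))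
      (∸∊ (4·∊ x) (·∊ 2 p))))

    -- Correcting x by i · y gives u with 2u ∈ K, and still 2y ∉ K + ⟨u⟩.
    module _ {x} (x∉ : ¬ x ∊ adjoin y 4) (i : ℕ) (p : 2 · x + - ((i ℕ.* 2) · y) ∊ K) where

      private
        u : Carrier
        u = x + - (i · y)

        u∉ : ¬ u ∊ K
        u∉ = x∉ ∘ adjoin⁺ i

        2u∊ : 2 · u ∊ K
        2u∊ = ∊-resp (trans (+-congˡ (-‿cong (trans (×-congˡ (ℕ.*-comm i 2)) (m*n·x 2 i y))))
          (solve (x ∷ i · y ∷ []) (λ x i → 2 ⊛ x ⊖ 2 ⊛ i ⊜ 2 ⊛ (x ⊖ i)) ≡.refl)) p

        module U = Adjoin (prime-order prime[2] K≤G u∉ 2u∊)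

        2y∉′ : ∀ j → j < 2 → ¬ 2 · y + - (j · u) ∊ K
        2y∉′ 0 _ q = 2y∉ (∊-resp (solve (y ∷ []) (λ y → 2 ⊛ y ⊖ 𝟘 ⊜ 2 ⊛ y) ≡.refl) q)
        -- Modulo `K`, u = 2y would make x = u + iy equal to (2 + i)y.
        2y∉′ 1 _ q = x∉ (adjoin⁺ (2 ℕ.+ i) (∊-resp
          (trans (solve (x ∷ y ∷ i · y ∷ [])
                   (λ x y i → ⊝ (2 ⊛ y ⊖ 1 ⊛ (x ⊖ i)) ⊜ x ⊖ (2 ⊛ y ⊕ i)) ≡.refl)
                 (+-congˡ (-‿cong (sym (×-homo-+ y 2 i))))) (-∊ q)))
        2y∉′ (suc (suc _)) (s≤s (s≤s ())) _

        2y∉U : ¬ 2 · y ∊ adjoin u 2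
        2y∉U 2y∊ with U.adjoin⁻ 2y∊
        ... | j , j<2 , q = 2y∉′ j j<2 q

      enlarge-by : ∃[ L ] (KilledBy4 y L × ∣ K ∣ < ∣ L ∣)
      enlarge-by = adjoin u 2 , (U.adjoin≤G , U.H⊆adjoin ∘ 4·∊ , 2y∉U) ,
        ≡.subst (∣ K ∣ <_) (≡.trans (ℕ.*-comm ∣ K ∣ 2) (≡.sym U.∣adjoin∣)) (ℕ.m<m*n ∣ K ∣ 2 (s≤s (s≤s z≤n)))

    enlarge : ∀ {x} → ¬ x ∊ adjoin y 4 → 2 · x ∊ adjoin y 4 → ∃[ L ] (KilledBy4 y L × ∣ K ∣ < ∣ L ∣)
    enlarge {x} x∉ 2x∊ = go (adjoin⁻ 2x∊)
      where
      go : ∃[ m ] (m < 4 × 2 · x + - (m · y) ∊ K) → _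
      go (m , _ , p) = enlarge-by x∉ (quotient 2∣m)
        (≡.subst (λ k → 2 · x + - (k · y) ∊ K) (_∣_.equality 2∣m) p)
        where 2∣m = even-correction {x} {m} p

    -- If 4|K| < n, some x lies outside K + ⟨y⟩. Since 4x ∈ K, either x or 2x is an element outside
    -- K + ⟨y⟩ whose double is inside, as `enlarge` requires.
    finish-or-enlarge : CyclicQuotient4 ⊎ ∃[ L ] (KilledBy4 y L × ∣ K ∣ < ∣ L ∣)
    finish-or-enlarge = by-size (4 ℕ.* ∣ K ∣ ℕ.≟ n)
      where
      by-double : ∀ {x} → ¬ x ∊ adjoin y 4 → Dec (2 · x ∊ adjoin y 4) → ∃[ L ] (KilledBy4 y L × ∣ K ∣ < ∣ L ∣)
      by-double x∉ (yes 2x∊) = enlarge x∉ 2x∊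
      by-double {x} x∉ (no 2x∉) = enlarge 2x∉ (H⊆adjoin (∊-resp (m*n·x 2 2 x) (4·∊ x)))

      adjoin<n : 4 ℕ.* ∣ K ∣ ≢ n → ∣ adjoin y 4 ∣ < n
      adjoin<n ≢ = ≡.subst (_< n) (≡.sym ∣adjoin∣) (ℕ.≤∧≢⇒< (∣⇒≤ (order*∣H∣∣n order≡4)) ≢)

      by-size : Dec (4 ℕ.* ∣ K ∣ ≡ n) → CyclicQuotient4 ⊎ ∃[ L ] (KilledBy4 y L × ∣ K ∣ < ∣ L ∣)
      by-size (yes eq) = inj₁ (K , y , K≤G , eq , order≡4)
      by-size (no ≢) = let (x , x∉) = Orders.proper⇒∃∉ adjoin≤G (adjoin<n ≢) in
        inj₂ (by-double x∉ (2 · x ∊? adjoin y 4))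

  -- Write e = 4q. By minimality of e some y has 2qy ≠ 0. The search starts from the kernel `T` of
  -- multiplication by q: it contains 4G because 4q annihilates G, and it does not contain 2y.
  cyclic-quotient-4 : ∀ {e} → IsLeast (λ k → 1 ≤ k × Annihilates k) e → 4 ∣ e →
    CyclicQuotient4
  cyclic-quotient-4 {e} ((e≥1 , e-annihilates) , e-least) (divides q e≡q*4) with any-element?
    (λ y → ¬? ((q ℕ.* 2) · y ≈? 0#)) (λ y≈z ≉ eq → ≉ (trans (×-congʳ (q ℕ.* 2) y≈z) eq))
  ... | no ∄y = contradiction (e-least (q ℕ.* 2) (ℕ.>-nonZero⁻¹ _ , annihilates)) e≰2q
    where
    instance
      q-nonZero : ℕ.NonZero q
      q-nonZero = ℕ.m*n≢0⇒m≢0 q {{≡.subst ℕ.NonZero e≡q*4 (ℕ.>-nonZero e≥1)}}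
      _ = ℕ.m*n≢0 q 2
    annihilates : Annihilates (q ℕ.* 2)
    annihilates y = decidable-stable (_ ≈? 0#) (λ ≉ → ∄y (y , ≉))
    e≰2q : ¬ e ≤ q ℕ.* 2
    e≰2q e≤2q = ℕ.<⇒≱ (ℕ.*-monoʳ-< q (s≤s (s≤s (s≤s z≤n)))) (≡.subst (_≤ q ℕ.* 2) e≡q*4 e≤2q)
  ... | yes (y , 2qy≉0) = exhaust {Q = KilledBy4 y}
    (λ K (K≤G , 4·∊ , 2y∉) → finish-or-enlarge K≤G 4·∊ 2y∉) T (T≤G , 4·∊T , 2y∉T)
    where
    q·_≈0? : Decidable (λ x → q · x ≈ 0#)
    q·_≈0? x = q · x ≈? 0#

    T = ⟪ q·_≈0? ⟫

    T⁺ : ∀ {x} → q · x ≈ 0# → x ∊ T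
    T⁺ = ∊⟪⟫⁺ q·_≈0? (λ x≈y eq → trans (×-congʳ q (sym x≈y)) eq)

    T⁻ : ∀ {x} → x ∊ T → q · x ≈ 0#
    T⁻ = ∊⟪⟫⁻ q·_≈0? (λ x≈y eq → trans (×-congʳ q (sym x≈y)) eq)

    T≤G : IsSubgroup T
    T≤G = record
      { 0∊ = T⁺ (·-0 q)
      ; +∊ = λ {x} {z} x∊ z∊ → T⁺ (trans (×-distrib-+ x z q) (trans (+-cong (T⁻ x∊) (T⁻ z∊)) (+-identityˡ 0#)))
      ; -∊ = λ {x} x∊ → T⁺ (trans (-‿· q x) (trans (-‿cong (T⁻ x∊)) ε⁻¹≈ε))
      }

    4·∊T : ∀ x → 4 · x ∊ T
    4·∊T x = T⁺ (trans (sym (m*n·x q 4 x)) (≡.subst (λ e → e · x ≈ 0#) e≡q*4 (e-annihilates x)))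

    2y∉T : ¬ 2 · y ∊ T
    2y∉T p = 2qy≉0 (trans (m*n·x q 2 y) (T⁻ p))

  -- Missing elements and reflections.

  χ∸1≡ : ∀ h {m} → IsGreatest (IncompleteSize h) m → χ h ℕ.∸ 1 ≡ m
  χ∸1≡ h {m} ((A , (A≠∅ , hA≢⊤) , ∣A∣≡m) , greatest) = ≡.cong (ℕ._∸ 1) (ℕ.≤-antisym χ≤ m<χ)
    where
    forces : ForcesComplete h (suc m)
    forces = s≤s z≤n , λ B m<∣B∣ → decidable-stable (≡-dec Bool._≟_ (h ⋆ B) ⊤) λ hB≢⊤ →
      ℕ.<⇒≱ m<∣B∣ (greatest ∣ B ∣ (B , (1≤∣p∣⇒Nonempty (ℕ.≤-trans (s≤s z≤n) m<∣B∣) , hB≢⊤) , ≡.refl))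

    χ≤ : χ h ≤ suc m
    χ≤ = proj₂ (proj₂ (χ-exists h)) (suc m) forces

    m<χ : m < χ h
    m<χ = ℕ.≰⇒> λ χ≤m → hA≢⊤ (proj₂ (proj₁ (proj₂ (χ-exists h))) A (ℕ.≤-trans χ≤m (ℕ.≤-reflexive (≡.sym ∣A∣≡m))))

  ∁⁺ : ∀ {A x} → ¬ x ∊ A → x ∊ ∁ A
  ∁⁺ = x∉p⇒x∈∁p

  ∁⁻ : ∀ {A x} → x ∊ ∁ A → ¬ x ∊ A
  ∁⁻ = x∈∁p⇒x∉p

  ∣A∣≡n∸ : ∀ {A k} → ∣ ∁ A ∣ ≡ k → ∣ A ∣ ≡ n ℕ.∸ k
  ∣A∣≡n∸ {A} {k} eq = ≡.trans (≡.sym (ℕ.m+n∸m≡n k ∣ A ∣)) (≡.cong (ℕ._∸ k)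
    (≡.trans (≡.cong (ℕ._+ ∣ A ∣) (≡.sym eq)) (∣∁p∣+∣p∣≡n A)))

  ≢⊤⇒missing : ∀ {A} → A ≢ ⊤ → ∃[ g ] ¬ g ∊ A
  ≢⊤⇒missing {A} A≢⊤ = let (g , _ , g∉A) = ∣A∣<∣B∣⇒∃ {A} {⊤} A<⊤ in g , g∉A
    where
    A<⊤ : ∣ A ∣ < ∣ ⊤ {n} ∣
    A<⊤ = ≡.subst (∣ A ∣ <_) (≡.sym (∣⊤∣≡n n)) (ℕ.≤∧≢⇒< (∣p∣≤n A) (A≢⊤ ∘ ∣p∣≡n⇒p≡⊤))

  missing⇒≢⊤ : ∀ {A g} → ¬ g ∊ A → A ≢ ⊤
  missing⇒≢⊤ g∉A ≡.refl = g∉A ∈⊤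

  ∊-2⋆-via : ∀ {A z} a → a ∊ A → z + - a ∊ A → z ∊ 2 ⋆ A
  ∊-2⋆-via {A} {z} a a∊ b∊ = ∊-2⋆⁺ {A} a∊ b∊ (solve (a ∷ z ∷ []) (λ a z → a ⊕ (z ⊖ a) ⊜ z) ≡.refl)

  missing⇒∉ : ∀ {A g} → ¬ g ∊ 2 ⋆ A → ∀ {x} → x ∊ A → ¬ g + - x ∊ A
  missing⇒∉ g∉ x∊ = g∉ ∘ ∊-2⋆-via _ x∊

  ∉⇒missing : ∀ {A g} → (∀ {x} → x ∊ A → ¬ g + - x ∊ A) → ¬ g ∊ 2 ⋆ A
  ∉⇒missing {A} {g} avoid g∊ with ∊-2⋆⁻ {A} g∊
  ... | x , y , x∊ , y∊ , eq = avoid x∊ (∊-resp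
    (eq ⇒ solve (x ∷ y ∷ g ∷ []) (λ x y g → y ⊕ g ⊜ (g ⊖ x) ⊕ (x ⊕ y)) ≡.refl) y∊)

  g∸-injective : ∀ {g x y} → g + - x ≈ g + - y → x ≈ y
  g∸-injective eq = ⁻¹-injective (∙-cancelˡ _ _ _ eq)

  g∸g∸ : ∀ g x → x ≈ g + - (g + - x)
  g∸g∸ g x = solve (g ∷ x ∷ []) (λ g x → x ⊜ g ⊖ (g ⊖ x)) ≡.refl

  missing⇒∣A∣+∣A∣≤n : ∀ {A g} → ¬ g ∊ 2 ⋆ A → ∣ A ∣ ℕ.+ ∣ A ∣ ≤ n
  missing⇒∣A∣+∣A∣≤n {A} {g} g∉ = ℕ.≤-trans
    (ℕ.+-monoˡ-≤ ∣ A ∣ (injection⇒∣A∣≤∣B∣ {A} {∁ A} (λ x → g + - x) (∁⁺ ∘ missing⇒∉ {A} g∉) g∸-injective))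
    (ℕ.≤-reflexive (∣∁p∣+∣p∣≡n A))

  incompleteSize⇒≤ : ∀ {m} → IncompleteSize 2 m → m ℕ.+ m ≤ n
  incompleteSize⇒≤ (A , (_ , 2A≢⊤) , ≡.refl) = missing⇒∣A∣+∣A∣≤n {A} (proj₂ (≢⊤⇒missing 2A≢⊤))

  reflection : Carrier → Subset n → Subset n
  reflection g A = ⟪ (λ x → g + - x ∊? A) ⟫

  reflection⁺ : ∀ {g A x} → g + - x ∊ A → x ∊ reflection g A
  reflection⁺ {g} {A} = ∊⟪⟫⁺ (λ x → g + - x ∊? A) (∊-resp ∘ +-congˡ ∘ -‿cong)

  reflection⁻ : ∀ {g A x} → x ∊ reflection g A → g + - x ∊ A
  reflection⁻ {g} {A} = ∊⟪⟫⁻ (λ x → g + - x ∊? A) (∊-resp ∘ +-congˡ ∘ -‿cong)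

  ∣A∣≤∣reflection∣ : ∀ {g A} → ∣ A ∣ ≤ ∣ reflection g A ∣
  ∣A∣≤∣reflection∣ {g} = injection⇒∣A∣≤∣B∣ (λ x → g + - x) (λ {x} → reflection⁺ ∘ ∊-resp (g∸g∸ g x)) g∸-injective

  module _ {m} (m≥1 : 1 ≤ m) (greatest : IsGreatest (IncompleteSize 2) m) where

    S⁺ : ∀ {A g} → ∣ A ∣ ≡ m → ¬ g ∊ 2 ⋆ A → S 2 ∣ 2 ⋆ A ∣
    S⁺ ∣A∣≡m g∉ = _ , (1≤∣p∣⇒Nonempty (≡.subst (1 ≤_) (≡.sym ∣A∣≡m) m≥1) , missing⇒≢⊤ g∉) ,
      ≡.trans ∣A∣≡m (≡.sym (χ∸1≡ 2 greatest)) , ≡.refl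

    S⁻ : ∀ {k} → S 2 k → ∃[ A ] ∃[ g ] (∣ A ∣ ≡ m × ¬ g ∊ 2 ⋆ A × ∣ 2 ⋆ A ∣ ≡ k)
    S⁻ (A , (_ , 2A≢⊤) , ∣A∣≡ , ∣2A∣≡k) =
      let (g , g∉) = ≢⊤⇒missing 2A≢⊤ in A , g , ≡.trans ∣A∣≡ (χ∸1≡ 2 greatest) , g∉ , ∣2A∣≡k

  -- Even order

  module HalfSize {A g q} (n≡ : n ≡ q ℕ.+ q) (∣A∣≡q : ∣ A ∣ ≡ q) (g∉ : ¬ g ∊ 2 ⋆ A) where

    ∣∁A∣≡q : ∣ ∁ A ∣ ≡ q
    ∣∁A∣≡q = ℕ.+-cancelʳ-≡ q _ _ (≡.trans (≡.cong (∣ ∁ A ∣ ℕ.+_) (≡.sym ∣A∣≡q)) (≡.trans (∣∁p∣+∣p∣≡n A) n≡))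

    module _ {g′} (g′∉ : ¬ g′ ∊ 2 ⋆ A) where

      ∉⇒∊ : ∀ {x} → ¬ x ∊ A → g′ + - x ∊ A
      ∉⇒∊ x∉ = reflection⁻ (⊆∧∣∣≥⇒∊ {reflection g′ A} {∁ A}
        (λ {x} x∊ → ∁⁺ λ x∊A → missing⇒∉ {A} g′∉ x∊A (reflection⁻ x∊))
        (ℕ.≤-trans (ℕ.≤-reflexive (≡.trans ∣∁A∣≡q (≡.sym ∣A∣≡q))) ∣A∣≤∣reflection∣) (∁⁺ x∉))

    -- The missing elements form the coset g + H of the stabilizer H of A.
    Stabilizes : Carrier → Set c
    Stabilizes h = ∀ x → (x ∊ A → x + h ∊ A) × (x + h ∊ A → x ∊ A)

    stabilizer? : Decidable (λ h → ¬ g + h ∊ 2 ⋆ A)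
    stabilizer? h = ¬? (g + h ∊? 2 ⋆ A)

    abstract
      -- Described through the missing elements, which makes membership decidable and gives the size
      -- of 2A by translation; the next two lemmas identify it with the stabilizer.
      H : Subset n
      H = ⟪ stabilizer? ⟫

      H⁺ : ∀ {h} → ¬ g + h ∊ 2 ⋆ A → h ∊ H
      H⁺ = ∊⟪⟫⁺ stabilizer? (λ h≈k p → p ∘ ∊-resp (+-congˡ (sym h≈k)))

      H⁻ : ∀ {h} → h ∊ H → ¬ g + h ∊ 2 ⋆ A
      H⁻ = ∊⟪⟫⁻ stabilizer? (λ h≈k p → p ∘ ∊-resp (+-congˡ (sym h≈k)))

    -- The reflections x ↦ g - x and x ↦ (g + h) - x both exchange A with its complement, and their
    -- composite is translation by h.
    H⇒stabilizes : ∀ {h} → h ∊ H → Stabilizes h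
    H⇒stabilizes {h} h∊ x =
      (λ x∊ → ∊-resp eq (∉⇒∊ (H⁻ h∊) (missing⇒∉ {A} g∉ x∊))) ,
      (λ x+h∊ → decidable-stable (x ∊? A) λ x∉ → missing⇒∉ {A} (H⁻ h∊) (∉⇒∊ g∉ x∉) (∊-resp (sym eq) x+h∊))
      where
      eq : (g + h) + - (g + - x) ≈ x + h
      eq = solve (g ∷ h ∷ x ∷ []) (λ g h x → (g ⊕ h) ⊖ (g ⊖ x) ⊜ x ⊕ h) ≡.refl

    stabilizes⇒H : ∀ {h} → Stabilizes h → h ∊ H
    stabilizes⇒H {h} stab = H⁺ (∉⇒missing {A} λ {x} x∊ p → missing⇒∉ {A} g∉ x∊ (proj₂ (stab (g + - x))
      (∊-resp (solve (g ∷ h ∷ x ∷ []) (λ g h x → (g ⊕ h) ⊖ x ⊜ (g ⊖ x) ⊕ h) ≡.refl) p)))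

    H≤G : IsSubgroup H
    H≤G = record
      { 0∊ = stabilizes⇒H λ x → ∊-resp (sym (+-identityʳ x)) , ∊-resp (+-identityʳ x)
      ; +∊ = λ {h} {k} h∊ k∊ → stabilizes⇒H λ x →
          (λ x∊ → ∊-resp (+-assoc x h k) (proj₁ (H⇒stabilizes k∊ _) (proj₁ (H⇒stabilizes h∊ x) x∊))) ,
          (λ p → proj₂ (H⇒stabilizes h∊ x) (proj₂ (H⇒stabilizes k∊ _) (∊-resp (sym (+-assoc x h k)) p)))
      ; -∊ = λ {h} h∊ → stabilizes⇒H λ x →
          let eq = solve (x ∷ h ∷ []) (λ x h → x ⊜ x ⊖ h ⊕ h) ≡.refl in
          (λ x∊ → proj₂ (H⇒stabilizes h∊ _) (∊-resp eq x∊)) ,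
          (λ p → ∊-resp (sym eq) (proj₁ (H⇒stabilizes h∊ _) p))
      }

    open Orders H≤G

    A-stable : Stable H A
    A-stable x∊ h∊ = proj₁ (H⇒stabilizes h∊ _) x∊

    ∣2A∣≡ : ∣ 2 ⋆ A ∣ ≡ n ℕ.∸ ∣ H ∣
    ∣2A∣≡ = ∣A∣≡n∸ {2 ⋆ A} (ℕ.≤-antisym
      (injection⇒∣A∣≤∣B∣ {∁ (2 ⋆ A)} {H} (_+ - g) (λ {z} z∊ → H⁺ (∁⁻ z∊ ∘ ∊-resp
        (solve (g ∷ z ∷ []) (λ g z → g ⊕ (z ⊖ g) ⊜ z) ≡.refl))) (∙-cancelʳ _ _ _))
      (injection⇒∣A∣≤∣B∣ {H} {∁ (2 ⋆ A)} (g +_) (∁⁺ ∘ H⁻) (∙-cancelˡ _ _ _)))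

    ∣H∣∣q : ∣ H ∣ ∣ q
    ∣H∣∣q = ≡.subst (∣ H ∣ ∣_) ∣A∣≡q (stable⇒∣H∣∣∣A∣ {A} A-stable)

    module _ (∣A∣≡2∣H∣ : ∣ A ∣ ≡ 2 ℕ.* ∣ H ∣) where

      private
        module _ {a b} (a∊A : a ∊ A) (b∊A : b ∊ A) (b∉a+H : ¬ b ∊ coset a H) where

          a+H∪b+H⊆A : ∀ {x} → x ∊ coset a H ∪ coset b H → x ∊ A
          a+H∪b+H⊆A x∊ = [ stable∸ {H} A-stable a∊A ∘ coset⁻ , stable∸ {H} A-stable b∊A ∘ coset⁻ ]′ (∪⁻ x∊)

          ∣a+H∪b+H∣ : ∣ coset a H ∪ coset b H ∣ ≡ ∣ A ∣
          ∣a+H∪b+H∣ = ≡.trans (∣∪coset∣ coset-stable b∉a+H)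
            (≡.trans (≡.cong₂ ℕ._+_ (∣coset∣ {a}) (≡.sym (ℕ.+-identityʳ ∣ H ∣))) (≡.sym ∣A∣≡2∣H∣))

          cosets : ∀ {x} → x ∊ A → x + - a ∊ H ⊎ x + - b ∊ H
          cosets x∊ = [ inj₁ ∘ coset⁻ , inj₂ ∘ coset⁻ ]′ (∪⁻
            (⊆∧∣∣≥⇒∊ a+H∪b+H⊆A (ℕ.≤-reflexive (≡.sym ∣a+H∪b+H∣)) x∊))

          -- Translation by b - a carries a + H to b + H, and under the hypothesis carries b + H
          -- back to a + H.
          shift : 2 · (b + - a) ∊ H → ∀ {x} → x ∊ A → x + (b + - a) ∊ A
          shift 2u∊ {x} x∊ = [
            (λ p → stable∸ {H} A-stable b∊A (∊-resp
              (solve (x ∷ a ∷ b ∷ []) (λ x a b → x ⊖ a ⊜ x ⊕ (b ⊖ a) ⊖ b) ≡.refl) p)) ,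
            (λ p → stable∸ {H} A-stable a∊A (∊-resp
              (solve (x ∷ a ∷ b ∷ []) (λ x a b → (x ⊖ b) ⊕ 2 ⊛ (b ⊖ a) ⊜ x ⊕ (b ⊖ a) ⊖ a) ≡.refl) (+∊ p 2u∊)))
            ]′ (cosets x∊)

          2u∉H : ¬ 2 · (b + - a) ∊ H
          2u∉H 2u∊ = b∉a+H (coset⁺ (stabilizes⇒H λ x → shift 2u∊ , λ x+u∊ → proj₂ (H⇒stabilizes 2u∊ x)
            (∊-resp (solve (x ∷ b + - a ∷ []) (λ x u → x ⊕ u ⊕ u ⊜ x ⊕ 2 ⊛ u) ≡.refl) (shift 2u∊ x+u∊))))

          order[b-a]≡4 : ∀ {r} → Order H (b + - a) r → r ≡ 4
          order[b-a]≡4 {r} o = order∣4⇒≡4 H≤G o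
            (*-cancelʳ-∣ ∣ H ∣ (≡.subst (r ℕ.* ∣ H ∣ ∣_) n≡4∣H∣ (order*∣H∣∣n o))) 2u∉H
            where
            q≡2∣H∣ = ≡.trans (≡.sym ∣A∣≡q) ∣A∣≡2∣H∣
            n≡4∣H∣ : n ≡ 4 ℕ.* ∣ H ∣
            n≡4∣H∣ = ≡.trans n≡ (≡.trans (≡.cong₂ ℕ._+_ q≡2∣H∣ q≡2∣H∣) (≡.sym (ℕ.*-distribʳ-+ ∣ H ∣ 2 2)))

      4∣annihilator : ∀ {e} → Annihilates e → 4 ∣ e
      4∣annihilator {e} e-annihilates =
        let (a , a∊A , _)   = ∣A∣<∣B∣⇒∃ {∅} {A} ∣∅∣<∣A∣
            (b , b∊A , b∉)  = ∣A∣<∣B∣⇒∃ {coset a H} {A} ∣a+H∣<∣A∣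
            (r , o)         = order (b + - a)
        in ≡.subst (_∣ e) (order[b-a]≡4 a∊A b∊A b∉ o) (order-∣ o (∊-resp (sym (e-annihilates _)) 0∊))
        where
        ∣H∣<∣A∣ : ∣ H ∣ < ∣ A ∣
        ∣H∣<∣A∣ = ≡.subst (∣ H ∣ <_) (≡.sym ∣A∣≡2∣H∣) (ℕ.m<m+n ∣ H ∣ (ℕ.≤-trans 1≤∣H∣ (ℕ.m≤m+n ∣ H ∣ 0)))
        ∣∅∣<∣A∣ : ∣ ∅ {n} ∣ < ∣ A ∣
        ∣∅∣<∣A∣ = ℕ.≤-<-trans (ℕ.≤-trans (ℕ.≤-reflexive (∣⊥∣≡0 n)) z≤n) ∣H∣<∣A∣
        ∣a+H∣<∣A∣ : ∀ {a} → ∣ coset a H ∣ < ∣ A ∣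
        ∣a+H∣<∣A∣ {a} = ≡.subst (_< ∣ A ∣) (≡.sym (∣coset∣ {a})) ∣H∣<∣A∣

  -- The swap construction for even order.

  reflective⇒∣A∣+∣A∣≡n : ∀ {A g} → (∀ {x} → x ∊ A → ¬ g + - x ∊ A) → (∀ {x} → ¬ x ∊ A → g + - x ∊ A) →
    ∣ A ∣ ℕ.+ ∣ A ∣ ≡ n
  reflective⇒∣A∣+∣A∣≡n {A} {g} avoid reflect = ≡.trans (≡.cong (ℕ._+ ∣ A ∣) (ℕ.≤-antisym
    (injection⇒∣A∣≤∣B∣ {A} {∁ A} (λ x → g + - x) (∁⁺ ∘ avoid) g∸-injective)
    (injection⇒∣A∣≤∣B∣ {∁ A} {A} (λ x → g + - x) (reflect ∘ ∁⁻) g∸-injective))) (∣∁p∣+∣p∣≡n A)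

  module Index2 {G₀} (G₀≤G : IsSubgroup G₀) (n≡ : n ≡ ∣ G₀ ∣ ℕ.+ ∣ G₀ ∣) where
    open Subgroup G₀≤G

    ∉⇒∸∊ : ∀ {g x} → ¬ g ∊ G₀ → ¬ x ∊ G₀ → x + - g ∊ G₀
    ∉⇒∸∊ {g} {x} g∉ x∉ = [ (λ x∊ → contradiction x∊ x∉) , coset⁻ ]′ (∪⁻ (≡.subst (x ∊_) (≡.sym all) ∈⊤))
      where
      all : G₀ ∪ coset g G₀ ≡ ⊤
      all = ∣p∣≡n⇒p≡⊤ (≡.trans (∣∪coset∣ (λ x∊ h∊ → +∊ x∊ h∊) g∉) (≡.sym n≡))

    double∊ : ∀ {g} → ¬ g ∊ G₀ → g + g ∊ G₀
    double∊ {g} g∉ = ∊-resp (+-congˡ (⁻¹-involutive g)) (∉⇒∸∊ (g∉ ∘ -∊⁻) g∉)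

  -- (G₀ ∖ H) ∪ (g + H) is G₀ with H swapped for its image under x ↦ g − x.
  module Swap {H G₀ g} (H≤G : IsSubgroup H) (G₀≤G : IsSubgroup G₀) (H⊆G₀ : ∀ {x} → x ∊ H → x ∊ G₀)
              (n≡ : n ≡ ∣ G₀ ∣ ℕ.+ ∣ G₀ ∣) (g∉ : ¬ g ∊ G₀) where
    private
      module H = Subgroup H≤G
      module G₀ = Subgroup G₀≤G
      open Index2 G₀≤G n≡

    Swapped : Carrier → Set
    Swapped x = (x ∊ G₀ × ¬ x ∊ H) ⊎ (x + - g ∊ H)

    swapped? : Decidable Swapped
    swapped? x = ((x ∊? G₀) ×-dec ¬? (x ∊? H)) ⊎-dec (x + - g ∊? H)

    swapped-resp : Swapped Respects _≈_
    swapped-resp eq (inj₁ (p , q)) = inj₁ (∊-resp eq p , q ∘ ∊-resp (sym eq))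
    swapped-resp eq (inj₂ p)       = inj₂ (∊-resp (+-congʳ eq) p)

    abstract
      swapped : Subset n
      swapped = ⟪ swapped? ⟫

      swapped⁺ : ∀ {x} → Swapped x → x ∊ swapped
      swapped⁺ = ∊⟪⟫⁺ swapped? swapped-resp

      swapped⁻ : ∀ {x} → x ∊ swapped → Swapped x
      swapped⁻ = ∊⟪⟫⁻ swapped? swapped-resp

    g∸x∸g : ∀ x → (g + - x) + - g ≈ - x
    g∸x∸g x = solve (g ∷ x ∷ []) (λ g x → (g ⊖ x) ⊖ g ⊜ ⊝ x) ≡.refl

    x∊G₀⇒g∸x∉G₀ : ∀ {x} → x ∊ G₀ → ¬ g + - x ∊ G₀
    x∊G₀⇒g∸x∉G₀ {x} x∊ p = g∉ (∊-resp (solve (g ∷ x ∷ []) (λ g x → (g ⊖ x) ⊕ x ⊜ g) ≡.refl) (G₀.+∊ p x∊))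

    avoid′ : ∀ {x} → Swapped x → ¬ Swapped (g + - x)
    avoid′ (inj₁ (x∊ , _)) (inj₁ (p , _)) = x∊G₀⇒g∸x∉G₀ x∊ p
    avoid′ {x} (inj₁ (_ , x∉)) (inj₂ p)   = x∉ (H.-∊⁻ (∊-resp (g∸x∸g x) p))
    avoid′ {x} (inj₂ p) (inj₁ (_ , q))    = q (∊-resp (solve (g ∷ x ∷ []) (λ g x → ⊝ (x ⊖ g) ⊜ g ⊖ x) ≡.refl) (H.-∊ p))
    avoid′ {x} (inj₂ p) (inj₂ q) = g∉ (∊-resp (solve (g ∷ x ∷ []) (λ g x → x ⊖ (x ⊖ g) ⊜ g) ≡.refl)
      (H⊆G₀ (H.∸∊ (H.-∊⁻ (∊-resp (g∸x∸g x) q)) p)))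

    reflect′ : ∀ {x} → ¬ Swapped x → Swapped (g + - x)
    reflect′ {x} ¬s = by (x ∊? G₀)
      where
      by : Dec (x ∊ G₀) → Swapped (g + - x)
      by (yes x∊) = inj₂ (∊-resp (sym (g∸x∸g x))
        (H.-∊ (decidable-stable (x ∊? H) λ x∉ → ¬s (inj₁ (x∊ , x∉)))))
      by (no x∉) = inj₁ (∊-resp eq (G₀.-∊ (∉⇒∸∊ g∉ x∉)) , λ p → ¬s (inj₂ (H.-∊⁻ (∊-resp (sym eq) p))))
        where eq = solve (g ∷ x ∷ []) (λ g x → ⊝ (x ⊖ g) ⊜ g ⊖ x) ≡.refl

    avoid : ∀ {x} → x ∊ swapped → ¬ g + - x ∊ swapped
    avoid x∊ y∊ = avoid′ (swapped⁻ x∊) (swapped⁻ y∊)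

    reflect : ∀ {x} → ¬ x ∊ swapped → g + - x ∊ swapped
    reflect x∉ = swapped⁺ (reflect′ (x∉ ∘ swapped⁺))

    ∣swapped∣+∣swapped∣≡n : ∣ swapped ∣ ℕ.+ ∣ swapped ∣ ≡ n
    ∣swapped∣+∣swapped∣≡n = reflective⇒∣A∣+∣A∣≡n avoid reflect

    stable : Stable H swapped
    stable {x} {h} x∊ h∊ = swapped⁺ (go (swapped⁻ x∊))
      where
      go : Swapped x → Swapped (x + h)
      go (inj₁ (p , q)) = inj₁ (G₀.+∊ p (H⊆G₀ h∊) ,
        λ r → q (∊-resp (solve (x ∷ h ∷ []) (λ x h → (x ⊕ h) ⊖ h ⊜ x) ≡.refl) (H.∸∊ r h∊)))
      go (inj₂ p) = inj₂ (∊-resp (solve (x ∷ h ∷ g ∷ []) (λ x h g → (x ⊖ g) ⊕ h ⊜ (x ⊕ h) ⊖ g) ≡.refl) (H.+∊ p h∊))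

    g∊swapped : g ∊ swapped
    g∊swapped = swapped⁺ (inj₂ (∊-resp (sym (-‿inverseʳ g)) H.0∊))

    -- Since g is missing and the set is H-stable, all of g + H is missing.
    g+H-missing : ∀ {z} → z + - g ∊ H → ¬ z ∊ 2 ⋆ swapped
    g+H-missing {z} z-g∊ = ∉⇒missing {swapped} λ {x} x∊ p → avoid x∊
      (∊-resp (solve (x ∷ z ∷ g ∷ []) (λ x z g → (z ⊖ x) ⊕ ⊝ (z ⊖ g) ⊜ g ⊖ x) ≡.refl) (stable p (H.-∊ z-g∊)))

    module _ (covers : ∀ {z} → z ∊ G₀ → z ∊ 2 ⋆ swapped) where

      -- Outside G₀ one has z = g + (z - g), where z - g lies in G₀ but not in H. Hence only the
      -- elements of G₀ depend on the size of H.
      covers′ : ∀ {z} → ¬ z + - g ∊ H → z ∊ 2 ⋆ swapped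
      covers′ {z} z-g∉ = by (z ∊? G₀)
        where
        by : Dec (z ∊ G₀) → z ∊ 2 ⋆ swapped
        by (yes z∊) = covers z∊
        by (no z∉)  = ∊-2⋆-via {swapped} g g∊swapped (swapped⁺ (inj₁ (∉⇒∸∊ g∉ z∉ , z-g∉)))

      ∣2swapped∣ : ∣ 2 ⋆ swapped ∣ ≡ n ℕ.∸ ∣ H ∣
      ∣2swapped∣ = ∣A∣≡n∸ {2 ⋆ swapped} (≡.trans
        (≡.cong ∣_∣ (⊆-antisym
          (⊆⁺ {∁ (2 ⋆ swapped)} {coset g H} (λ z∊ → coset⁺ (decidable-stable (_ ∊? H) (∁⁻ z∊ ∘ covers′))))
          (⊆⁺ {coset g H} (∁⁺ ∘ g+H-missing ∘ coset⁻))))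
        ∣coset∣)

    -- Some a ∈ G₀ avoids both H and z + H, and then neither a nor z - a was removed.
    covers-large : ∣ H ∣ ℕ.+ ∣ H ∣ < ∣ G₀ ∣ → ∀ {z} → z ∊ G₀ → z ∊ 2 ⋆ swapped
    covers-large 2H<G₀ {z} z∊ =
      let (a , a∊G₀ , a∉) = ∣A∣<∣B∣⇒∃ {H ∪ coset z H} {G₀} (ℕ.≤-<-trans (∣p∪q∣≤∣p∣+∣q∣ H (coset z H))
                              (≡.subst (λ k → ∣ H ∣ ℕ.+ k < ∣ G₀ ∣) (≡.sym ∣coset∣) 2H<G₀))
      in ∊-2⋆-via {swapped} a (swapped⁺ (inj₁ (a∊G₀ , a∉ ∘ ∪⁺ˡ)))
           (swapped⁺ (inj₁ (G₀.∸∊ z∊ a∊G₀ , λ p → a∉ (∪⁺ʳ {H} (coset⁺ (H.symʰ p))))))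

    -- The set is now the coset g + G₀, and its double is 2g + G₀ = G₀.
    covers-equal : (∀ {x} → x ∊ G₀ → x ∊ H) → ∀ {z} → z ∊ G₀ → z ∊ 2 ⋆ swapped
    covers-equal G₀⊆H {z} z∊ = ∊-2⋆-via {swapped} g g∊swapped (swapped⁺ (inj₂ (G₀⊆H
      (∊-resp (solve (z ∷ g ∷ []) (λ z g → z ⊖ (g ⊕ g) ⊜ (z ⊖ g) ⊖ g) ≡.refl) (G₀.∸∊ z∊ (double∊ g∉))))))

    -- Here G₀ consists of H and 2g + H. Two elements of 2g + H add up to any element of H, and two
    -- elements of g + H to any element of 2g + H.
    covers-half : ∣ G₀ ∣ ≡ ∣ H ∣ ℕ.+ ∣ H ∣ → ¬ g + g ∊ H → ∀ {z} → z ∊ G₀ → z ∊ 2 ⋆ swapped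
    covers-half ∣G₀∣≡ 2g∉H {z} z∊ = by (z ∊? H)
      where
      2g∊G₀ = double∊ g∉

      G₀≡ : ∀ {x} → x ∊ G₀ → x ∊ H ∪ coset (g + g) H
      G₀≡ = ⊆∧∣∣≥⇒∊ {H ∪ coset (g + g) H} {G₀}
        (λ x∊ → [ H⊆G₀ , (λ p → G₀.+∊ (H⊆G₀ (coset⁻ p)) 2g∊G₀ |>
          ∊-resp (solve (_ ∷ g ∷ []) (λ x g → (x ⊖ (g ⊕ g)) ⊕ (g ⊕ g) ⊜ x) ≡.refl)) ]′ (∪⁻ x∊))
        (ℕ.≤-reflexive (≡.trans ∣G₀∣≡ (≡.sym (H.∣∪coset∣ (λ x∊ h∊ → H.+∊ x∊ h∊) 2g∉H))))

      by : Dec (z ∊ H) → z ∊ 2 ⋆ swapped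
      by (yes z∊H) = ∊-2⋆-via {swapped} (g + g) (swapped⁺ (inj₁ (2g∊G₀ , 2g∉H)))
        (swapped⁺ (inj₁ (G₀.∸∊ z∊ 2g∊G₀ , λ p → 2g∉H
          (∊-resp (solve (z ∷ g ∷ []) (λ z g → z ⊖ (z ⊖ (g ⊕ g)) ⊜ g ⊕ g) ≡.refl) (H.∸∊ z∊H p)))))
      by (no z∉H) = [ (λ z∊H → contradiction z∊H z∉H) ,
        (λ p → ∊-2⋆-via {swapped} g g∊swapped (swapped⁺ (inj₂
          (∊-resp (solve (z ∷ g ∷ []) (λ z g → z ⊖ (g ⊕ g) ⊜ (z ⊖ g) ⊖ g) ≡.refl) (coset⁻ p)))))
        ]′ (∪⁻ (G₀≡ z∊))

  -- n − m is the size of 2A for a 2-incomplete set A of size q.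
  Attained : ℕ → ℕ → Set c
  Attained q m = ∃[ A ] ∃[ g ] (∣ A ∣ ≡ q × ¬ g ∊ 2 ⋆ A × ∣ 2 ⋆ A ∣ ≡ n ℕ.∸ m)

  attained⇒greatest : ∀ {q m} → 1 ≤ q → n < suc q ℕ.+ suc q → Attained q m → IsGreatest (IncompleteSize 2) q
  attained⇒greatest q≥1 n<2+2q (A , g , ∣A∣≡q , g∉ , _) =
    (A , (1≤∣p∣⇒Nonempty (≡.subst (1 ≤_) (≡.sym ∣A∣≡q) q≥1) , missing⇒≢⊤ g∉) , ∣A∣≡q) ,
    λ m size → ℕ.≮⇒≥ λ q<m → ℕ.<⇒≱ (ℕ.<-≤-trans n<2+2q (ℕ.+-mono-≤ q<m q<m)) (incompleteSize⇒≤ size)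

  module EvenOrder {q} (n≡ : n ≡ q ℕ.+ q) where

    q<n : q < n
    q<n = ≡.subst (q <_) (≡.sym n≡) (ℕ.m<m+n q (ℕ.n≢0⇒n>0 λ { ≡.refl → ℕ.<⇒≢ 1≤n (≡.sym n≡) }))

    q≥1 : 1 ≤ q
    q≥1 = ℕ.n≢0⇒n>0 λ { ≡.refl → ℕ.<⇒≢ 1≤n (≡.sym n≡) }

    double-injective : ∀ {a b} → a ℕ.+ a ≡ b ℕ.+ b → a ≡ b
    double-injective {a} {b} eq = ℕ.*-cancelˡ-≡ a b 2
      (≡.trans (≡.cong (a ℕ.+_) (ℕ.+-identityʳ a)) (≡.trans eq (≡.sym (≡.cong (b ℕ.+_) (ℕ.+-identityʳ b)))))

    module _ {H G₀ g} (H≤G : IsSubgroup H) (G₀≤G : IsSubgroup G₀) (H⊆G₀ : ∀ {x} → x ∊ H → x ∊ G₀)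
             (∣G₀∣≡q : ∣ G₀ ∣ ≡ q) (g∉ : ¬ g ∊ G₀) where

      n≡′ : n ≡ ∣ G₀ ∣ ℕ.+ ∣ G₀ ∣
      n≡′ = ≡.trans n≡ (≡.sym (≡.cong₂ ℕ._+_ ∣G₀∣≡q ∣G₀∣≡q))

      open Swap H≤G G₀≤G H⊆G₀ n≡′ g∉ public using () renaming
        (swapped to swap; covers-large to swap-large; covers-equal to swap-equal; covers-half to swap-half)
      private module S = Swap H≤G G₀≤G H⊆G₀ n≡′ g∉

      swap-attains : (∀ {z} → z ∊ G₀ → z ∊ 2 ⋆ swap) → Attained q ∣ H ∣
      swap-attains covers = swap , g
        , double-injective (≡.trans S.∣swapped∣+∣swapped∣≡n n≡)
        , S.g+H-missing (∊-resp (sym (-‿inverseʳ g)) (IsSubgroup.0∊ H≤G))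
        , S.∣2swapped∣ covers

    -- With d = 2s, m is n/d = |H| and s is the index of H in G₀. For s ≠ 2 any H ≤ G₀ of these
    -- orders will do; s = 2 takes H from a cyclic quotient of order 4.
    attained : ∀ {m} s → q ≡ s ℕ.* m → (s ≡ 2 → 4 ∣ exponent) → Attained q m
    attained {m} s q≡ 2⇒4∣e = by s q≡ 2⇒4∣e (s ℕ.≟ 2)
      where
      m∣n : m ℕ.* ∣ trivial ∣ ∣ n
      m∣n = ≡.subst (_∣ n) (≡.sym (≡.trans (≡.cong (m ℕ.*_) ∣trivial∣) (ℕ.*-identityʳ m)))
        (≡.subst (m ∣_) (≡.sym n≡) (∣m∣n⇒∣m+n m∣q m∣q))
        where
        m∣q : m ∣ q
        m∣q = divides s q≡

      by : ∀ s → q ≡ s ℕ.* m → (s ≡ 2 → 4 ∣ exponent) → Dec (s ≡ 2) → Attained q m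
      by s q≡ 2⇒4∣e (yes ≡.refl) =
        let (H , y , H≤G , 4H≡n , o) = cyclic-quotient-4 exponent-least (2⇒4∣e ≡.refl)
        in quarter H≤G 4H≡n o
        where
        quarter : ∀ {H y} → IsSubgroup H → 4 ℕ.* ∣ H ∣ ≡ n → Order H y 4 → Attained q m
        quarter {H} {y} H≤G 4H≡n o = ≡.subst (Attained q) H≡m (swap-attains H≤G adjoin≤G H⊆adjoin
          (≡.trans ∣adjoin∣ 2H≡q) y∉ (swap-half H≤G adjoin≤G H⊆adjoin (≡.trans ∣adjoin∣ 2H≡q) y∉
            (≡.trans ∣adjoin∣ (≡.cong (∣ H ∣ ℕ.+_) (ℕ.+-identityʳ _))) (2y∉ ∘ ∊-resp (sym (2·x≈x+x y)))))
          where
          open Orders H≤G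
          2y∉ : ¬ 2 · y ∊ H
          2y∉ = k·x∉ o (s≤s z≤n) (s≤s (s≤s (s≤s z≤n)))
          -- In the cyclic quotient generated by y, G₀ is the subgroup H + ⟨2y⟩ of index 2, and g =
          -- y satisfies 2g ∉ H.
          open Adjoin (prime-order prime[2] H≤G 2y∉ (∊-resp (m*n·x 2 2 y) (r·x∊ o)))
          2H≡q : 2 ℕ.* ∣ H ∣ ≡ q
          2H≡q = double-injective (≡.trans (≡.trans (≡.sym (ℕ.*-distribʳ-+ ∣ H ∣ 2 2)) 4H≡n) n≡)
          H≡m : ∣ H ∣ ≡ m
          H≡m = ℕ.*-cancelˡ-≡ ∣ H ∣ m 2 (≡.trans 2H≡q q≡)
          y∉′ : ∀ j → j < 2 → ¬ y + - (j · 2 · y) ∊ H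
          y∉′ 0 _ p = 2y∉ (∊-resp (solve (y ∷ []) (λ y → 2 ⊛ (y ⊖ 𝟘) ⊜ 2 ⊛ y) ≡.refl) (·∊ 2 p))
          y∉′ 1 _ p = 2y∉ (∊-resp (solve (y ∷ []) (λ y → ⊝ (2 ⊛ (y ⊖ 1 ⊛ (2 ⊛ y))) ⊜ 2 ⊛ y) ≡.refl) (-∊ (·∊ 2 p)))
          y∉′ (suc (suc _)) (s≤s (s≤s ())) _
          y∉ : ¬ y ∊ adjoin (2 · y) 2
          y∉ y∊ = let (j , j<2 , p) = adjoin⁻ y∊ in y∉′ j j<2 p
      by s q≡ _ (no s≢2) =
        let (H , H≤G , _ , ∣H∣≡)      = extend-by m trivial≤G m∣n
            ∣H∣≡m                     = ≡.trans ∣H∣≡ (≡.trans (≡.cong (m ℕ.*_) ∣trivial∣) (ℕ.*-identityʳ m))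
            q≡s∣H∣                    = ≡.trans q≡ (≡.cong (s ℕ.*_) (≡.sym ∣H∣≡m))
            (G₀ , G₀≤G , H⊆G₀ , ∣G₀∣≡) = extend-by s H≤G (≡.subst (_∣ n) q≡s∣H∣ (divides 2 (≡.trans n≡ (≡.cong (q ℕ.+_) (≡.sym (ℕ.+-identityʳ q))))))
            ∣G₀∣≡q                    = ≡.trans ∣G₀∣≡ (≡.sym q≡s∣H∣)
            (g , g∉)                  = Orders.proper⇒∃∉ G₀≤G (≡.subst (_< n) (≡.sym ∣G₀∣≡q) q<n)
        in ≡.subst (Attained q) ∣H∣≡m (swap-attains H≤G G₀≤G H⊆G₀ ∣G₀∣≡q g∉
             (covers s s≢2 ∣G₀∣≡ H≤G G₀≤G H⊆G₀ ∣G₀∣≡q g∉))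
        where
        covers : ∀ {H G₀ g} s → s ≢ 2 → ∣ G₀ ∣ ≡ s ℕ.* ∣ H ∣ →
          (H≤G : IsSubgroup H) (G₀≤G : IsSubgroup G₀) (H⊆G₀ : ∀ {x} → x ∊ H → x ∊ G₀)
          (∣G₀∣≡q : ∣ G₀ ∣ ≡ q) (g∉ : ¬ g ∊ G₀) → ∀ {z} → z ∊ G₀ → z ∊ 2 ⋆ swap H≤G G₀≤G H⊆G₀ ∣G₀∣≡q g∉
        covers {G₀ = G₀} zero _ ∣G₀∣≡ H≤G G₀≤G H⊆G₀ ∣G₀∣≡q g∉ =
          contradiction (≡.sym ∣G₀∣≡) (ℕ.<⇒≢ (Subgroup.1≤∣H∣ G₀≤G))
        covers {H} {G₀} 1 _ ∣G₀∣≡ H≤G G₀≤G H⊆G₀ ∣G₀∣≡q g∉ = swap-equal H≤G G₀≤G H⊆G₀ ∣G₀∣≡q g∉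
          (⊆∧∣∣≥⇒∊ {H} {G₀} H⊆G₀ (ℕ.≤-reflexive (≡.trans ∣G₀∣≡ (ℕ.+-identityʳ ∣ H ∣))))
        covers 2 2≢2 = contradiction ≡.refl 2≢2
        covers {H} {G₀} (suc (suc (suc s))) _ ∣G₀∣≡ H≤G G₀≤G H⊆G₀ ∣G₀∣≡q g∉ = swap-large H≤G G₀≤G H⊆G₀ ∣G₀∣≡q g∉
          (≡.subst (∣ H ∣ ℕ.+ ∣ H ∣ <_) (≡.sym ∣G₀∣≡) (ℕ.+-monoʳ-< ∣ H ∣
            (ℕ.m<m+n ∣ H ∣ (ℕ.≤-trans (Subgroup.1≤∣H∣ H≤G) (ℕ.m≤m+n ∣ H ∣ (s ℕ.* ∣ H ∣))))))

    greatest : IsGreatest (IncompleteSize 2) q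
    greatest = attained⇒greatest {m = q} q≥1
      (≡.subst (_< suc q ℕ.+ suc q) (≡.sym n≡) (ℕ.+-mono-< (ℕ.n<1+n q) (ℕ.n<1+n q)))
      -- With s = 1 the witness is a nontrivial coset of a subgroup of order n/2.
      (attained {q} 1 (≡.sym (ℕ.+-identityʳ q)) (λ ()))

    SizeOf : ℕ → Set
    SizeOf k = ∃[ d ] ∃[ d∣n ] (2 ∣ d × (d ≡ 4 → 4 ∣ exponent) × k ≡ n ℕ.∸ quotient {d} {n} d∣n)

    S⇔ : ∀ k → S 2 k ⇔ SizeOf k
    S⇔ k = mk⇔ S⇒ S⇐
      where
      S⇒ : S 2 k → SizeOf k
      S⇒ k∊S = let (A , g , ∣A∣≡q , g∉ , ∣2A∣≡k) = S⁻ q≥1 greatest k∊S in of A ∣A∣≡q g∉ ∣2A∣≡k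
        where
        of : ∀ A {g} → ∣ A ∣ ≡ q → ¬ g ∊ 2 ⋆ A → ∣ 2 ⋆ A ∣ ≡ k → SizeOf k
        -- The divisor is d = 2s with s = q/|H|, so n/d = |H|; and d = 4 means that A consists of
        -- two cosets of H.
        of A ∣A∣≡q g∉ ∣2A∣≡k = s ℕ.+ s , divides ∣ H ∣ n≡H*2s , divides s (≡.trans (≡.cong (s ℕ.+_) (≡.sym (ℕ.+-identityʳ s))) (ℕ.*-comm 2 s)) ,
          (λ 2s≡4 → 4∣annihilator (≡.trans ∣A∣≡q (≡.trans q≡sH (≡.cong (ℕ._* ∣ H ∣) (double-injective {s} {2} 2s≡4))))
            (proj₂ (proj₁ exponent-least))) ,
          ≡.trans (≡.sym ∣2A∣≡k) ∣2A∣≡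
          where
          open HalfSize {A} n≡ ∣A∣≡q g∉
          s = quotient ∣H∣∣q
          q≡sH : q ≡ s ℕ.* ∣ H ∣
          q≡sH = _∣_.equality ∣H∣∣q
          n≡H*2s : n ≡ ∣ H ∣ ℕ.* (s ℕ.+ s)
          n≡H*2s = ≡.trans n≡ (≡.trans (≡.cong₂ ℕ._+_ q≡sH q≡sH)
            (≡.trans (≡.sym (ℕ.*-distribʳ-+ ∣ H ∣ s s)) (ℕ.*-comm (s ℕ.+ s) ∣ H ∣)))

      S⇐ : SizeOf k → S 2 k
      S⇐ (d , divides m n≡md , divides s d≡s*2 , 4⇒ , k≡) =
        let (A , g , ∣A∣≡q , g∉ , ∣2A∣≡) = attained s q≡sm
              (λ s≡2 → 4⇒ (≡.trans d≡s*2 (≡.cong (ℕ._* 2) s≡2)))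
        in ≡.subst (S 2) (≡.trans ∣2A∣≡ (≡.sym k≡)) (S⁺ q≥1 greatest ∣A∣≡q g∉)
        where
        q≡sm : q ≡ s ℕ.* m
        q≡sm = double-injective (≡.trans (≡.sym n≡) (≡.trans n≡md (≡.trans (≡.cong (m ℕ.*_) d≡s*2)
          (≡.trans (≡.sym (ℕ.*-assoc m s 2)) (≡.trans (ℕ.*-comm (m ℕ.* s) 2)
            (≡.trans (≡.cong (2 ℕ.*_) (ℕ.*-comm m s)) (≡.cong (s ℕ.* m ℕ.+_) (ℕ.+-identityʳ (s ℕ.* m)))))))))

    4∣exponent⇒S⇔ : 4 ∣ exponent → ∀ k →
      S 2 k ⇔ (∃[ d ] ∃[ d∣n ] (2 ∣ d × k ≡ n ℕ.∸ quotient {d} {n} d∣n))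
    4∣exponent⇒S⇔ 4∣e k = mk⇔ (weaken ∘ Equivalence.to (S⇔ k)) (Equivalence.from (S⇔ k) ∘ strengthen)
      where
      weaken : SizeOf k → ∃[ d ] ∃[ d∣n ] (2 ∣ d × k ≡ n ℕ.∸ quotient {d} {n} d∣n)
      weaken (d , d∣n , 2∣d , _ , k≡) = d , d∣n , 2∣d , k≡
      strengthen : ∃[ d ] ∃[ d∣n ] (2 ∣ d × k ≡ n ℕ.∸ quotient {d} {n} d∣n) → SizeOf k
      strengthen (d , d∣n , 2∣d , k≡) = d , d∣n , 2∣d , (λ _ → 4∣e) , k≡

    4∤exponent⇒S⇔ : ¬ 4 ∣ exponent → ∀ k →
      S 2 k ⇔ (∃[ d ] ∃[ d∣n ] (2 ∣ d × d ≢ 4 × k ≡ n ℕ.∸ quotient {d} {n} d∣n))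
    4∤exponent⇒S⇔ 4∤e k = mk⇔ (exclude4 ∘ Equivalence.to (S⇔ k)) (Equivalence.from (S⇔ k) ∘ include)
      where
      exclude4 : SizeOf k → ∃[ d ] ∃[ d∣n ] (2 ∣ d × d ≢ 4 × k ≡ n ℕ.∸ quotient {d} {n} d∣n)
      exclude4 (d , d∣n , 2∣d , 4⇒ , k≡) = d , d∣n , 2∣d , 4∤e ∘ 4⇒ , k≡
      include : ∃[ d ] ∃[ d∣n ] (2 ∣ d × d ≢ 4 × k ≡ n ℕ.∸ quotient {d} {n} d∣n) → SizeOf k
      include (d , d∣n , 2∣d , d≢4 , k≡) = d , d∣n , 2∣d , (λ d≡4 → contradiction d≡4 d≢4) , k≡

    n/2≡q : n / 2 ≡ q
    n/2≡q = ≡.trans (≡.cong (_/ 2) n≡) (q+q/2≡q q)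

  -- Odd order: doubling, reflections with a fixed point, half-sets.

  module OddOrder {q} (n≡ : n ≡ suc (q ℕ.+ q)) where

    ¬2∣1+q+q : ¬ 2 ∣ suc (q ℕ.+ q)
    ¬2∣1+q+q 2∣ = contradiction (∣m+n∣m⇒∣n (≡.subst (2 ∣_) (ℕ.+-comm 1 (q ℕ.+ q)) 2∣)
      (≡.subst (2 ∣_) (≡.cong (q ℕ.+_) (ℕ.+-identityʳ q)) (m∣m*n q))) (from-no (2 ∣? 1))

    ¬2∣n : ¬ 2 ∣ n
    ¬2∣n = ¬2∣1+q+q ∘ ≡.subst (2 ∣_) n≡

    -- The order of x modulo H divides 2, and order 2 would make n even.
    x+x∊⇒x∊ : ∀ {H x} → IsSubgroup H → x + x ∊ H → x ∊ H
    x+x∊⇒x∊ {H} {x} H≤G x+x∊ = let (r , o) = order x in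
      [ (λ r≡1 → ∊-resp (+-identityʳ x) (r·x∊ (≡.subst (Order H x) r≡1 o)))
      , (λ r≡2 → contradiction (∣-trans (m∣m*n ∣ H ∣)
          (order*∣H∣∣n (≡.subst (Order H x) r≡2 o))) ¬2∣n)
      ]′ (irreducible[2] (order-∣ o (∊-resp (sym (2·x≈x+x x)) x+x∊)))
      where open Orders H≤G

    double-injectiveᴳ : ∀ {x y} → x + x ≈ y + y → x ≈ y
    double-injectiveᴳ {x} {y} eq = trivial⁻ (x+x∊⇒x∊ {x = x + - y} trivial≤G (trivial⁺
      (eq ⇒ solve (x ∷ y ∷ []) (λ x y → (x ⊖ y) ⊕ (x ⊖ y) ⊕ (y ⊕ y) ⊜ 𝟘 ⊕ (x ⊕ x)) ≡.refl)))
      ⇒ solve (x ∷ y ∷ []) (λ x y → x ⊕ 𝟘 ⊜ y ⊕ (x ⊖ y)) ≡.refl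

    halvable? : Decidable (λ g → ∃[ c ] c + c ≈ g)
    halvable? g = any-element? (λ c → c + c ≈? g) (λ x≈y eq → trans (+-cong (sym x≈y) (sym x≈y)) eq)

    abstract
      -- Doubling is injective, hence onto. So every reflection x ↦ g - x has a fixed point c, and
      -- every missing element may be written as `c + c`.
      half : ∀ g → ∃[ c ] c + c ≈ g
      half g = ∊⟪⟫⁻ halvable? resp (⊆∧∣∣≥⇒∊ {⟪ halvable? ⟫} {⊤} (λ _ → ∈⊤)
        (injection⇒∣A∣≤∣B∣ {⊤} (λ c → c + c) (λ {c} _ → ∊⟪⟫⁺ halvable? resp (c , refl)) double-injectiveᴳ) ∈⊤)
        where
        resp : (λ g → ∃[ c ] c + c ≈ g) Respects _≈_
        resp g≈h (c , eq) = c , trans eq g≈h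

    module HalfSizeOdd {A : Subset n} (∣A∣≡q : ∣ A ∣ ≡ q) where

      ∣∁A∣≡1+q : ∣ ∁ A ∣ ≡ suc q
      ∣∁A∣≡1+q = ℕ.+-cancelʳ-≡ q _ _ (≡.trans (≡.cong (∣ ∁ A ∣ ℕ.+_) (≡.sym ∣A∣≡q)) (≡.trans (∣∁p∣+∣p∣≡n A) n≡))

      module _ {c} (2c∉ : ¬ c + c ∊ 2 ⋆ A) where

        c∉A : ¬ c ∊ A
        c∉A c∊ = 2c∉ (∊-2⋆⁺ {A} c∊ c∊ refl)

        ∊⇒∉ : ∀ {x} → x ∊ A → ¬ (c + c) + - x ∊ A
        ∊⇒∉ = missing⇒∉ {A} 2c∉

        private
          c∉reflection : ∀ {i} → i ∈ reflection (c + c) A → ¬ i ∈ ⁅ to c ⁆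
          c∉reflection i∈ i∈c with ≡.refl ← x∈⁅y⁆⇒x≡y _ i∈c =
            c∉A (∊-resp (solve (c ∷ []) (λ c → c ⊕ c ⊖ c ⊜ c) ≡.refl) (reflection⁻ i∈))

          B = reflection (c + c) A ∪ ⁅ to c ⁆

          B⊆∁A : ∀ {x} → x ∊ B → x ∊ ∁ A
          B⊆∁A x∊ = [ (λ p → ∁⁺ λ x∊A → ∊⇒∉ x∊A (reflection⁻ p))
                    , (λ p → ∁⁺ λ x∊A → c∉A (≡.subst (_∈ A) (x∈⁅y⁆⇒x≡y _ p) x∊A)) ]′ (∪⁻ x∊)

          ∣∁A∣≤∣B∣ : ∣ ∁ A ∣ ≤ ∣ B ∣
          ∣∁A∣≤∣B∣ = ℕ.≤-trans (ℕ.≤-reflexive (≡.trans ∣∁A∣≡1+q (≡.trans (≡.cong suc (≡.sym ∣A∣≡q)) (ℕ.+-comm 1 ∣ A ∣))))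
            (ℕ.≤-trans (ℕ.+-monoˡ-≤ 1 (∣A∣≤∣reflection∣ {c + c} {A}))
              (ℕ.≤-reflexive (≡.sym (≡.trans (disjoint⇒∣p∪q∣ (reflection (c + c) A) ⁅ to c ⁆ c∉reflection)
                (≡.cong (∣ reflection (c + c) A ∣ ℕ.+_) (∣⁅x⁆∣≡1 (to c)))))))

        ∉⇒∊ : ∀ {x} → ¬ x ∊ A → ¬ x ≈ c → (c + c) + - x ∊ A
        ∉⇒∊ x∉ x≉c = [ reflection⁻ , (λ p → contradiction (to-injective (x∈⁅y⁆⇒x≡y _ p)) x≉c) ]′
          (∪⁻ (⊆∧∣∣≥⇒∊ {B} {∁ A} B⊆∁A ∣∁A∣≤∣B∣ (∁⁺ x∉)))

      three-missing : ∀ {c d e} → ¬ c + c ∊ 2 ⋆ A → ¬ d + d ∊ 2 ⋆ A → ¬ e + e ∊ 2 ⋆ A →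
        c ≈ d ⊎ c ≈ e ⊎ d ≈ e
      three-missing {c} {d} {e} 2c∉ 2d∉ 2e∉ = by (c ≈? d) (c ≈? e) (d ≈? e)
        where
        by : Dec (c ≈ d) → Dec (c ≈ e) → Dec (d ≈ e) → c ≈ d ⊎ c ≈ e ⊎ d ≈ e
        by (yes c≈d) _ _ = inj₁ c≈d
        by _ (yes c≈e) _ = inj₂ (inj₁ c≈e)
        by _ _ (yes d≈e) = inj₂ (inj₂ d≈e)
        by (no c≉d) (no c≉e) (no d≉e) = contradiction
          (∊-resp (solve (c ∷ d ∷ e ∷ []) (λ c d e → (e ⊕ e) ⊖ ((c ⊕ c) ⊖ ((d ⊕ d) ⊖ e)) ⊜ (d ⊕ d) ⊖ ((c ⊕ c) ⊖ e)) ≡.refl)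
            -- The closing reflection x ↦ 2e - x applies only away from its fixed point e; 2c - (2d
            -- - e) = e would give 2c = 2d.
            (∉⇒∊ 2e∉ (∊⇒∉ 2c∉ (∉⇒∊ 2d∉ (c∉A 2e∉) (d≉e ∘ sym))) λ eq → c≉d (double-injectiveᴳ
              (eq ⇒ solve (c ∷ d ∷ e ∷ []) (λ c d e → (c ⊕ c) ⊕ e ⊜ (d ⊕ d) ⊕ ((c ⊕ c) ⊖ ((d ⊕ d) ⊖ e))) ≡.refl))))
          (∊⇒∉ 2d∉ (∉⇒∊ 2c∉ (c∉A 2e∉) (c≉e ∘ sym)))

      two-missing⇒ : ∀ {g h} → ¬ g ≈ h → ¬ g ∊ 2 ⋆ A → ¬ h ∊ 2 ⋆ A → ∣ 2 ⋆ A ∣ ≡ n ℕ.∸ 2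
      two-missing⇒ {g} {h} g≉h g∉ h∉ = ∣A∣≡n∸ {2 ⋆ A} (≡.trans (≡.cong ∣_∣ (⊆-antisym (⊆⁺ one-of) (⊆⁺ ⊆∁)))
        (≡.trans (disjoint⇒∣p∪q∣ ⁅ to g ⁆ ⁅ to h ⁆ λ i∈ i∈′ →
          g≉h (to-injective (≡.trans (≡.sym (x∈⁅y⁆⇒x≡y _ i∈)) (x∈⁅y⁆⇒x≡y _ i∈′))))
          (≡.cong₂ ℕ._+_ (∣⁅x⁆∣≡1 (to g)) (∣⁅x⁆∣≡1 (to h)))))
        where
        ⊆∁ : ∀ {x} → x ∊ ⁅ to g ⁆ ∪ ⁅ to h ⁆ → x ∊ ∁ (2 ⋆ A)
        ⊆∁ x∊ = ∁⁺ λ x∊2A → [ (λ p → g∉ (≡.subst (_∈ 2 ⋆ A) (x∈⁅y⁆⇒x≡y _ p) x∊2A))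
                             , (λ p → h∉ (≡.subst (_∈ 2 ⋆ A) (x∈⁅y⁆⇒x≡y _ p) x∊2A)) ]′ (∪⁻ x∊)

        by-halves : ∀ {x} → ¬ x ∊ 2 ⋆ A → ∃[ c ] c + c ≈ g → ∃[ c ] c + c ≈ h → ∃[ c ] c + c ≈ x →
          x ∊ ⁅ to g ⁆ ∪ ⁅ to h ⁆
        by-halves x∉ (c , 2c≈g) (d , 2d≈h) (e , 2e≈x) =
          [ (λ c≈d → contradiction (trans (sym 2c≈g) (trans (+-cong c≈d c≈d) 2d≈h)) g≉h) ,
          [ (λ c≈e → ∪⁺ˡ (∊-resp (trans (sym 2c≈g) (trans (+-cong c≈e c≈e) 2e≈x)) (x∈⁅x⁆ _))) ,
            (λ d≈e → ∪⁺ʳ {⁅ to g ⁆} (∊-resp (trans (sym 2d≈h) (trans (+-cong d≈e d≈e) 2e≈x)) (x∈⁅x⁆ _))) ]′ ]′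
          (three-missing (g∉ ∘ ∊-resp 2c≈g) (h∉ ∘ ∊-resp 2d≈h) (x∉ ∘ ∊-resp 2e≈x))

        one-of : ∀ {x} → x ∊ ∁ (2 ⋆ A) → x ∊ ⁅ to g ⁆ ∪ ⁅ to h ⁆
        one-of x∊ = by-halves (∁⁻ x∊) (half g) (half h) (half _)

    one-missing⇒ : ∀ {A g} → ¬ g ∊ 2 ⋆ A → (∀ {z} → ¬ z ≈ g → z ∊ 2 ⋆ A) → ∣ 2 ⋆ A ∣ ≡ n ℕ.∸ 1
    one-missing⇒ {A} {g} g∉ others = ∣A∣≡n∸ {2 ⋆ A} (≡.trans (≡.cong ∣_∣ (⊆-antisym
        (⊆⁺ {∁ (2 ⋆ A)} {⁅ to g ⁆} (λ {x} x∊ → ∊-resp (decidable-stable (g ≈? x) λ g≉x → ∁⁻ x∊ (others (g≉x ∘ sym))) (x∈⁅x⁆ _)))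
        (⊆⁺ {⁅ to g ⁆} (λ x∊ → ∁⁺ λ x∊2A → g∉ (≡.subst (_∈ 2 ⋆ A) (x∈⁅y⁆⇒x≡y _ x∊) x∊2A)))))
      (∣⁅x⁆∣≡1 (to g)))

    ∣2A∣≡n∸2⊎n∸1 : ∀ {A g} → ∣ A ∣ ≡ q → ¬ g ∊ 2 ⋆ A → ∣ 2 ⋆ A ∣ ≡ n ℕ.∸ 2 ⊎ ∣ 2 ⋆ A ∣ ≡ n ℕ.∸ 1
    ∣2A∣≡n∸2⊎n∸1 {A} {g} ∣A∣≡q g∉ = by (any-element? (λ h → ¬? (g ≈? h) ×-dec ¬? (h ∊? 2 ⋆ A))
      (λ h≈k (p , r) → (λ g≈k → p (trans g≈k (sym h≈k))) , r ∘ ∊-resp (sym h≈k)))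
      where
      by : Dec (∃[ h ] (¬ g ≈ h × ¬ h ∊ 2 ⋆ A)) → ∣ 2 ⋆ A ∣ ≡ n ℕ.∸ 2 ⊎ ∣ 2 ⋆ A ∣ ≡ n ℕ.∸ 1
      by (yes (h , g≉h , h∉)) = inj₁ (HalfSizeOdd.two-missing⇒ {A} ∣A∣≡q g≉h g∉ h∉)
      by (no ∄) = inj₂ (one-missing⇒ {A} g∉ λ {z} z≉g →
        decidable-stable (z ∊? 2 ⋆ A) λ z∉ → ∄ (z , z≉g ∘ sym , z∉))

    -- One element is taken from each pair ±x with x ≠ 0, so 0 is missing from 2A and the size is
    -- forced. Translating A moves any chosen missing element to 0.
    record HalfSet (A : Subset n) : Set (c ⊔ ℓ) where
      field
        avoids : ∀ {x} → x ∊ A → ¬ - x ∊ A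
        covers : ∀ {x} → ¬ x ≈ 0# → x ∊ A ⊎ - x ∊ A

      0-missing : ¬ 0# ∊ 2 ⋆ A
      0-missing = ∉⇒missing {A} λ x∊ p → avoids x∊ (∊-resp (+-identityˡ _) p)

      ∣A∣≡q : ∣ A ∣ ≡ q
      ∣A∣≡q = ℕ.≤-antisym
        (ℕ.≮⇒≥ λ q<A → ℕ.<⇒≱ (ℕ.<-≤-trans (≡.subst (suc (q ℕ.+ q) <_) (≡.sym (≡.cong suc (ℕ.+-suc q q))) (ℕ.n<1+n _)) (ℕ.+-mono-≤ q<A q<A))
          (≡.subst (∣ A ∣ ℕ.+ ∣ A ∣ ≤_) n≡ (missing⇒∣A∣+∣A∣≤n {A} 0-missing)))
        (ℕ.≮⇒≥ λ A<q → ℕ.<⇒≱ (s≤s (ℕ.+-mono-< A<q A<q)) (ℕ.≤-trans (ℕ.≤-reflexive (≡.sym n≡)) n≤))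
        where
        ∁A→ : ∀ {x} → x ∊ ∁ A → - x ∊ A ∪ ⁅ to 0# ⁆
        ∁A→ {x} x∊ = by (x ≈? 0#)
          where
          by : Dec (x ≈ 0#) → - x ∊ A ∪ ⁅ to 0# ⁆
          by (yes x≈0) = ∪⁺ʳ {A} (∊-resp (sym (trans (-‿cong x≈0) ε⁻¹≈ε)) (x∈⁅x⁆ _))
          by (no x≉0)  = ∪⁺ˡ ([ (λ x∊A → contradiction x∊A (∁⁻ x∊)) , (λ -x∊ → -x∊) ]′ (covers x≉0))

        n≤ : n ≤ suc (∣ A ∣ ℕ.+ ∣ A ∣)
        n≤ = ℕ.≤-trans (ℕ.≤-reflexive (≡.sym (∣∁p∣+∣p∣≡n A)))
          (ℕ.≤-trans (ℕ.+-monoˡ-≤ ∣ A ∣ (ℕ.≤-trans (injection⇒∣A∣≤∣B∣ {∁ A} {A ∪ ⁅ to 0# ⁆} -_ ∁A→ ⁻¹-injective)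
            (∣p∪q∣≤∣p∣+∣q∣ A ⁅ to 0# ⁆)))
          (ℕ.≤-reflexive (≡.cong (ℕ._+ ∣ A ∣) (≡.trans (≡.cong (∣ A ∣ ℕ.+_) (∣⁅x⁆∣≡1 (to 0#))) (ℕ.+-comm ∣ A ∣ 1)))))

    halfSet-attains-2 : ∀ {A g} → HalfSet A → ¬ g ≈ 0# → ¬ g ∊ 2 ⋆ A → Attained q 2
    halfSet-attains-2 {A} {g} half-A g≉0 g∉ =
      A , g , ∣A∣≡q , g∉ , HalfSizeOdd.two-missing⇒ {A} ∣A∣≡q g≉0 g∉ 0-missing
      where open HalfSet half-A

    halfSet-attains-1 : ∀ {A} → HalfSet A → (∀ {z} → ¬ z ≈ 0# → z ∊ 2 ⋆ A) → Attained q 1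
    halfSet-attains-1 {A} half-A others = A , 0# , ∣A∣≡q , 0-missing , one-missing⇒ {A} 0-missing others
      where open HalfSet half-A

    -- Half-systems on the complement of a subgroup

    module HalfSystem {H} (H≤G : IsSubgroup H) where
      open Subgroup H≤G

      PartialHalf : Subset n → Set c
      PartialHalf P = Stable H P × (∀ {x} → x ∊ P → ¬ - x ∊ P)

      ∅-partial : PartialHalf ∅
      ∅-partial = (λ x∊ → contradiction x∊ ∉⊥) , (λ x∊ → contradiction x∊ ∉⊥)

      ∪coset-partial : ∀ {P w} → PartialHalf P → ¬ w ∊ H → ¬ - w ∊ P → PartialHalf (P ∪ coset w H)
      ∪coset-partial {P} {w} (stable , avoids) w∉H -w∉P = ∪coset-stable {P} stable , λ x∊ -x∊ → disjoint (∪⁻ x∊) (∪⁻ -x∊)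
        where
        disjoint : ∀ {x} → x ∊ P ⊎ x ∊ coset w H → ¬ (- x ∊ P ⊎ - x ∊ coset w H)
        disjoint (inj₁ p) (inj₁ r) = avoids p r
        disjoint {x} (inj₁ p) (inj₂ r) = -w∉P (stable∸ {H} stable p
          (∊-resp (solve (x ∷ w ∷ []) (λ x w → ⊝ x ⊖ w ⊜ ⊝ w ⊖ x) ≡.refl) (coset⁻ r)))
        disjoint {x} (inj₂ p) (inj₁ r) = -w∉P (stable∸ {H} stable r
          (∊-resp (solve (x ∷ w ∷ []) (λ x w → x ⊖ w ⊜ ⊝ w ⊖ ⊝ x) ≡.refl) (coset⁻ p)))
        -- If x and -x were both in w + H, then 2w ∈ H, and odd order would put w in H.
        disjoint {x} (inj₂ p) (inj₂ r) = w∉H (x+x∊⇒x∊ H≤G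
          (∊-resp (solve (x ∷ w ∷ []) (λ x w → ⊝ ((x ⊖ w) ⊕ (⊝ x ⊖ w)) ⊜ w ⊕ w) ≡.refl) (-∊ (+∊ (coset⁻ p) (coset⁻ r)))))

      record OuterHalf (P : Subset n) : Set c where
        field
          stable : Stable H P
          avoids : ∀ {x} → x ∊ P → ¬ - x ∊ P
          covers : ∀ {x} → ¬ x ∊ H → x ∊ P ⊎ - x ∊ P

        disjoint : ∀ {x} → x ∊ P → ¬ x ∊ H
        disjoint {x} x∊P x∊H = avoids x∊P (stable∸ {H} stable x∊P (∸∊ (-∊ x∊H) x∊H))

      -- Greedy: as long as neither x nor -x is covered, x + H is added. Starting from a given `P`
      -- allows cosets to be prescribed, which k = 1 requires.
      complete : ∀ {P} → PartialHalf P → ∃[ Q ] (OuterHalf Q × (∀ {x} → x ∊ P → x ∊ Q))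
      complete {P} P-partial = exhaust {Q = λ Q → PartialHalf Q × (∀ {x} → x ∊ P → x ∊ Q)} step P (P-partial , λ x∊ → x∊)
        where
        Result = ∃[ Q ] (OuterHalf Q × (∀ {x} → x ∊ P → x ∊ Q))

        Uncovered : Subset n → Carrier → Set
        Uncovered Q x = ¬ x ∊ H × ¬ x ∊ Q × ¬ - x ∊ Q

        step : ∀ Q → PartialHalf Q × (∀ {x} → x ∊ P → x ∊ Q) →
          Result ⊎ ∃[ R ] ((PartialHalf R × (∀ {x} → x ∊ P → x ∊ R)) × ∣ Q ∣ < ∣ R ∣)
        step Q (Q-partial@(stable , avoids) , P⊆Q) = by (any-element?
          (λ x → ¬? (x ∊? H) ×-dec ¬? (x ∊? Q) ×-dec ¬? (- x ∊? Q))
          (λ x≈y (p , r , s) → p ∘ ∊-resp (sym x≈y) , r ∘ ∊-resp (sym x≈y) , s ∘ ∊-resp (-‿cong (sym x≈y))))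
          where
          by : Dec (∃ (Uncovered Q)) → Result ⊎ ∃[ R ] ((PartialHalf R × (∀ {x} → x ∊ P → x ∊ R)) × ∣ Q ∣ < ∣ R ∣)
          by (yes (x , x∉H , x∉Q , -x∉Q)) = inj₂ (Q ∪ coset x H
            , (∪coset-partial {Q} Q-partial x∉H -x∉Q , (λ y∊ → ∪⁺ˡ (P⊆Q y∊)))
            , ≡.subst (∣ Q ∣ <_) (≡.sym (∣∪coset∣ {Q} stable x∉Q)) (ℕ.m<m+n ∣ Q ∣ 1≤∣H∣))
          by (no ∄) = inj₁ (Q , record { stable = λ {x} {h} → stable {x} {h} ; avoids = λ {x} → avoids {x} ; covers = λ {x} → covers {x} } , λ {x} → P⊆Q {x})
            where
            covers : ∀ {x} → ¬ x ∊ H → x ∊ Q ⊎ - x ∊ Q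
            covers {x} x∉H = decide (x ∊? Q) (- x ∊? Q)
              where
              decide : Dec (x ∊ Q) → Dec (- x ∊ Q) → x ∊ Q ⊎ - x ∊ Q
              decide (yes p) _       = inj₁ p
              decide (no _)  (yes p) = inj₂ p
              decide (no p)  (no r)  = contradiction (x , x∉H , p , r) ∄

      -- If z is no sum of two elements of H ∪ P, then −mz ∈ H ∪ P for all m, by induction:
      -- z = −mz + (m + 1)z gives (m + 1)z ∉ H ∪ P, hence −(m + 1)z ∈ P.
      module _ {P} (outer : OuterHalf P) {z} (z∉H : ¬ z ∊ H) where
        open OuterHalf outer

        private
          In : Carrier → Set
          In x = x ∊ H ⊎ x ∊ P

          Covered : Set _
          Covered = z ∊ P ⊎ ∃[ u ] ∃[ v ] (u ∊ P × v ∊ P × u + v ≈ z)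

          combine : ∀ {u v} → In u → In v → u + v ≈ z → Covered
          combine (inj₁ p) (inj₁ r) eq = contradiction (∊-resp eq (+∊ p r)) z∉H
          combine (inj₁ p) (inj₂ r) eq = inj₁ (∊-resp (trans (+-comm _ _) eq) (stable r p))
          combine (inj₂ p) (inj₁ r) eq = inj₁ (∊-resp eq (stable p r))
          combine (inj₂ p) (inj₂ r) eq = inj₂ (_ , _ , p , r , eq)

          iterate : ∀ m → Covered ⊎ In (- (m · z))
          iterate zero = inj₂ (inj₁ (∊-resp (sym ε⁻¹≈ε) 0∊))
          iterate (suc m) = [ inj₁ , (λ p → by p (suc m · z ∊? H) (suc m · z ∊? P)) ]′ (iterate m)
            where
            eq : - (m · z) + suc m · z ≈ z
            eq = solve (z ∷ m · z ∷ []) (λ z k → ⊝ k ⊕ (z ⊕ k) ⊜ z) ≡.refl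
            by : In (- (m · z)) → Dec (suc m · z ∊ H) → Dec (suc m · z ∊ P) → Covered ⊎ In (- (suc m · z))
            by p (yes r) _       = inj₁ (combine p (inj₁ r) eq)
            by p _       (yes r) = inj₁ (combine p (inj₂ r) eq)
            by p (no r)  (no s)  = inj₂ (inj₂ ([ (λ t → contradiction t s) , (λ t → t) ]′ (covers r)))

          -- At m = e - 1 one has -mz = z, so the induction ends with z itself in H ∪ P, hence in P.
          at-exponent : ∀ e → 1 ≤ e → Annihilates e → Covered
          at-exponent (suc m) _ e-annihilates =
            [ (λ covered → covered) , (λ p → [ (λ r → contradiction (∊-resp eq r) z∉H) , inj₁ ∘ ∊-resp eq ]′ p) ]′ (iterate m)
            where
            eq : - (m · z) ≈ z
            eq = sym (e-annihilates z) ⇒ solve (z ∷ m · z ∷ []) (λ z k → ⊝ k ⊕ (z ⊕ k) ⊜ z ⊕ 𝟘) ≡.refl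

        outer-covers : Covered
        outer-covers = at-exponent exponent (proj₁ (proj₁ exponent-least)) (proj₂ (proj₁ exponent-least))

    -- Joining a half of a cyclic subgroup to a half-system outside it.

    module CyclicSubgroup {t k} (k≥1 : 1 ≤ k) (o : Order trivial t (suc (k ℕ.+ k))) where
      open Orders trivial≤G using (order-∣; k·x∉; r·x∊; adjoin; module Adjoin)
      open Adjoin o using (adjoin⁺; adjoin⁻; ∣adjoin∣) renaming (adjoin≤G to H≤G)
      open Subgroup H≤G using (+∊; -∊; ∸∊; ·∊; 0∊; -∊⁻; symʰ)
      open HalfSystem H≤G

      r : ℕ
      r = suc (k ℕ.+ k)

      H : Subset n
      H = adjoin t r

      ∣H∣≡r : ∣ H ∣ ≡ r
      ∣H∣≡r = ≡.trans ∣adjoin∣ (≡.trans (≡.cong (r ℕ.*_) ∣trivial∣) (ℕ.*-identityʳ r))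

      ·t∊H : ∀ m → m · t ∊ H
      ·t∊H m = adjoin⁺ m (trivial⁺ (-‿inverseʳ _))

      t∊H : t ∊ H
      t∊H = ∊-resp (+-identityʳ t) (·t∊H 1)

      H⁻ : ∀ {z} → z ∊ H → ∃[ m ] (m < r × z ≈ m · t)
      H⁻ {z} z∊ = let (m , m<r , p) = adjoin⁻ z∊ in m , m<r ,
        (trivial⁻ p ⇒ solve (z ∷ m · t ∷ []) (λ z m → z ⊕ 𝟘 ⊜ m ⊕ (z ⊖ m)) ≡.refl)

      ·t≈0⇒∣ : ∀ {m} → m · t ≈ 0# → r ∣ m
      ·t≈0⇒∣ = order-∣ o ∘ trivial⁺

      r·t≈0 : r · t ≈ 0#
      r·t≈0 = trivial⁻ (r·x∊ o)

      ·t≉0 : ∀ {m} → 1 ≤ m → m < r → ¬ m · t ≈ 0#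
      ·t≉0 1≤m m<r = k·x∉ o 1≤m m<r ∘ trivial⁺

      1<r : 1 < r
      1<r = s≤s (ℕ.≤-trans k≥1 (ℕ.m≤m+n k k))

      2<r : 2 < r
      2<r = s≤s (ℕ.+-mono-≤ k≥1 k≥1)

      t≉0 : ¬ t ≈ 0#
      t≉0 = ·t≉0 (s≤s z≤n) 1<r ∘ trans (+-identityʳ t)

      2t≉0 : ¬ t + t ≈ 0#
      2t≉0 = ·t≉0 (s≤s z≤n) 2<r ∘ trans (2·x≈x+x t)

      -- The half-set condition inside H, read on multipliers: `j` stands for jt and `r ∸ j` for
      -- -jt.
      record InnerHalf (J : ℕ → Set) : Set where
        field
          ≥1     : ∀ {j} → J j → 1 ≤ j
          <r     : ∀ {j} → J j → j < r
          avoids : ∀ {i j} → J i → J j → i ℕ.+ j ≢ r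
          covers : ∀ {m} → 1 ≤ m → m < r → J m ⊎ J (r ℕ.∸ m)

      -- Stated for arbitrary half-systems outside H, so as to cover both outer halves and the
      -- flipped sets of `Flip`, which are not unions of cosets.
      module Join {J} (J? : ∀ j → Dec (J j)) (inner : InnerHalf J) {P : Subset n}
        (P∉H : ∀ {x} → x ∊ P → ¬ x ∊ H) (P-avoids : ∀ {x} → x ∊ P → ¬ - x ∊ P)
        (P-covers : ∀ {x} → ¬ x ∊ H → x ∊ P ⊎ - x ∊ P) where

        private module J = InnerHalf inner

        Member : Carrier → Set ℓ
        Member x = (∃[ j ] (J (toℕ {r} j) × x ≈ toℕ j · t)) ⊎ x ∊ P

        member? : Decidable Member
        member? x = Fin.any? (λ j → J? (toℕ j) ×-dec (x ≈? toℕ j · t)) ⊎-dec (x ∊? P)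

        member-resp : Member Respects _≈_
        member-resp x≈y (inj₁ (j , Jj , eq)) = inj₁ (j , Jj , trans (sym x≈y) eq)
        member-resp x≈y (inj₂ p)             = inj₂ (∊-resp x≈y p)

        abstract
          joined : Subset n
          joined = ⟪ member? ⟫

          joined⁺ : ∀ {x} → Member x → x ∊ joined
          joined⁺ = ∊⟪⟫⁺ member? member-resp

          joined⁻ : ∀ {x} → x ∊ joined → Member x
          joined⁻ = ∊⟪⟫⁻ member? member-resp

        P⊆joined : ∀ {x} → x ∊ P → x ∊ joined
        P⊆joined = joined⁺ ∘ inj₂

        ·t∊joined : ∀ {j} → J j → j · t ∊ joined
        ·t∊joined {j} Jj = joined⁺ (inj₁ (fromℕ< (J.<r Jj) ,
          ≡.subst J (≡.sym (Fin.toℕ-fromℕ< (J.<r Jj))) Jj ,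
          ×-congˡ (≡.sym (Fin.toℕ-fromℕ< (J.<r Jj)))))

        t∊joined : J 1 → t ∊ joined
        t∊joined J1 = ∊-resp (+-identityʳ t) (·t∊joined J1)

        sum∊2joined : ∀ {i j m} → J i → J j → i ℕ.+ j ≡ m → m · t ∊ 2 ⋆ joined
        sum∊2joined {i} {j} Ji Jj eq = ∊-2⋆⁺ {joined} (·t∊joined Ji) (·t∊joined Jj)
          (trans (sym (×-homo-+ t i j)) (×-congˡ eq))

        avoids′ : ∀ {x} → Member x → ¬ Member (- x)
        avoids′ {x} (inj₁ (i , Ji , x≈)) (inj₁ (j , Jj , -x≈)) = J.avoids Ji Jj
          (∣∧<⇒≡ (ℕ.≤-trans (J.≥1 Ji) (ℕ.m≤m+n _ _)) (ℕ.+-mono-< (J.<r Ji) (J.<r Jj))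
            (·t≈0⇒∣ (trans (×-homo-+ t (toℕ i) (toℕ j)) (trans (+-cong (sym x≈) (sym -x≈)) (-‿inverseʳ x)))))
        avoids′ (inj₁ (i , Ji , x≈)) (inj₂ p) = P∉H p (-∊ (∊-resp (sym x≈) (·t∊H (toℕ i))))
        avoids′ (inj₂ p) (inj₁ (j , Jj , -x≈)) = P∉H p (-∊⁻ (∊-resp (sym -x≈) (·t∊H (toℕ j))))
        avoids′ (inj₂ p) (inj₂ p′) = P-avoids p p′

        covers′ : ∀ {x} → ¬ x ≈ 0# → x ∊ joined ⊎ - x ∊ joined
        covers′ {x} x≉0 = by (x ∊? H)
          where
          inside-H : ∀ m → m < r → x ≈ m · t → x ∊ joined ⊎ - x ∊ joined
          inside-H zero    _   x≈0 = contradiction x≈0 x≉0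
          inside-H m@(suc _) m<r x≈ = [
            (λ Jm → inj₁ (∊-resp (sym x≈) (·t∊joined Jm))) ,
            (λ Jr-m → inj₂ (∊-resp (trans (∸-· t (ℕ.<⇒≤ m<r)) (trans (+-cong r·t≈0 (-‿cong (sym x≈))) (+-identityˡ _)))
              (·t∊joined Jr-m))) ]′ (J.covers (s≤s z≤n) m<r)

          by : Dec (x ∊ H) → x ∊ joined ⊎ - x ∊ joined
          by (yes x∊H) = let (m , m<r , x≈) = H⁻ x∊H in inside-H m m<r x≈
          by (no x∉H)  = [ inj₁ ∘ P⊆joined , inj₂ ∘ P⊆joined ]′ (P-covers x∉H)

        joined-half : HalfSet joined
        joined-half = record
          { avoids = λ x∊ p → avoids′ (joined⁻ x∊) (joined⁻ p)
          ; covers = covers′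
          }

      Low : ℕ → Set
      Low j = 1 ≤ j × j ≤ k

      low? : ∀ j → Dec (Low j)
      low? j = (1 ℕ.≤? j) ×-dec (j ℕ.≤? k)

      r∸-≥1 : ∀ {m} → m < r → 1 ≤ r ℕ.∸ m
      r∸-≥1 = ℕ.m<n⇒0<n∸m

      r∸1+k : r ℕ.∸ suc k ≡ k
      r∸1+k = ℕ.m+n∸m≡n k k

      low-half : InnerHalf Low
      low-half = record
        { ≥1     = proj₁
        ; <r     = λ (_ , j≤k) → s≤s (ℕ.≤-trans j≤k (ℕ.m≤m+n k k))
        ; avoids = λ (_ , i≤k) (_ , j≤k) eq → ℕ.<⇒≢ (s≤s (ℕ.+-mono-≤ i≤k j≤k)) eq
        ; covers = λ {m} 1≤m m<r → by 1≤m m<r (m ℕ.≤? k)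
        }
        where
        by : ∀ {m} → 1 ≤ m → m < r → Dec (m ≤ k) → Low m ⊎ Low (r ℕ.∸ m)
        by 1≤m _ (yes m≤k) = inj₁ (1≤m , m≤k)
        by 1≤m m<r (no m≰k) = inj₂ (r∸-≥1 m<r , ℕ.≤-trans (ℕ.∸-monoʳ-≤ r (ℕ.≰⇒> m≰k)) (ℕ.≤-reflexive r∸1+k))

      low-1 : Low 1
      low-1 = s≤s z≤n , k≥1

      module LowJoin {P} (outer : OuterHalf P) where
        open OuterHalf outer
        open Join low? low-half disjoint avoids covers

        -- Within H, i + j - 1 lies between 1 and 2k - 1, so (i + j)t ≠ t. A sum of one element of H
        -- and one of P is outside H. For a, b ∈ P with a + b = t, stability puts b - t = -a into P.
        t-avoids : ∀ {a b} → Member a → Member b → ¬ a + b ≈ t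
        t-avoids {a} {b} (inj₁ (i , (1≤i , i≤k) , a≈)) (inj₁ (j , (1≤j , j≤k) , b≈)) a+b≈t =
          ·t≉0 {toℕ i ℕ.+ toℕ j ℕ.∸ 1} (ℕ.m<n⇒0<n∸m (ℕ.+-mono-≤ 1≤i 1≤j))
            (ℕ.≤-<-trans (ℕ.m∸n≤m _ 1) (s≤s (ℕ.+-mono-≤ i≤k j≤k)))
            (trans (∸-· t (ℕ.≤-trans 1≤i (ℕ.m≤m+n _ _))) (trans (+-congʳ (trans (×-homo-+ t (toℕ i) (toℕ j))
              (trans (+-cong (sym a≈) (sym b≈)) a+b≈t))) (solve (t ∷ []) (λ t → t ⊖ 1 ⊛ t ⊜ 𝟘) ≡.refl)))
        t-avoids {a} {b} (inj₁ (i , _ , a≈)) (inj₂ p) a+b≈t = disjoint p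
          (∊-resp (sym a+b≈t ⇒ solve (a ∷ b ∷ t ∷ []) (λ a b t → (t ⊖ a) ⊕ (a ⊕ b) ⊜ b ⊕ t) ≡.refl)
            (∸∊ t∊H (∊-resp (sym a≈) (·t∊H (toℕ i)))))
        t-avoids {a} {b} (inj₂ p) (inj₁ (j , _ , b≈)) a+b≈t = disjoint p
          (∊-resp (sym a+b≈t ⇒ solve (a ∷ b ∷ t ∷ []) (λ a b t → (t ⊖ b) ⊕ (a ⊕ b) ⊜ a ⊕ t) ≡.refl)
            (∸∊ t∊H (∊-resp (sym b≈) (·t∊H (toℕ j)))))
        t-avoids {a} {b} (inj₂ p) (inj₂ p′) a+b≈t = avoids p
          (∊-resp (a+b≈t ⇒ solve (a ∷ b ∷ t ∷ []) (λ a b t → (b ⊖ t) ⊕ t ⊜ ⊝ a ⊕ (a ⊕ b)) ≡.refl)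
            (stable p′ (-∊ t∊H)))

        t-missing : ¬ t ∊ 2 ⋆ joined
        t-missing t∊ = let (a , b , a∊ , b∊ , eq) = ∊-2⋆⁻ {joined} t∊ in t-avoids (joined⁻ a∊) (joined⁻ b∊) eq

        attained-2 : Attained q 2
        attained-2 = halfSet-attains-2 joined-half t≉0 t-missing

      n-2-attained : Attained q 2
      n-2-attained = let (P , outer , _) = complete {∅} ∅-partial in LowJoin.attained-2 outer

      -- For k ≥ 3 the set {1, …, k − 1, k + 1} has all nonzero residues modulo 2k + 1 as sums.
      module Long (k≥3 : 3 ≤ k) where

        J : ℕ → Set
        J j = (1 ≤ j × j < k) ⊎ j ≡ suc k

        J? : ∀ j → Dec (J j)
        J? j = ((1 ℕ.≤? j) ×-dec (j ℕ.<? k)) ⊎-dec (j ℕ.≟ suc k)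

        private
          k<k+k : k < k ℕ.+ k
          k<k+k = ℕ.m<m+n k k≥1

          J<r : ∀ {j} → J j → j < r
          J<r (inj₁ (_ , j<k)) = s≤s (ℕ.≤-trans (ℕ.<⇒≤ j<k) (ℕ.m≤m+n k k))
          J<r (inj₂ ≡.refl)    = s≤s k<k+k

          J-avoids : ∀ {i j} → J i → J j → i ℕ.+ j ≢ r
          J-avoids (inj₁ (_ , i<k)) (inj₁ (_ , j<k)) = ℕ.<⇒≢ (s≤s (ℕ.+-mono-≤ (ℕ.<⇒≤ i<k) (ℕ.<⇒≤ j<k)))
          J-avoids {i} (inj₁ (_ , i<k)) (inj₂ ≡.refl) =
            ℕ.<⇒≢ (≡.subst (_< r) (≡.sym (ℕ.+-suc i k)) (s≤s (ℕ.+-monoˡ-< k i<k)))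
          J-avoids {j = j} (inj₂ ≡.refl) (inj₁ (_ , j<k)) = ℕ.<⇒≢ (s≤s (ℕ.+-monoʳ-< k j<k))
          J-avoids (inj₂ ≡.refl) (inj₂ ≡.refl) = ℕ.>⇒≢ (s≤s (ℕ.+-monoʳ-< k (ℕ.n<1+n k)))

          J-covers : ∀ {m} → 1 ≤ m → m < r → J m ⊎ J (r ℕ.∸ m)
          J-covers {m} 1≤m m<r = by (ℕ.<-cmp m k) (m ℕ.≟ suc k)
            where
            by : _ → Dec (m ≡ suc k) → J m ⊎ J (r ℕ.∸ m)
            by _ (yes m≡1+k) = inj₁ (inj₂ m≡1+k)
            by (tri< m<k _ _) _ = inj₁ (inj₁ (1≤m , m<k))
            by (tri≈ _ ≡.refl _) _ = inj₂ (inj₂ (ℕ.m+n∸n≡m (suc k) k))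
            by (tri> _ _ k<m) (no m≢1+k) = inj₂ (inj₁ (r∸-≥1 m<r ,
              ℕ.<-≤-trans (ℕ.∸-monoʳ-< (ℕ.≤∧≢⇒< k<m (m≢1+k ∘ ≡.sym)) (ℕ.<⇒≤ m<r)) (ℕ.≤-reflexive r∸1+k)))

        J-half : InnerHalf J
        J-half = record
          { ≥1     = [ proj₁ , (λ { ≡.refl → s≤s z≤n }) ]′
          ; <r     = J<r
          ; avoids = J-avoids
          ; covers = J-covers
          }

        J-1 : J 1
        J-1 = inj₁ (s≤s z≤n , ℕ.<-≤-trans (s≤s (s≤s z≤n)) k≥3)

        -- The residue 1 arises by wrapping, from 2(k + 1) = r + 1. Up to k the sums are 1 + (m -
        -- 1), beyond k + 1 they are (k + 1) + (m - k - 1). The value k + 1 is 2 + (k - 1), where 2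
        -- < k is used.
        J-sums : ∀ {m} → 1 ≤ m → m < r → ∃[ i ] ∃[ j ] (J i × J j × (i ℕ.+ j ≡ m ⊎ i ℕ.+ j ≡ m ℕ.+ r))
        J-sums {1} _ _ = suc k , suc k , inj₂ ≡.refl , inj₂ ≡.refl , inj₂ (≡.cong suc (ℕ.+-suc k k))
        J-sums {suc (suc m)} _ m<r = by (suc (suc m) ℕ.≤? k) (suc (suc m) ℕ.≟ suc k)
          where
          by : Dec (suc (suc m) ≤ k) → Dec (suc (suc m) ≡ suc k) → _
          by (yes m≤k) _ = 1 , suc m , J-1 , inj₁ (s≤s z≤n , m≤k) , inj₁ ≡.refl
          by (no _) (yes ≡.refl) = 2 , m , inj₁ (s≤s z≤n , k≥3) , inj₁ (ℕ.≤-trans (s≤s z≤n) (ℕ.s≤s⁻¹ k≥3) , ℕ.n<1+n m) , inj₁ ≡.refl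
          by (no m≰k) (no m≢1+k) = suc k , suc m ℕ.∸ k , inj₂ ≡.refl ,
            inj₁ (ℕ.m<n⇒0<n∸m k<1+m , ℕ.<-≤-trans (ℕ.∸-monoˡ-< {suc m} {k} {k ℕ.+ k} (ℕ.s≤s⁻¹ m<r) (ℕ.<⇒≤ k<1+m)) (ℕ.≤-reflexive (ℕ.m+n∸m≡n k k))) ,
            inj₁ (≡.cong suc (ℕ.m+[n∸m]≡n (ℕ.<⇒≤ k<1+m)))
            where
            k<1+m : k < suc m
            k<1+m = ℕ.s≤s⁻¹ (ℕ.≤∧≢⇒< (ℕ.≰⇒> m≰k) (m≢1+k ∘ ≡.sym))

        module _ {P} (outer : OuterHalf P) where
          open OuterHalf outer
          open Join J? J-half disjoint avoids covers

          outer⇒attained-1 : Attained q 1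
          outer⇒attained-1 = halfSet-attains-1 joined-half all
            where
            in-H : ∀ {z} m → m < r → ¬ z ≈ 0# → z ≈ m · t → z ∊ 2 ⋆ joined
            in-H zero _ z≉0 z≈ = contradiction z≈ z≉0
            in-H m@(suc _) m<r _ z≈ = let (i , j , Ji , Jj , eq) = J-sums (s≤s z≤n) m<r in ∊-resp (sym z≈)
              ([ sum∊2joined Ji Jj
               , (λ i+j≡m+r → ∊-resp (trans (×-homo-+ t m r) (trans (+-congˡ r·t≈0) (+-identityʳ _))) (sum∊2joined Ji Jj i+j≡m+r))
               ]′ eq)

            all : ∀ {z} → ¬ z ≈ 0# → z ∊ 2 ⋆ joined
            all {z} z≉0 = by (z ∊? H)
              where
              by : Dec (z ∊ H) → z ∊ 2 ⋆ joined
              by (yes z∊H) = let (m , m<r , z≈) = H⁻ z∊H in in-H m m<r z≉0 z≈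
              by (no z∉H)  = [
                (λ z∊P → ∊-2⋆-via {joined} t (t∊joined J-1) (P⊆joined (stable z∊P (-∊ t∊H)))) ,
                (λ (u , v , u∊ , v∊ , eq) → ∊-2⋆⁺ {joined} (P⊆joined u∊) (P⊆joined v∊) eq)
                ]′ (outer-covers outer z∉H)

        attained-1 : Attained q 1
        attained-1 = let (P , outer , _) = complete {∅} ∅-partial in outer⇒attained-1 outer

      -- With {1, …, k} in H only t is lost; it is regained as −x + (x + t) after
      -- replacing one element x of P by −x.
      module Flip {P} (outer : OuterHalf P) {x} (x∊P : x ∊ P) where
        private module P = OuterHalf outer

        Flipped : Carrier → Set ℓ
        Flipped y = (y ∊ P × ¬ y ≈ x) ⊎ y ≈ - x

        flipped? : Decidable Flipped
        flipped? y = ((y ∊? P) ×-dec ¬? (y ≈? x)) ⊎-dec (y ≈? - x)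

        flipped-resp : Flipped Respects _≈_
        flipped-resp eq (inj₁ (p , q)) = inj₁ (∊-resp eq p , q ∘ trans eq)
        flipped-resp eq (inj₂ p)       = inj₂ (trans (sym eq) p)

        abstract
          flipped : Subset n
          flipped = ⟪ flipped? ⟫

          flipped⁺ : ∀ {y} → Flipped y → y ∊ flipped
          flipped⁺ = ∊⟪⟫⁺ flipped? flipped-resp

          flipped⁻ : ∀ {y} → y ∊ flipped → Flipped y
          flipped⁻ = ∊⟪⟫⁻ flipped? flipped-resp

        -≈⇒≈- : ∀ {y z} → - y ≈ z → y ≈ - z
        -≈⇒≈- {y} eq = trans (sym (⁻¹-involutive y)) (-‿cong eq)

        x∉H : ¬ x ∊ H
        x∉H = P.disjoint x∊P

        disjoint′ : ∀ {y} → Flipped y → ¬ y ∊ H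
        disjoint′ (inj₁ (p , _)) y∊H = P.disjoint p y∊H
        disjoint′ (inj₂ y≈-x) y∊H    = x∉H (-∊⁻ (∊-resp y≈-x y∊H))

        avoids′ : ∀ {y} → Flipped y → ¬ Flipped (- y)
        avoids′ (inj₁ (p , _)) (inj₁ (p′ , _)) = P.avoids p p′
        avoids′ (inj₁ (_ , y≉x)) (inj₂ eq) = y≉x (⁻¹-injective eq)
        avoids′ (inj₂ eq) (inj₁ (_ , -y≉x)) = -y≉x (trans (-‿cong eq) (⁻¹-involutive x))
        avoids′ (inj₂ eq) (inj₂ eq′) = P.avoids x∊P (∊-resp (trans (sym (⁻¹-injective eq′)) eq) x∊P)

        covers′ : ∀ {y} → ¬ y ∊ H → y ∊ flipped ⊎ - y ∊ flipped
        covers′ {y} y∉H = [ (λ y∊ → by y∊ (y ≈? x)) , (λ -y∊ → by′ -y∊ (- y ≈? x)) ]′ (P.covers y∉H)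
          where
          by : y ∊ P → Dec (y ≈ x) → y ∊ flipped ⊎ - y ∊ flipped
          by _  (yes y≈x) = inj₂ (flipped⁺ (inj₂ (-‿cong y≈x)))
          by y∊ (no y≉x)  = inj₁ (flipped⁺ (inj₁ (y∊ , y≉x)))
          by′ : - y ∊ P → Dec (- y ≈ x) → y ∊ flipped ⊎ - y ∊ flipped
          by′ _   (yes -y≈x) = inj₁ (flipped⁺ (inj₂ (-≈⇒≈- -y≈x)))
          by′ -y∊ (no -y≉x)  = inj₂ (flipped⁺ (inj₁ (-y∊ , -y≉x)))

        open Join low? low-half (disjoint′ ∘ flipped⁻) (λ p p′ → avoids′ (flipped⁻ p) (flipped⁻ p′)) covers′

        P⊆ : ∀ {y} → y ∊ P → ¬ y ≈ x → y ∊ joined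
        P⊆ p y≉x = P⊆joined (flipped⁺ (inj₁ (p , y≉x)))

        t∊2joined : t ∊ 2 ⋆ joined
        t∊2joined = ∊-2⋆⁺ {joined} (P⊆joined (flipped⁺ (inj₂ refl)))
          (P⊆ (P.stable x∊P t∊H) (λ eq → t≉0 (eq ⇒ solve (x ∷ t ∷ []) (λ x t → t ⊕ x ⊜ 𝟘 ⊕ (x ⊕ t)) ≡.refl)))
          (solve (x ∷ t ∷ []) (λ x t → ⊝ x ⊕ (x ⊕ t) ⊜ t) ≡.refl)

        in-H : ∀ {z} m → m < r → ¬ z ≈ 0# → z ≈ m · t → z ∊ 2 ⋆ joined
        in-H zero _ z≉0 z≈ = contradiction z≈ z≉0
        in-H 1 _ _ z≈ = ∊-resp (trans (sym (+-identityʳ t)) (sym z≈)) t∊2joined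
        in-H m@(suc (suc m′)) m<r _ z≈ = ∊-resp (sym z≈) (by (suc m′ ℕ.≤? k))
          where
          by : Dec (suc m′ ≤ k) → m · t ∊ 2 ⋆ joined
          by (yes m′<k) = sum∊2joined low-1 (s≤s z≤n , m′<k) ≡.refl
          by (no m′≮k)  = sum∊2joined (k≥1 , ℕ.≤-refl) (ℕ.m<n⇒0<n∸m k<m ,
            ℕ.≤-trans (ℕ.∸-monoˡ-≤ k (ℕ.s≤s⁻¹ m<r)) (ℕ.≤-reflexive (ℕ.m+n∸m≡n k k))) (ℕ.m+[n∸m]≡n (ℕ.<⇒≤ k<m))
            where
            k<m : k < m
            k<m = ℕ.m≤n⇒m≤1+n (ℕ.≰⇒> m′≮k)

        -- A sum using the lost element x is rewritten as (u + t) + (v - t) or (u - t) + (v + t).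
        -- Not both can meet x again, because v - t = x = v + t would give 2t = 0.
        x-shifted : ∀ {u v z} → u ≈ x → v ∊ P → u + v ≈ z → z ∊ 2 ⋆ joined
        x-shifted {u} {v} {z} u≈x v∊ u+v≈z = by (v + - t ≈? x)
          where
          u∊ : u ∊ P
          u∊ = ∊-resp (sym u≈x) x∊P
          by : Dec (v + - t ≈ x) → z ∊ 2 ⋆ joined
          by (no v-t≉x) = ∊-2⋆⁺ {joined}
            (P⊆ (P.stable u∊ t∊H) λ eq → t≉0 (trans eq (sym u≈x) ⇒ solve (u ∷ t ∷ []) (λ u t → t ⊕ u ⊜ 𝟘 ⊕ (u ⊕ t)) ≡.refl))
            (P⊆ (P.stable v∊ (-∊ t∊H)) v-t≉x)
            (trans (solve (u ∷ v ∷ t ∷ []) (λ u v t → (u ⊕ t) ⊕ (v ⊖ t) ⊜ u ⊕ v) ≡.refl) u+v≈z)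
          by (yes v-t≈x) = ∊-2⋆⁺ {joined}
            (P⊆ (P.stable u∊ (-∊ t∊H)) λ eq → t≉0 (sym (trans eq (sym u≈x)) ⇒ solve (u ∷ t ∷ []) (λ u t → t ⊕ (u ⊖ t) ⊜ 𝟘 ⊕ u) ≡.refl))
            (P⊆ (P.stable v∊ t∊H) λ eq → 2t≉0 (trans eq (sym v-t≈x) ⇒ solve (v ∷ t ∷ []) (λ v t → (t ⊕ t) ⊕ (v ⊖ t) ⊜ 𝟘 ⊕ (v ⊕ t)) ≡.refl))
            (trans (solve (u ∷ v ∷ t ∷ []) (λ u v t → (u ⊖ t) ⊕ (v ⊕ t) ⊜ u ⊕ v) ≡.refl) u+v≈z)

        -- For z ∈ P the decomposition t + (z - t) uses x precisely when z = x + t. This one sum is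
        -- left as a hypothesis because it is recovered differently for k ≥ 2 and for k = 1.
        module _ (x+t∊2joined : x + t ∊ 2 ⋆ joined) where

          all : ∀ {z} → ¬ z ≈ 0# → z ∊ 2 ⋆ joined
          all {z} z≉0 = by (z ∊? H)
            where
            in-P : z ∊ P → Dec (z ≈ x + t) → z ∊ 2 ⋆ joined
            in-P _   (yes z≈x+t) = ∊-resp (sym z≈x+t) x+t∊2joined
            in-P z∊P (no z≉x+t)  = ∊-2⋆-via {joined} t (t∊joined low-1) (P⊆ (P.stable z∊P (-∊ t∊H))
              λ eq → z≉x+t (eq ⇒ solve (x ∷ t ∷ z ∷ []) (λ x t z → z ⊕ x ⊜ (x ⊕ t) ⊕ (z ⊖ t)) ≡.refl))

            sums : ∀ {u v} → u ∊ P → v ∊ P → u + v ≈ z → Dec (u ≈ x) → Dec (v ≈ x) → z ∊ 2 ⋆ joined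
            sums _  v∊ eq (yes u≈x) _         = x-shifted u≈x v∊ eq
            sums u∊ _  eq _         (yes v≈x) = x-shifted v≈x u∊ (trans (+-comm _ _) eq)
            sums u∊ v∊ eq (no u≉x)  (no v≉x)  = ∊-2⋆⁺ {joined} (P⊆ u∊ u≉x) (P⊆ v∊ v≉x) eq

            by : Dec (z ∊ H) → z ∊ 2 ⋆ joined
            by (yes z∊H) = let (m , m<r , z≈) = H⁻ z∊H in in-H m m<r z≉0 z≈
            by (no z∉H)  = [ (λ z∊P → in-P z∊P (z ≈? x + t)) ,
              (λ (u , v , u∊ , v∊ , eq) → sums u∊ v∊ eq (u ≈? x) (v ≈? x)) ]′ (outer-covers outer z∉H)

          attained-1 : Attained q 1
          attained-1 = halfSet-attains-1 joined-half all

        -- Now 2t belongs to the set, and x + t = 2t + (x - t).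
        k≥2⇒attained-1 : 2 ≤ k → Attained q 1
        k≥2⇒attained-1 k≥2 = attained-1 (∊-2⋆⁺ {joined} (·t∊joined (s≤s z≤n , k≥2))
          (P⊆ (P.stable x∊P (-∊ t∊H)) λ eq → t≉0 (sym eq ⇒ solve (x ∷ t ∷ []) (λ x t → t ⊕ (x ⊖ t) ⊜ 𝟘 ⊕ x) ≡.refl))
          (solve (x ∷ t ∷ []) (λ x t → 2 ⊛ t ⊕ (x ⊖ t) ⊜ x ⊕ t) ≡.refl))

        -- A substitute for 2t when k = 1: x + t = y + ((x - y) + t). Neither summand is x, since x
        -- - y and y are outside H.
        split⇒attained-1 : ∀ {y} → y ∊ P → x + - y ∊ P → Attained q 1
        split⇒attained-1 {y} y∊ x-y∊ = attained-1 (∊-2⋆⁺ {joined}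
          (P⊆ y∊ λ y≈x → P.disjoint x-y∊ (∊-resp (sym (trans (+-congˡ (-‿cong y≈x)) (-‿inverseʳ x))) 0∊))
          (P⊆ (P.stable x-y∊ t∊H) λ eq → P.disjoint y∊ (∊-resp
            (eq ⇒ solve (x ∷ y ∷ t ∷ []) (λ x y t → t ⊕ x ⊜ y ⊕ ((x ⊖ y) ⊕ t)) ≡.refl) t∊H))
          (solve (x ∷ y ∷ t ∷ []) (λ x y t → y ⊕ ((x ⊖ y) ⊕ t) ⊜ x ⊕ t) ≡.refl))

      k≥2⇒n-1-attained : 2 ≤ k → r < n → Attained q 1
      k≥2⇒n-1-attained k≥2 r<n =
        let (P , outer , _) = complete {∅} ∅-partial
            (x , x∉H)       = Orders.proper⇒∃∉ H≤G (≡.subst (_< n) (≡.sym ∣H∣≡r) r<n)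
        in [ (λ x∊P → Flip.k≥2⇒attained-1 outer x∊P k≥2) , (λ -x∊P → Flip.k≥2⇒attained-1 outer -x∊P k≥2) ]′
             (OuterHalf.covers outer x∉H)

      -- The cosets of x, y and x - y have to lie in one half-system. This keeps y out of four
      -- cosets: H, x + H (else x - y ∈ H), -x + H (else -y ∈ x + H) and 2x + H (else -(x - y) ∈ x +
      -- H). Each has r elements.
      4r<n⇒n-1-attained : (r ℕ.+ r) ℕ.+ (r ℕ.+ r) < n → Attained q 1
      4r<n⇒n-1-attained 4r<n = let (x , x∉H) = Orders.proper⇒∃∉ H≤G (≡.subst (_< n) (≡.sym ∣H∣≡r)
                                      (ℕ.≤-<-trans (ℕ.≤-trans (ℕ.m≤m+n r r) (ℕ.m≤m+n (r ℕ.+ r) _)) 4r<n))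
                               in from-x x x∉H
        where
        module _ (x : Carrier) (x∉H : ¬ x ∊ H) where

          Excluded : Subset n
          Excluded = (H ∪ coset x H) ∪ (coset (- x) H ∪ coset (x + x) H)

          ∣Excluded∣<n : ∣ Excluded ∣ < n
          ∣Excluded∣<n = ℕ.≤-<-trans (ℕ.≤-trans (∣p∪q∣≤∣p∣+∣q∣ (H ∪ coset x H) _)
            (ℕ.+-mono-≤
              (ℕ.≤-trans (∣p∪q∣≤∣p∣+∣q∣ H _) (ℕ.≤-reflexive (≡.cong₂ ℕ._+_ ∣H∣≡r (≡.trans ∣coset∣ ∣H∣≡r))))
              (ℕ.≤-trans (∣p∪q∣≤∣p∣+∣q∣ (coset (- x) H) _)
                (ℕ.≤-reflexive (≡.cong₂ ℕ._+_ (≡.trans ∣coset∣ ∣H∣≡r) (≡.trans ∣coset∣ ∣H∣≡r)))))) 4r<n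

          module _ (y : Carrier) (y∉ : ¬ y ∊ Excluded) where

            y∉H : ¬ y ∊ H
            y∉H = y∉ ∘ ∪⁺ˡ ∘ ∪⁺ˡ

            y-x∉H : ¬ y + - x ∊ H
            y-x∉H = y∉ ∘ ∪⁺ˡ ∘ ∪⁺ʳ {H} ∘ coset⁺

            y+x∉H : ¬ y + - - x ∊ H
            y+x∉H = y∉ ∘ ∪⁺ʳ {H ∪ coset x H} ∘ ∪⁺ˡ ∘ coset⁺

            y-2x∉H : ¬ y + - (x + x) ∊ H
            y-2x∉H = y∉ ∘ ∪⁺ʳ {H ∪ coset x H} ∘ ∪⁺ʳ {coset (- x) H} ∘ coset⁺

            P₁ P₂ P₃ : Subset n
            P₁ = ∅ ∪ coset x H
            P₂ = P₁ ∪ coset y H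
            P₃ = P₂ ∪ coset (x + - y) H

            P₁-partial : PartialHalf P₁
            P₁-partial = ∪coset-partial {∅} ∅-partial x∉H ∉⊥

            P₂-partial : PartialHalf P₂
            P₂-partial = ∪coset-partial {P₁} P₁-partial y∉H λ p → [ ∉⊥ ,
              (λ p → y+x∉H (∊-resp (solve (x ∷ y ∷ []) (λ x y → ⊝ (⊝ y ⊖ x) ⊜ y ⊖ ⊝ x) ≡.refl) (-∊ (coset⁻ p)))) ]′ (∪⁻ {∅} p)

            P₃-partial : PartialHalf P₃
            P₃-partial = ∪coset-partial {P₂} P₂-partial (y-x∉H ∘ symʰ) λ p → [
              (λ p → [ ∉⊥ , (λ p → y-2x∉H (∊-resp (solve (x ∷ y ∷ []) (λ x y → ⊝ (x ⊖ y) ⊖ x ⊜ y ⊖ (x ⊕ x)) ≡.refl) (coset⁻ p))) ]′ (∪⁻ {∅} p)) ,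
              (λ p → x∉H (∊-resp (solve (x ∷ y ∷ []) (λ x y → ⊝ (⊝ (x ⊖ y) ⊖ y) ⊜ x) ≡.refl) (-∊ (coset⁻ p)))) ]′ (∪⁻ {P₁} p)

            from-y : Attained q 1
            from-y = let (P , outer , P₃⊆P) = complete {P₃} P₃-partial in
              Flip.split⇒attained-1 outer (P₃⊆P (∪⁺ˡ (∪⁺ˡ (∪⁺ʳ {∅} x∊coset))))
                (P₃⊆P (∪⁺ˡ (∪⁺ʳ {P₁} x∊coset))) (P₃⊆P (∪⁺ʳ {P₂} x∊coset))
              where open Subgroup H≤G using (x∊coset)

          from-x : Attained q 1
          from-x = let (y , _ , y∉) = ∣A∣<∣B∣⇒∃ {Excluded} {⊤} (≡.subst (∣ Excluded ∣ <_) (≡.sym (∣⊤∣≡n n)) ∣Excluded∣<n) in from-y y y∉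

  -- Listing the sums of very small sets.

  ∣A∣≤length : ∀ {A} xs → (∀ {z} → z ∊ A → Any (z ≈_) xs) → ∣ A ∣ ≤ length xs
  ∣A∣≤length {A} [] A⊆ = ℕ.≤-trans (∣∣-mono {A} {∅} (λ z∊ → contradiction (A⊆ z∊) λ ())) (ℕ.≤-reflexive (∣⊥∣≡0 n))
  ∣A∣≤length {A} (x ∷ xs) A⊆ = by (x ∊? A)
    where
    rest : ∀ {z} → z ∊ A ∖ to x → Any (z ≈_) xs
    rest {z} z∊ = let (z∊A , z≢x) = x∈p∖y⁻ A z∊ in tail z≢x (A⊆ z∊A)
      where
      tail : to z ≢ to x → Any (z ≈_) (x ∷ xs) → Any (z ≈_) xs
      tail z≢x (here z≈x) = contradiction (to-cong z≈x) z≢x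
      tail _   (there p)  = p

    by : Dec (x ∊ A) → ∣ A ∣ ≤ suc (length xs)
    by (yes x∊) = ≡.subst (_≤ suc (length xs)) (≡.sym (∣p∣≡1+∣p∖x∣ x∊)) (s≤s (∣A∣≤length {A ∖ to x} xs rest))
    by (no x∉)  = ℕ.m≤n⇒m≤1+n (∣A∣≤length {A} xs λ z∊ → rest (x∈p∧x≢y⇒x∈p-y z∊ λ z≡x → x∉ (≡.subst (_∈ A) z≡x z∊)))

  ∣A∖x∣≡ : ∀ {A x m} → x ∊ A → ∣ A ∣ ≡ suc m → ∣ A ∖ to x ∣ ≡ m
  ∣A∖x∣≡ x∊ eq = ℕ.suc-injective (≡.trans (≡.sym (∣p∣≡1+∣p∖x∣ x∊)) eq)

  ∖⁺ : ∀ {A x y} → x ∊ A → ¬ x ≈ y → x ∊ A ∖ to y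
  ∖⁺ x∊ x≉y = x∈p∧x≢y⇒x∈p-y x∊ (x≉y ∘ to-injective)

  ∖⁻ : ∀ {A x y} → x ∊ A ∖ to y → x ∊ A × ¬ x ≈ y
  ∖⁻ {A} x∊ = let (p , q) = x∈p∖y⁻ A x∊ in p , q ∘ to-cong

  ∣A∣≡1+⇒∃ : ∀ {A m} → ∣ A ∣ ≡ suc m → ∃[ x ] x ∊ A
  ∣A∣≡1+⇒∃ {A} eq = let (x , x∊ , _) = ∣A∣<∣B∣⇒∃ {∅} {A} (≡.subst₂ _<_ (≡.sym (∣⊥∣≡0 n)) (≡.sym eq) (s≤s z≤n)) in x , x∊

  ∣A∣≡0⇒∉ : ∀ {A x} → ∣ A ∣ ≡ 0 → ¬ x ∊ A
  ∣A∣≡0⇒∉ ∣A∣≡0 x∊ = contradiction (≡.trans (≡.sym (∣p∣≡1+∣p∖x∣ x∊)) ∣A∣≡0) λ ()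

  unique : ∀ {A x y} → ∣ A ∣ ≡ 1 → x ∊ A → y ∊ A → y ≈ x
  unique {A} {x} {y} ∣A∣≡1 x∊ y∊ = decidable-stable (y ≈? x) λ y≉x →
    ∣A∣≡0⇒∉ {A ∖ to x} (∣A∖x∣≡ {A} x∊ ∣A∣≡1) (∖⁺ {A} y∊ y≉x)

  ∣2A∣≤1 : ∀ {A} → ∣ A ∣ ≡ 1 → ∣ 2 ⋆ A ∣ ≤ 1
  ∣2A∣≤1 {A} ∣A∣≡1 = let (a , a∊) = ∣A∣≡1+⇒∃ {A} ∣A∣≡1 in
    ∣A∣≤length {2 ⋆ A} (a + a ∷ []) λ z∊ → let (x , y , x∊ , y∊ , eq) = ∊-2⋆⁻ {A} z∊ in
      here (trans (sym eq) (+-cong (unique {A} ∣A∣≡1 a∊ x∊) (unique {A} ∣A∣≡1 a∊ y∊)))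

  ∣2A∣≤3 : ∀ {A} → ∣ A ∣ ≡ 2 → ∣ 2 ⋆ A ∣ ≤ 3
  ∣2A∣≤3 {A} ∣A∣≡2 =
    let (a , a∊)  = ∣A∣≡1+⇒∃ {A} ∣A∣≡2
        ∣A∖a∣≡1   = ∣A∖x∣≡ {A} a∊ ∣A∣≡2
        (b , b∊)  = ∣A∣≡1+⇒∃ {A ∖ to a} ∣A∖a∣≡1
        one-of    = λ {x} (x∊ : x ∊ A) → [ inj₁ , (λ x≉a → inj₂ (unique {A ∖ to a} ∣A∖a∣≡1 b∊ (∖⁺ {A} x∊ x≉a))) ]′ (dec (x ≈? a))
    in ∣A∣≤length {2 ⋆ A} (a + a ∷ a + b ∷ b + b ∷ []) λ z∊ →
         let (x , y , x∊ , y∊ , eq) = ∊-2⋆⁻ {A} z∊ in sums (one-of x∊) (one-of y∊) eq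
    where
    dec : ∀ {p} {P : Set p} → Dec P → P ⊎ ¬ P
    dec (yes p) = inj₁ p
    dec (no ¬p) = inj₂ ¬p

    sums : ∀ {a b x y z} → x ≈ a ⊎ x ≈ b → y ≈ a ⊎ y ≈ b → x + y ≈ z → Any (z ≈_) (a + a ∷ a + b ∷ b + b ∷ [])
    sums (inj₁ p) (inj₁ q) eq = here (trans (sym eq) (+-cong p q))
    sums (inj₁ p) (inj₂ q) eq = there (here (trans (sym eq) (+-cong p q)))
    sums (inj₂ p) (inj₁ q) eq = there (here (trans (sym eq) (trans (+-cong p q) (+-comm _ _))))
    sums (inj₂ p) (inj₂ q) eq = there (there (here (trans (sym eq) (+-cong p q))))

  module Exponent3 (3·≈0 : ∀ x → 3 · x ≈ 0#) where

    +3·≈ : ∀ x y → x + 3 · y ≈ x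
    +3·≈ x y = trans (+-congˡ (3·≈0 y)) (+-identityʳ x)

    -- A line x, y, z = −x − y has only 3 pairwise sums, so a fourth point w adds only 4.
    line⇒∣2A∣≤7 : ∀ {A x y z} → ∣ A ∣ ≡ 4 → x ∊ A → y ∊ A → z ∊ A → ¬ y ≈ x → ¬ z ≈ x → ¬ z ≈ y →
      x + y + z ≈ 0# → ∣ 2 ⋆ A ∣ ≤ 7
    line⇒∣2A∣≤7 {A} {x} {y} {z} ∣A∣≡4 x∊ y∊ z∊ y≉x z≉x z≉y x+y+z≈0 =
      let (w , w∊) = ∣A∣≡1+⇒∃ {D} ∣D∣≡1 in from-w w w∊
      where
      B = A ∖ to x
      C = B ∖ to y
      D = C ∖ to z

      ∣D∣≡1 : ∣ D ∣ ≡ 1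
      ∣D∣≡1 = ∣A∖x∣≡ {C} (∖⁺ {B} (∖⁺ {A} z∊ z≉x) z≉y) (∣A∖x∣≡ {B} (∖⁺ {A} y∊ y≉x) (∣A∖x∣≡ {A} x∊ ∣A∣≡4))

      -- In exponent 3 a line with sum 0 has x + y = -z = 2z, so sums of distinct points repeat the
      -- doubles.
      x+y≈2z : x + y ≈ z + z
      x+y≈2z = trans x+y+z≈0 (sym (3·≈0 z)) ⇒
        solve (x ∷ y ∷ z ∷ []) (λ x y z → (x ⊕ y) ⊕ 3 ⊛ z ⊜ (z ⊕ z) ⊕ (x ⊕ y ⊕ z)) ≡.refl
      x+z≈2y : x + z ≈ y + y
      x+z≈2y = trans x+y+z≈0 (sym (3·≈0 y)) ⇒
        solve (x ∷ y ∷ z ∷ []) (λ x y z → (x ⊕ z) ⊕ 3 ⊛ y ⊜ (y ⊕ y) ⊕ (x ⊕ y ⊕ z)) ≡.refl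
      y+z≈2x : y + z ≈ x + x
      y+z≈2x = trans x+y+z≈0 (sym (3·≈0 x)) ⇒
        solve (x ∷ y ∷ z ∷ []) (λ x y z → (y ⊕ z) ⊕ 3 ⊛ x ⊜ (x ⊕ x) ⊕ (x ⊕ y ⊕ z)) ≡.refl

      data Point (w u : Carrier) : Set ℓ where
        is-x : u ≈ x → Point w u
        is-y : u ≈ y → Point w u
        is-z : u ≈ z → Point w u
        is-w : u ≈ w → Point w u

      point : ∀ {w u} → w ∊ D → u ∊ A → Point w u
      point {w} {u} w∊ u∊ = by (u ≈? x) (u ≈? y) (u ≈? z)
        where
        by : Dec (u ≈ x) → Dec (u ≈ y) → Dec (u ≈ z) → Point w u
        by (yes p) _ _ = is-x p
        by _ (yes p) _ = is-y p
        by _ _ (yes p) = is-z p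
        by (no p) (no q) (no r) = is-w (unique {D} ∣D∣≡1 w∊ (∖⁺ {C} (∖⁺ {B} (∖⁺ {A} u∊ p) q) r))

      sums : Carrier → List Carrier
      sums w = x + x ∷ y + y ∷ z + z ∷ x + w ∷ y + w ∷ z + w ∷ w + w ∷ []

      pattern #1 p = here p
      pattern #2 p = there (#1 p)
      pattern #3 p = there (#2 p)
      pattern #4 p = there (#3 p)
      pattern #5 p = there (#4 p)
      pattern #6 p = there (#5 p)
      pattern #7 p = there (#6 p)

      flip-+ : ∀ {s u v} → s ≈ u + v → s ≈ v + u
      flip-+ eq = trans eq (+-comm _ _)

      sum : ∀ {w u v s} → Point w u → Point w v → s ≈ u + v → Any (s ≈_) (sums w)
      sum (is-x p) (is-x q) eq = #1 (trans eq (+-cong p q))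
      sum (is-x p) (is-y q) eq = #3 (trans eq (trans (+-cong p q) x+y≈2z))
      sum (is-x p) (is-z q) eq = #2 (trans eq (trans (+-cong p q) x+z≈2y))
      sum (is-x p) (is-w q) eq = #4 (trans eq (+-cong p q))
      sum (is-y p) (is-x q) eq = #3 (trans (flip-+ eq) (trans (+-cong q p) x+y≈2z))
      sum (is-y p) (is-y q) eq = #2 (trans eq (+-cong p q))
      sum (is-y p) (is-z q) eq = #1 (trans eq (trans (+-cong p q) y+z≈2x))
      sum (is-y p) (is-w q) eq = #5 (trans eq (+-cong p q))
      sum (is-z p) (is-x q) eq = #2 (trans (flip-+ eq) (trans (+-cong q p) x+z≈2y))
      sum (is-z p) (is-y q) eq = #1 (trans (flip-+ eq) (trans (+-cong q p) y+z≈2x))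
      sum (is-z p) (is-z q) eq = #3 (trans eq (+-cong p q))
      sum (is-z p) (is-w q) eq = #6 (trans eq (+-cong p q))
      sum (is-w p) (is-x q) eq = #4 (trans (flip-+ eq) (+-cong q p))
      sum (is-w p) (is-y q) eq = #5 (trans (flip-+ eq) (+-cong q p))
      sum (is-w p) (is-z q) eq = #6 (trans (flip-+ eq) (+-cong q p))
      sum (is-w p) (is-w q) eq = #7 (trans eq (+-cong p q))

      from-w : ∀ w → w ∊ D → ∣ 2 ⋆ A ∣ ≤ 7
      from-w w w∊ = ∣A∣≤length {2 ⋆ A} (sums w) λ s∊ →
        let (u , v , u∊ , v∊ , eq) = ∊-2⋆⁻ {A} s∊ in sum (point w∊ u∊) (point w∊ v∊) (sym eq)

  -- Choosing an element in a nontrivial group of odd order.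

  module NontrivialOddOrder {q} (n≡ : n ≡ suc (q ℕ.+ q)) (q≥1 : 1 ≤ q) where
    open OddOrder {q} n≡

    order∣n : ∀ {x r} → Order trivial x r → r ∣ n
    order∣n {r = r} o = ≡.subst (_∣ n) (≡.trans (≡.cong (r ℕ.*_) ∣trivial∣) (ℕ.*-identityʳ r))
      (Orders.order*∣H∣∣n trivial≤G o)

    1<n : 1 < n
    1<n = ≡.subst (1 <_) (≡.sym n≡) (s≤s (ℕ.≤-trans q≥1 (ℕ.m≤m+n q q)))

    record NontrivialElement : Set c where
      field
        {t}       : Carrier
        {k}       : ℕ
        k≥1       : 1 ≤ k
        order-odd : Order trivial t (suc (k ℕ.+ k))

    nontrivial⇒odd : ∀ {t r} → Order trivial t r → ¬ t ≈ 0# →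
      ∃[ k ] (1 ≤ k × r ≡ suc (k ℕ.+ k))
    nontrivial⇒odd {t} {r} o t≉0 = by (odd-form r (λ 2∣r → ¬2∣n (∣-trans 2∣r (order∣n o)))) o
      where
      by : ∀ {r} → ∃[ k ] r ≡ suc (k ℕ.+ k) → Order trivial t r → ∃[ k ] (1 ≤ k × r ≡ suc (k ℕ.+ k))
      by (zero , ≡.refl) ((_ , 1t∊) , _) = contradiction (trans (sym (+-identityʳ t)) (trivial⁻ 1t∊)) t≉0
      by (suc k , eq) _ = suc k , s≤s z≤n , eq

    nontrivial : NontrivialElement
    nontrivial = let (t , t∉)        = Orders.proper⇒∃∉ trivial≤G (≡.subst (_< n) (≡.sym ∣trivial∣) 1<n)
                     (r , o)         = Orders.order trivial≤G t
                     (k , k≥1 , eq)  = nontrivial⇒odd o (t∉ ∘ trivial⁺)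
                 in record { k≥1 = k≥1 ; order-odd = ≡.subst (Order trivial t) eq o }

    attained-2 : Attained q 2
    attained-2 = CyclicSubgroup.n-2-attained k≥1 order-odd
      where open NontrivialElement nontrivial

    greatest : IsGreatest (IncompleteSize 2) q
    greatest = attained⇒greatest {m = 2} q≥1
      (≡.subst₂ _<_ (≡.sym n≡) (≡.sym (≡.cong suc (ℕ.+-suc q q))) (ℕ.n<1+n _)) attained-2

    attained⇒S : ∀ {m} → Attained q m → S 2 (n ℕ.∸ m)
    attained⇒S (A , g , ∣A∣≡q , g∉ , eq) = ≡.subst (S 2) eq (S⁺ q≥1 greatest ∣A∣≡q g∉)

    S⇒ : ∀ {k} → S 2 k → k ≡ n ℕ.∸ 2 ⊎ k ≡ n ℕ.∸ 1
    S⇒ k∊S = let (A , g , ∣A∣≡q , g∉ , eq) = S⁻ q≥1 greatest k∊S in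
      ≡.subst (λ k → k ≡ n ℕ.∸ 2 ⊎ k ≡ n ℕ.∸ 1) eq (∣2A∣≡n∸2⊎n∸1 {A} ∣A∣≡q g∉)

    -- Order 9

    Cyclic⇒n≤3 : (∀ x → 3 · x ≈ 0#) → Cyclic → n ≤ 3
    Cyclic⇒n≤3 3·≈0 (g , generates) = let (r , o) = order g in bound o
      where
      open Orders trivial≤G
      bound : ∀ {r} → Order trivial g r → n ≤ 3
      bound {r} o = ℕ.≤-trans (ℕ.≤-reflexive (≡.sym (∣⊤∣≡n n))) (ℕ.≤-trans (∣∣-mono {⊤} {adjoin g r} (λ {x} _ → in-adjoin x))
        (ℕ.≤-trans (ℕ.≤-reflexive (≡.trans ∣adjoin∣ (≡.trans (≡.cong (r ℕ.*_) ∣trivial∣) (ℕ.*-identityʳ r))))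
          (∣⇒≤ (order-∣ o (trivial⁺ (3·≈0 g))))))
        where
        open Adjoin o
        multiple∊ : ∀ k → k ·ᶻ g ∊ adjoin g r
        multiple∊ (ℤ.+ k)      = IsSubgroup.·∊ adjoin≤G k x∊adjoin
        multiple∊ (-[1+ k ]) = IsSubgroup.·∊ adjoin≤G (suc k) (IsSubgroup.-∊ adjoin≤G x∊adjoin)
        in-adjoin : ∀ x → x ∊ adjoin g r
        in-adjoin x = let (k , eq) = generates x in ∊-resp eq (multiple∊ k)

    order≡n⇒Cyclic : ∀ {x r} → Order trivial x r → r ≡ n → Cyclic
    order≡n⇒Cyclic {x} {r} o r≡n = x , λ y → let (m , _ , p) = adjoin⁻ (all y) in
      ℤ.+ m , (sym (trivial⁻ p) ⇒ solve (y ∷ m · x ∷ []) (λ y m → m ⊕ (y ⊖ m) ⊜ y ⊕ 𝟘) ≡.refl)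
      where
      open Orders trivial≤G
      open Adjoin o
      all : ∀ y → y ∊ adjoin x r
      all y = ≡.subst (y ∊_) (≡.sym (∣p∣≡n⇒p≡⊤ (≡.trans ∣adjoin∣ (≡.trans (≡.cong (r ℕ.*_) ∣trivial∣)
        (≡.trans (ℕ.*-identityʳ r) r≡n))))) ∈⊤

    order9⊎3· : n ≡ 9 → ∀ x → Order trivial x 9 ⊎ 3 · x ≈ 0#
    order9⊎3· n≡9 x = let (r , o) = Orders.order trivial≤G x in by o (∣9⁻ (≡.subst (r ∣_) n≡9 (order∣n o)))
      where
      by : ∀ {r} → Order trivial x r → r ≡ 1 ⊎ r ≡ 3 ⊎ r ≡ 9 → Order trivial x 9 ⊎ 3 · x ≈ 0#
      by ((_ , x∊) , _) (inj₁ ≡.refl) = inj₂ (trans (×-congʳ 3 (trans (sym (+-identityʳ x)) (trivial⁻ x∊))) (·-0 3))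
      by ((_ , x∊) , _) (inj₂ (inj₁ ≡.refl)) = inj₂ (trivial⁻ x∊)
      by o (inj₂ (inj₂ ≡.refl)) = inj₁ o

    order9⇒attained-1 : ∀ {x} → Order trivial x 9 → Attained q 1
    order9⇒attained-1 o = CyclicSubgroup.Long.attained-1 {k = 4} (s≤s z≤n) o (s≤s (s≤s (s≤s z≤n)))

    Exceptional : Set (c ⊔ ℓ)
    Exceptional = n ≡ 3 ⊎ n ≡ 5 ⊎ (n ≡ 9 × ¬ Cyclic)

    n≡9⇒attained-1 : ¬ Exceptional → n ≡ 9 → Attained q 1
    n≡9⇒attained-1 ¬exc n≡9 = by (any-element? (λ x → ¬? (3 · x ≈? 0#)) (λ x≈y p eq → p (trans (×-congʳ 3 x≈y) eq)))
      where
      by : Dec (∃[ x ] ¬ 3 · x ≈ 0#) → Attained q 1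
      by (yes (x , 3x≉0)) = [ order9⇒attained-1 , (λ 3x≈0 → contradiction 3x≈0 3x≉0) ]′ (order9⊎3· n≡9 x)
      -- If 3 annihilates the group, it cannot be cyclic of order 9, so the excluded case would
      -- hold.
      by (no ∄) = contradiction (inj₂ (inj₂ (n≡9 , λ cyclic → ℕ.<⇒≱ (s≤s (s≤s (s≤s (s≤s z≤n))))
        (≡.subst (_≤ 3) n≡9 (Cyclic⇒n≤3 (λ x → decidable-stable (3 · x ≈? 0#) λ 3x≉0 → ∄ (x , 3x≉0)) cyclic))))) ¬exc

    -- The bound 12 is 4r for r = 3. Odd multiples of 3 other than 3 and 9 start at 15.
    3∣n⇒n>12 : 3 ∣ n → n ≢ 3 → n ≢ 9 → 12 < n
    3∣n⇒n>12 (divides m n≡m*3) n≢3 n≢9 = by m n≡m*3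
      where
      by : ∀ m → n ≡ m ℕ.* 3 → 12 < n
      by 0 eq = contradiction eq (ℕ.>⇒≢ 1≤n)
      by 1 eq = contradiction eq n≢3
      by 2 eq = contradiction (≡.subst (2 ∣_) (≡.sym eq) (divides 3 ≡.refl)) ¬2∣n
      by 3 eq = contradiction eq n≢9
      by 4 eq = contradiction (≡.subst (2 ∣_) (≡.sym eq) (divides 6 ≡.refl)) ¬2∣n
      by (suc (suc (suc (suc (suc m))))) eq = ≡.subst (12 <_) (≡.sym eq) (ℕ.m≤n⇒m≤n+o {13} {15} (m ℕ.* 3) (ℕ.m≤m+n 13 2))

    -- Any nontrivial t serves when n ≠ 9, the construction depending on k alone. Order 9 is
    -- separated because t might have order 3 in a cyclic group, leaving too few cosets.
    ¬exceptional⇒attained-1 : ¬ Exceptional → Attained q 1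
    ¬exceptional⇒attained-1 ¬exc = by (n ℕ.≟ 9) nontrivial
      where
      by-k : ∀ {t} k → 1 ≤ k → Order trivial t (suc (k ℕ.+ k)) → n ≢ 9 → Attained q 1
      by-k 1 k≥1 o n≢9 = CyclicSubgroup.4r<n⇒n-1-attained k≥1 o
        (3∣n⇒n>12 (order∣n o) (¬exc ∘ inj₁) n≢9)
      by-k 2 k≥1 o _ = CyclicSubgroup.k≥2⇒n-1-attained k≥1 o ℕ.≤-refl
        (ℕ.≤∧≢⇒< (∣⇒≤ (order∣n o)) (¬exc ∘ inj₂ ∘ inj₁ ∘ ≡.sym))
      by-k (suc (suc (suc k))) k≥1 o _ = CyclicSubgroup.Long.attained-1 k≥1 o (s≤s (s≤s (s≤s z≤n)))

      by : Dec (n ≡ 9) → NontrivialElement → Attained q 1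
      by (yes n≡9) _ = n≡9⇒attained-1 ¬exc n≡9
      by (no n≢9)  e = by-k (NontrivialElement.k e) (NontrivialElement.k≥1 e) (NontrivialElement.order-odd e) n≢9

    module NineNoncyclic {A c} (3·≈0 : ∀ x → 3 · x ≈ 0#) (∣A∣≡4 : ∣ A ∣ ≡ 4) (∣A∣≡q : ∣ A ∣ ≡ q) (2c∉ : ¬ c + c ∊ 2 ⋆ A) where
      open Exponent3 3·≈0
      open HalfSizeOdd {A} ∣A∣≡q using (c∉A; ∊⇒∉; ∉⇒∊)

      ≉c : ∀ {x} → x ∊ A → ¬ x ≈ c
      ≉c x∊ x≈c = c∉A 2c∉ (∊-resp x≈c x∊)

      -- a, w = c + (a − c) + (b − c) and c + (a − c) − (b − c) are collinear.
      through : ∀ {a b} → a ∊ A → b ∊ A → (c + c) + (a + b) ∊ A → (a + - b) + c ∊ A → ∣ 2 ⋆ A ∣ ≤ 7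
      through {a} {b} a∊ b∊ w∊ d∊ = line⇒∣2A∣≤7 {A} ∣A∣≡4 a∊ w∊ d∊
        (λ w≈a → ≉c b∊ (trans w≈a (sym (+3·≈ a c)) ⇒
          solve (a ∷ b ∷ c ∷ []) (λ a b c → b ⊕ (a ⊕ 3 ⊛ c) ⊜ c ⊕ ((c ⊕ c) ⊕ (a ⊕ b))) ≡.refl))
        (λ d≈a → ≉c b∊ (sym d≈a ⇒ solve (a ∷ b ∷ c ∷ []) (λ a b c → b ⊕ ((a ⊖ b) ⊕ c) ⊜ c ⊕ a) ≡.refl))
        (λ d≈w → ≉c b∊ (trans (+3·≈ _ b) d≈w ⇒
          solve (a ∷ b ∷ c ∷ []) (λ a b c → b ⊕ ((c ⊕ c) ⊕ (a ⊕ b)) ⊜ c ⊕ ((a ⊖ b) ⊕ c ⊕ 3 ⊛ b)) ≡.refl))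
        (trans (solve (a ∷ b ∷ c ∷ []) (λ a b c → a ⊕ ((c ⊕ c) ⊕ (a ⊕ b)) ⊕ ((a ⊖ b) ⊕ c) ⊜ 3 ⊛ a ⊕ 3 ⊛ c) ≡.refl)
          (trans (+-cong (3·≈0 a) (3·≈0 c)) (+-identityˡ 0#)))

      -- The points c + (a - b) and c - (a - b) are exchanged by the reflection about c, so one of
      -- them lies in A; the second case is the first with a and b interchanged.
      by-difference : ∀ {a b} → a ∊ A → b ∊ A → ¬ a ≈ b → (c + c) + (a + b) ∊ A → Dec ((a + - b) + c ∊ A) → ∣ 2 ⋆ A ∣ ≤ 7
      by-difference a∊ b∊ _ w∊ (yes d∊) = through a∊ b∊ w∊ d∊
      by-difference {a} {b} a∊ b∊ a≉b w∊ (no d∉) = through b∊ a∊ (∊-resp (+-congˡ (+-comm a b)) w∊)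
        (∊-resp (solve (a ∷ b ∷ c ∷ []) (λ a b c → (c ⊕ c) ⊖ ((a ⊖ b) ⊕ c) ⊜ (b ⊖ a) ⊕ c) ≡.refl)
          (∉⇒∊ 2c∉ d∉ λ d≈c → a≉b (d≈c ⇒ solve (a ∷ b ∷ c ∷ []) (λ a b c → a ⊕ c ⊜ b ⊕ ((a ⊖ b) ⊕ c)) ≡.refl)))

      -- The third point of the line through a and b is -(a + b). If it is not in A, its reflection
      -- 2c + a + b is, provided it differs from c; and -(a + b) = c would make b = 2c - a, the
      -- reflection of a.
      by-sum : ∀ {a b} → a ∊ A → b ∊ A → ¬ a ≈ b → Dec (- (a + b) ∊ A) → ∣ 2 ⋆ A ∣ ≤ 7
      by-sum {a} {b} a∊ b∊ a≉b (yes z∊) = line⇒∣2A∣≤7 {A} ∣A∣≡4 a∊ b∊ z∊ (a≉b ∘ sym)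
        (λ z≈a → a≉b (trans (+3·≈ _ a) z≈a ⇒
          solve (a ∷ b ∷ []) (λ a b → a ⊕ a ⊜ b ⊕ (⊝ (a ⊕ b) ⊕ 3 ⊛ a)) ≡.refl))
        (λ z≈b → a≉b (sym (trans (+3·≈ _ b) z≈b) ⇒
          solve (a ∷ b ∷ []) (λ a b → a ⊕ (⊝ (a ⊕ b) ⊕ 3 ⊛ b) ⊜ b ⊕ b) ≡.refl))
        (-‿inverseʳ (a + b))
      by-sum {a} {b} a∊ b∊ a≉b (no z∉) = by-difference a∊ b∊ a≉b
        (∊-resp (solve (a ∷ b ∷ c ∷ []) (λ a b c → (c ⊕ c) ⊖ ⊝ (a ⊕ b) ⊜ (c ⊕ c) ⊕ (a ⊕ b)) ≡.refl)
          (∉⇒∊ 2c∉ z∉ λ z≈c → ∊⇒∉ 2c∉ a∊ (∊-resp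
            (sym (trans (+3·≈ _ c) z≈c) ⇒
              solve (a ∷ b ∷ c ∷ []) (λ a b c → b ⊕ (⊝ (a ⊕ b) ⊕ 3 ⊛ c) ⊜ ((c ⊕ c) ⊖ a) ⊕ c) ≡.refl) b∊)))
        (_ ∊? A)

      ∣2A∣≤7 : ∣ 2 ⋆ A ∣ ≤ 7
      ∣2A∣≤7 =
        let (a , a∊)   = ∣A∣≡1+⇒∃ {A} ∣A∣≡4
            (b , b∊′)  = ∣A∣≡1+⇒∃ {A ∖ to a} (∣A∖x∣≡ {A} a∊ ∣A∣≡4)
            (b∊ , b≉a) = ∖⁻ {A} b∊′
        in by-sum a∊ b∊ (b≉a ∘ sym) (_ ∊? A)

    exceptional⇒∣2A∣≤n∸2 : Exceptional → ∀ {A g} → ∣ A ∣ ≡ q → ¬ g ∊ 2 ⋆ A → ∣ 2 ⋆ A ∣ ≤ n ℕ.∸ 2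
    exceptional⇒∣2A∣≤n∸2 exc {A} {g} ∣A∣≡q g∉ = by exc
      where
      ∣A∣≡ : ∀ m → n ≡ suc (m ℕ.+ m) → ∣ A ∣ ≡ m
      ∣A∣≡ m n≡1+2m = ≡.trans ∣A∣≡q (ℕ.*-cancelˡ-≡ q m 2 (≡.trans (≡.cong (q ℕ.+_) (ℕ.+-identityʳ q))
        (≡.trans (ℕ.suc-injective (≡.trans (≡.sym n≡) n≡1+2m)) (≡.sym (≡.cong (m ℕ.+_) (ℕ.+-identityʳ m))))))

      ≤n∸2 : ∀ {m} → n ≡ m → ∣ 2 ⋆ A ∣ ≤ m ℕ.∸ 2 → ∣ 2 ⋆ A ∣ ≤ n ℕ.∸ 2
      ≤n∸2 n≡m = ≡.subst (λ m → ∣ 2 ⋆ A ∣ ≤ m ℕ.∸ 2) (≡.sym n≡m)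

      by : Exceptional → ∣ 2 ⋆ A ∣ ≤ n ℕ.∸ 2
      by (inj₁ n≡3) = ≤n∸2 n≡3 (∣2A∣≤1 {A} (∣A∣≡ 1 n≡3))
      by (inj₂ (inj₁ n≡5)) = ≤n∸2 n≡5 (∣2A∣≤3 {A} (∣A∣≡ 2 n≡5))
      by (inj₂ (inj₂ (n≡9 , ¬cyclic))) = let (c , 2c≈g) = half g in ≤n∸2 n≡9
        (NineNoncyclic.∣2A∣≤7 {A} 3·≈0 (∣A∣≡ 4 n≡9) ∣A∣≡q (g∉ ∘ ∊-resp 2c≈g))
        where
        3·≈0 : ∀ x → 3 · x ≈ 0#
        3·≈0 x = [ (λ o → contradiction (order≡n⇒Cyclic o (≡.sym n≡9)) ¬cyclic) , (λ eq → eq) ]′ (order9⊎3· n≡9 x)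

    exceptional-S⇔ : Exceptional → ∀ k → S 2 k ⇔ (k ≡ n ℕ.∸ 2)
    exceptional-S⇔ exc k = mk⇔ S⇒n∸2 (λ { ≡.refl → attained⇒S {2} attained-2 })
      where
      n∸2<n∸1 : n ℕ.∸ 2 < n ℕ.∸ 1
      n∸2<n∸1 = ℕ.∸-monoʳ-< (ℕ.n<1+n 1) 1<n
      S⇒n∸2 : S 2 k → k ≡ n ℕ.∸ 2
      S⇒n∸2 k∊S = let (A , g , ∣A∣≡q , g∉ , eq) = S⁻ q≥1 greatest k∊S in
        ≡.trans (≡.sym eq) ([ (λ p → p) , (λ p → contradiction (≡.subst (_≤ n ℕ.∸ 2) p
          (exceptional⇒∣2A∣≤n∸2 exc {A} ∣A∣≡q g∉)) (ℕ.<⇒≱ n∸2<n∸1)) ]′ (∣2A∣≡n∸2⊎n∸1 {A} ∣A∣≡q g∉))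

    nonexceptional-S⇔ : ¬ Exceptional → ∀ k → S 2 k ⇔ (k ≡ n ℕ.∸ 2 ⊎ k ≡ n ℕ.∸ 1)
    nonexceptional-S⇔ ¬exc k = mk⇔ S⇒ [ (λ { ≡.refl → attained⇒S {2} attained-2 }) ,
      (λ { ≡.refl → attained⇒S {1} (¬exceptional⇒attained-1 ¬exc) }) ]′

    [n-1]/2≡q : (n ℕ.∸ 1) / 2 ≡ q
    [n-1]/2≡q = ≡.trans (≡.cong (λ m → (m ℕ.∸ 1) / 2) n≡) (q+q/2≡q q)

theorem1p1 : ∀ {c ℓ} (G : AbelianGroup c ℓ) {n : ℕ} (ι : G HasOrder n) → 2 ≤ n →
    let open FiniteAbelianGroup G ι in
    (2 ∣ n →
    IsGreatest (IncompleteSize 2) (n / 2)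
    × (∀ k → S 2 k ⇔
    (∃[ d ] Σ[ d∣n ∈ d ∣ n ] (2 ∣ d × (d ≡ 4 → 4 ∣ exponent) × k ≡ n ∸ quotient d∣n)))
    × (4 ∣ exponent →
    ∀ k → S 2 k ⇔
    (∃[ d ] Σ[ d∣n ∈ d ∣ n ] (2 ∣ d × k ≡ n ∸ quotient d∣n)))
    × (2 ∣ exponent → ¬ (4 ∣ exponent) →
    ∀ k → S 2 k ⇔
    (∃[ d ] Σ[ d∣n ∈ d ∣ n ] (2 ∣ d × d ≢ 4 × k ≡ n ∸ quotient d∣n))))
    ×
    (¬ (2 ∣ n) →
    IsGreatest (IncompleteSize 2) ((n ∸ 1) / 2)
    × ((n ≡ 3 ⊎ n ≡ 5 ⊎ (n ≡ 9 × ¬ Cyclic)) →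
    ∀ k → S 2 k ⇔ (k ≡ n ∸ 2))
    × (¬ (n ≡ 3 ⊎ n ≡ 5 ⊎ (n ≡ 9 × ¬ Cyclic)) →
    ∀ k → S 2 k ⇔ (k ≡ n ∸ 2 ⊎ k ≡ n ∸ 1)))
theorem1p1 G {n} ι 2≤n
  = (λ 2∣n → let q = quotient 2∣n ; n≡ = 2∣⇒≡q+q 2∣n in
      ≡.subst (IsGreatest (IncompleteSize 2)) (≡.sym (EvenOrder.n/2≡q {q} n≡)) (EvenOrder.greatest {q} n≡)
      , EvenOrder.S⇔ {q} n≡ , EvenOrder.4∣exponent⇒S⇔ {q} n≡ , λ _ → EvenOrder.4∤exponent⇒S⇔ {q} n≡)
  , (λ ¬2∣n → let (q , n≡) = odd-form n ¬2∣n ; q≥1 = 1<1+q+q⇒1≤q (≡.subst (1 <_) n≡ 2≤n) in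
      ≡.subst (IsGreatest (IncompleteSize 2)) (≡.sym (NontrivialOddOrder.[n-1]/2≡q {q} n≡ q≥1)) (NontrivialOddOrder.greatest {q} n≡ q≥1)
      , NontrivialOddOrder.exceptional-S⇔ {q} n≡ q≥1 , NontrivialOddOrder.nonexceptional-S⇔ {q} n≡ q≥1)
  where
  open Sumsets G ι using (module EvenOrder; module NontrivialOddOrder)
  open FiniteAbelianGroup G ι using (IncompleteSize)
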